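{- Let $C$ be an extremal binary doubly even self-dual code of length $n$, and let $s(C)$ and $\delta(C)$ be as defined in the context. (1) If $n=24m$, then $\delta(C)=s(C)=5$ or $\delta(C)=s(C)=7$. (2) If $n=24m+8$, then $\delta(C)=s(C)=3$ or $5\le \delta(C)\le s(C)\le 7$. (3) If $n=24m+16$, then $\delta(C)=s(C)=1$ or $3\le \delta(C)\le s(C)\le 5$.
   Context: A binary doubly even self-dual code of length $n$ is a binary linear code $C\subseteq\mathbb{F}_2^n$ with $C=C^\perp$ (with respect to the standard inner product) such that every codeword has Hamming weight divisible by $4$; then $8\mid n$. Such a code is extremal if its minimum nonzero weight equals $4\lfloor n/24\rfloor+4$. A $t$-$(v,k,\lambda)$ design is a pair $(X,\mathcal{B})$ with $|X|=v$ and $\mathcal{B}$ a collection of $k$-subsets of $X$ (blocks) such that every $t$-subset of $X$ is contained in exactly $\lambda$ blocks. For a codeword $c=(c_1,\dots,c_n)$, $\mathrm{supp}(c)=\{i: c_i\neq 0\}$. For a weight $w$ with $w\equiv 0\pmod 4$ and $4\lfloor n/24\rfloor+4\le w\le n-(4\lfloor n/24\rfloor+4)$, the support design $D_w$ of $C$ has point set $\{1,\dots,n\}$ and as blocks the supports of all codewords of $C$ of weight $w$. Define $s(C)=\max\{t\in\mathbb{N}: \text{there exists such a } w \text{ with } D_w \text{ a } t\text{ -design}\}$ and $\delta(C)=\max\{t\in\mathbb{N}: D_w \text{ is a } t\text{ -design for every such } w\}$. -}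

module Defs where

open import Data.Bool using (Bool; true; false; _∧_; _xor_; if_then_else_)
open import Data.Nat using (ℕ; zero; suc; _+_; _*_; _∸_; _≤_; _<_)
open import Data.Nat.DivMod using (_/_)
open import Data.Nat.Divisibility using (_∣_)
open import Data.Vec using (Vec; []; _∷_; zipWith)
open import Data.List using (List; []; _∷_; map; _++_; filterᵇ; length)
open import Data.Fin.Subset using (Subset; ⊥; _∩_; ∣_∣)
open import Data.Product using (Σ; _×_; ∃)
open import Relation.Binary.PropositionalEquality using (_≡_)
open import Function.Bundles using (_⇔_)

-- Words of F₂ⁿ are identified with subsets of {1..n} (their supports):
-- a word is a 'Subset n' = 'Vec Bool n'; true = coordinate 1.
-- The zero word is ⊥, the Hamming weight is ∣_∣, and the support of a word is the word itself.

_⊕_ : ∀ {n} → Subset n → Subset n → Subset n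
_⊕_ = zipWith _xor_

-- Standard inner product over F₂ vanishes iff ∣ x ∩ y ∣ is even.
Orth : ∀ {n} → Subset n → Subset n → Set
Orth x y = 2 ∣ ∣ x ∩ y ∣

Code : ℕ → Set
Code n = Subset n → Bool

_∈C_ : ∀ {n} → Subset n → Code n → Set
x ∈C C = C x ≡ true

IsLinear : ∀ {n} → Code n → Set
IsLinear C = (⊥ ∈C C) × (∀ x y → x ∈C C → y ∈C C → (x ⊕ y) ∈C C)

IsSelfDual : ∀ {n} → Code n → Set
IsSelfDual C = ∀ x → (x ∈C C) ⇔ (∀ y → y ∈C C → Orth x y)

IsDoublyEven : ∀ {n} → Code n → Set
IsDoublyEven C = ∀ x → x ∈C C → 4 ∣ ∣ x ∣

IsDoublyEvenSelfDual : ∀ {n} → Code n → Set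
IsDoublyEvenSelfDual C = IsLinear C × IsSelfDual C × IsDoublyEven C

dExt : ℕ → ℕ
dExt n = 4 * (n / 24) + 4

IsExtremal : ∀ {n} → Code n → Set
IsExtremal {n} C =
  (∃ λ x → x ∈C C × ∣ x ∣ ≡ dExt n) ×
  (∀ x → x ∈C C → 0 < ∣ x ∣ → dExt n ≤ ∣ x ∣)

allWords : (n : ℕ) → List (Subset n)
allWords zero = [] ∷ []
allWords (suc n) = map (true ∷_) (allWords n) ++ map (false ∷_) (allWords n)

_==ℕ_ : ℕ → ℕ → Bool
zero ==ℕ zero = true
zero ==ℕ suc _ = false
suc _ ==ℕ zero = false
suc m ==ℕ suc n = m ==ℕ n

_⊆ᵇ_ : ∀ {n} → Subset n → Subset n → Bool
[] ⊆ᵇ [] = true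
(true ∷ s) ⊆ᵇ (true ∷ t) = s ⊆ᵇ t
(true ∷ s) ⊆ᵇ (false ∷ t) = false
(false ∷ s) ⊆ᵇ (_ ∷ t) = s ⊆ᵇ t

-- number of blocks of D_w containing T = number of codewords of weight w whose support contains T
blocksThrough : ∀ {n} → Code n → ℕ → Subset n → ℕ
blocksThrough {n} C w T =
  length (filterᵇ (λ x → C x ∧ ((∣ x ∣ ==ℕ w) ∧ (T ⊆ᵇ x))) (allWords n))

Admissible : ℕ → ℕ → Set
Admissible n w = (4 ∣ w) × (dExt n ≤ w) × (w + dExt n ≤ n)

-- D_w is a t-(n,w,λ) design for some λ (with the standard convention t ≤ k = w)
IsDesignD : ∀ {n} → Code n → ℕ → ℕ → Set
IsDesignD {n} C w t =
  (t ≤ w) × Σ ℕ (λ lam → ∀ (T : Subset n) → ∣ T ∣ ≡ t → blocksThrough C w T ≡ lam)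

IsS : ∀ {n} → Code n → ℕ → Set
IsS {n} C s =
  (Σ ℕ λ w → Admissible n w × IsDesignD C w s) ×
  (∀ t w → Admissible n w → IsDesignD C w t → t ≤ s)

IsDelta : ∀ {n} → Code n → ℕ → Set
IsDelta {n} C δ =
  (∀ w → Admissible n w → IsDesignD C w δ) ×
  (∀ t → (∀ w → Admissible n w → IsDesignD C w t) → t ≤ δ)

{-# OPTIONS --safe #-}
module Submission where

-- D_w is a t-design iff the Specht sums Σ ∏ (c_a - c_b), over the codewords c of weight w and over a system
-- of k pairwise disjoint pairs (a , b), vanish for 1 ≤ k ≤ t. For a fixed system the generating series of these
-- sums over w is, by self-duality and divisibility by 4, (X(1-X⁴))^k times a form that is invariant under the
-- substitution of MacWilliams' identity; since the code has no small weights, that form is divisible by a high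
-- power of Δ = X⁴(1-X⁴)⁴, and what remains is 0 or a multiple of 1, F = 1+14X⁴+X⁸, or F². Hence one weight where
-- the corresponding coefficient is nonzero decides whether all Specht sums of degree k vanish, which gives the
-- lower bounds on δ and the equalities. For the upper bounds on s, the numbers A_d and A_(d+4) of codewords of
-- the two smallest weights are residues of powers of Δ/F³; A_(d+4) < 0 for large m, so only finitely many m
-- remain. These are excluded by the integrality of the block numbers of D_w or of a weighted union of D_d and
-- D_(n-d), or by the parity of the block intersections |c ∩ x|.

open import Defs
open import Algebra.Bundles using (CommutativeRing)
open import Algebra.Structures using (IsCommutativeRing)
import Algebra.Solver.Ring
import Algebra.Solver.Ring.AlmostCommutativeRing as ACR
open import Data.Bool using (Bool; true; false; if_then_else_; _xor_; _∧_; _∨_; not)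
import Data.Bool as Bool
import Data.Bool.Properties as Bool
open import Data.Empty using (⊥-elim) renaming (⊥ to Empty)
open import Data.Fin as Fin using (Fin; zero; suc)
import Data.Fin.Properties as Fin
open import Data.Fin.Subset using (Subset; ⊥; _∩_; ∣_∣)
open import Data.Fin.Subset.Properties using (anySubset?)
open import Data.Integer as ℤ using (ℤ; +_; -[1+_]; 0ℤ; 1ℤ; -1ℤ)
  renaming (_+_ to _+ᶻ_; _*_ to _*ᶻ_; -_ to -ᶻ_; _-_ to _-ᶻ_)
import Data.Integer.Properties as ℤ
open import Data.Integer.Tactic.RingSolver using (solve-∀)
open import Data.List as List using (List; []; _∷_; length; _++_; map; filterᵇ)
open import Data.List.Properties using (++-identityʳ; length-++; length-map)
open import Data.List.Relation.Unary.All as All using (All; []; _∷_)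
open import Data.List.Relation.Unary.All.Properties using (++⁻ˡ; ++⁻ʳ; ++⁺)
open import Data.List.Relation.Unary.AllPairs using ([]; _∷_)
open import Data.List.Relation.Unary.Unique.Propositional using (Unique)
import Data.List.Relation.Unary.Unique.Propositional.Properties as Unique
open import Data.Maybe using (Maybe; just; nothing)
open import Data.Nat as ℕ using (ℕ; zero; suc; _+_; _*_; _∸_; _≤_; _<_; _≤ᵇ_; z≤n; s≤s)
open import Data.Nat.DivMod using (_/_; m*n/n≡m; +-distrib-/-∣ˡ)
open import Data.Nat.Divisibility using (divides; _∣?_; ∣m+n∣m⇒∣n; ∣m∣n⇒∣m+n; ∣-refl; m∣m*n) renaming (_∣_ to _∣ⁿ_)
import Data.Nat.Properties as ℕ
import Data.Nat.Tactic.RingSolver as ℕ-Solver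
open import Data.Product using (Σ; _×_; _,_; proj₁; proj₂)
open import Data.Sum using (_⊎_; inj₁; inj₂; [_,_]′)
open import Data.Vec as Vec using (Vec; []; _∷_; lookup; _[_]≔_; replicate)
open import Data.Vec.Properties using (lookup∘update; lookup∘update′; lookup-replicate)
open import Function using (_∘_)
open import Function.Bundles using (Equivalence)
open import Level using (0ℓ)
open import Relation.Binary.PropositionalEquality
open import Relation.Nullary using (¬_; Dec; yes; no; does; contradiction)
open import Relation.Nullary.Decidable using (_×-dec_; ¬?; decidable-stable; map′)

-- The origin of the numbers 5, 3, 1: let d be the least weight and L + 1 the number of admissible
-- weights. In degree k there remains a form of degree q = L + k - d in (1+X)⁴ and (1-X)⁴, where L -
-- d is -6, -4, -2 for n ≡ 0, 8, 16 mod 24. For q < 0 all sums vanish, so strength 5, 3, 1 is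
-- certain. For q = 0 the sums over the weights are proportional to the coefficients of (1-X)^L,
-- none of which is 0. For q = 1 no nonzero form has the required gaps, which is why the strength
-- jumps by two as soon as one weight does better. The obstacle is q = 3, that is degree 7 for n ≡ 8
-- and degree 5 for n ≡ 16. Complementation multiplies sums of odd degree by -1, so at weight n/2
-- they vanish in every code, and a design at that weight says nothing about the other weights in
-- this degree. The union of D_d and D_(n-d) serves to bypass the degree; q = 2 and q = 4 supply the
-- degrees around it.

cancelˡ : ∀ a {b} → a ≢ 0ℤ → a *ᶻ b ≡ 0ℤ → b ≡ 0ℤ
cancelˡ a ne e with ℤ.i*j≡0⇒i≡0∨j≡0 a e
... | inj₁ z = contradiction z ne
... | inj₂ z = z

suc-cancel : ∀ k a → + suc k *ᶻ a ≡ 0ℤ → a ≡ 0ℤ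
suc-cancel k a = cancelˡ (+ suc k) (λ ())

-- Formal power series

Ser : Set
Ser = ℕ → ℤ

infix 4 _≈_
_≈_ : Ser → Ser → Set
f ≈ g = ∀ k → f k ≡ g k

tail : Ser → Ser
tail f k = f (suc k)

κ : ℤ → Ser
κ a zero = a
κ a (suc _) = 0ℤ

infixl 6 _+ˢ_
infixl 7 _*ˢ_
infix 8 -ˢ_

_+ˢ_ : Ser → Ser → Ser
(f +ˢ g) k = f k +ᶻ g k

-ˢ_ : Ser → Ser
(-ˢ f) k = -ᶻ f k

_*ˢ_ : Ser → Ser → Ser
(f *ˢ g) zero = f 0 *ᶻ g 0
(f *ˢ g) (suc k) = f 0 *ᶻ g (suc k) +ᶻ (tail f *ˢ g) k

*ˢ-cong : ∀ {f f′ g g′} → f ≈ f′ → g ≈ g′ → f *ˢ g ≈ f′ *ˢ g′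
*ˢ-cong p q zero = cong₂ _*ᶻ_ (p 0) (q 0)
*ˢ-cong p q (suc k) = cong₂ _+ᶻ_ (cong₂ _*ᶻ_ (p 0) (q (suc k))) (*ˢ-cong (λ j → p (suc j)) q k)

*ˢ-distribʳ : ∀ h f g → (f +ˢ g) *ˢ h ≈ f *ˢ h +ˢ g *ˢ h
*ˢ-distribʳ h f g zero = ℤ.*-distribʳ-+ (h 0) (f 0) (g 0)
*ˢ-distribʳ h f g (suc k) rewrite *ˢ-distribʳ h (tail f) (tail g) k =
  lem (f 0) (g 0) (h (suc k)) _ _
  where
  lem : ∀ a b c x y → (a +ᶻ b) *ᶻ c +ᶻ (x +ᶻ y) ≡ (a *ᶻ c +ᶻ x) +ᶻ (b *ᶻ c +ᶻ y)
  lem = solve-∀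

*ˢ-snoc : ∀ f g k → (f *ˢ g) (suc k) ≡ (f *ˢ tail g) k +ᶻ f (suc k) *ᶻ g 0
*ˢ-snoc f g zero = refl
*ˢ-snoc f g (suc k) rewrite *ˢ-snoc (tail f) g k =
  sym (ℤ.+-assoc (f 0 *ᶻ g (suc (suc k))) _ _)

*ˢ-comm : ∀ f g → f *ˢ g ≈ g *ˢ f
*ˢ-comm f g zero = ℤ.*-comm (f 0) (g 0)
*ˢ-comm f g (suc k) = begin
  f 0 *ᶻ g (suc k) +ᶻ (tail f *ˢ g) k  ≡⟨ cong₂ _+ᶻ_ (ℤ.*-comm (f 0) (g (suc k))) (*ˢ-comm (tail f) g k) ⟩
  g (suc k) *ᶻ f 0 +ᶻ (g *ˢ tail f) k  ≡⟨ ℤ.+-comm (g (suc k) *ᶻ f 0) _ ⟩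
  (g *ˢ tail f) k +ᶻ g (suc k) *ᶻ f 0  ≡⟨ *ˢ-snoc g f k ⟨
  (g *ˢ f) (suc k)                     ∎
  where open ≡-Reasoning

*ˢ-distribˡ : ∀ h f g → h *ˢ (f +ˢ g) ≈ h *ˢ f +ˢ h *ˢ g
*ˢ-distribˡ h f g k = trans (*ˢ-comm h (f +ˢ g) k)
  (trans (*ˢ-distribʳ h f g k) (cong₂ _+ᶻ_ (*ˢ-comm f h k) (*ˢ-comm g h k)))

scale-*ˢ : ∀ a f g k → ((λ j → a *ᶻ f j) *ˢ g) k ≡ a *ᶻ (f *ˢ g) k
scale-*ˢ a f g zero = ℤ.*-assoc a (f 0) (g 0)
scale-*ˢ a f g (suc k) rewrite scale-*ˢ a (tail f) g k = lem a (f 0) (g (suc k)) _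
  where
  lem : ∀ a b c x → a *ᶻ b *ᶻ c +ᶻ a *ᶻ x ≡ a *ᶻ (b *ᶻ c +ᶻ x)
  lem = solve-∀

*ˢ-assoc : ∀ f g h → (f *ˢ g) *ˢ h ≈ f *ˢ (g *ˢ h)
*ˢ-assoc f g h zero = ℤ.*-assoc (f 0) (g 0) (h 0)
*ˢ-assoc f g h (suc k)
  rewrite *ˢ-distribʳ h (λ j → f 0 *ᶻ g (suc j)) (tail f *ˢ g) k
        | scale-*ˢ (f 0) (tail g) h k | *ˢ-assoc (tail f) g h k = lem (f 0) (g 0) (h (suc k)) _ _
  where
  lem : ∀ a b c x y → a *ᶻ b *ᶻ c +ᶻ (a *ᶻ x +ᶻ y) ≡ a *ᶻ (b *ᶻ c +ᶻ x) +ᶻ y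
  lem = solve-∀

0*ˢ : ∀ g → (λ _ → 0ℤ) *ˢ g ≈ (λ _ → 0ℤ)
0*ˢ g zero = ℤ.*-zeroˡ (g 0)
0*ˢ g (suc k) rewrite 0*ˢ g k = cong (_+ᶻ 0ℤ) (ℤ.*-zeroˡ (g (suc k)))

κ-*ˢ : ∀ a g k → (κ a *ˢ g) k ≡ a *ᶻ g k
κ-*ˢ a g zero = refl
κ-*ˢ a g (suc k) rewrite 0*ˢ g k = ℤ.+-identityʳ _

0ˢ 1ˢ : Ser
0ˢ = λ _ → 0ℤ
1ˢ = κ 1ℤ

*ˢ-identityˡ : ∀ g → 1ˢ *ˢ g ≈ g
*ˢ-identityˡ g k = trans (κ-*ˢ 1ℤ g k) (ℤ.*-identityˡ (g k))

≈-isCommutativeRing : IsCommutativeRing _≈_ _+ˢ_ _*ˢ_ -ˢ_ 0ˢ 1ˢ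
≈-isCommutativeRing = record
  { isRing = record
    { +-isAbelianGroup = record
      { isGroup = record
        { isMonoid = record
          { isSemigroup = record
            { isMagma = record
              { isEquivalence = record
                { refl = λ _ → refl ; sym = λ p k → sym (p k) ; trans = λ p q k → trans (p k) (q k) }
              ; ∙-cong = λ p q k → cong₂ _+ᶻ_ (p k) (q k) }
            ; assoc = λ f g h k → ℤ.+-assoc (f k) (g k) (h k) }
          ; identity = (λ f k → ℤ.+-identityˡ (f k)) , (λ f k → ℤ.+-identityʳ (f k)) }
        ; inverse = (λ f k → ℤ.+-inverseˡ (f k)) , (λ f k → ℤ.+-inverseʳ (f k))
        ; ⁻¹-cong = λ p k → cong -ᶻ_ (p k) }
      ; comm = λ f g k → ℤ.+-comm (f k) (g k) }
    ; *-cong = *ˢ-cong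
    ; *-assoc = *ˢ-assoc
    ; *-identity = *ˢ-identityˡ , (λ f k → trans (*ˢ-comm f 1ˢ k) (*ˢ-identityˡ f k))
    ; distrib = *ˢ-distribˡ , *ˢ-distribʳ }
  ; *-comm = *ˢ-comm }

Ser-commutativeRing : CommutativeRing 0ℓ 0ℓ
Ser-commutativeRing = record { isCommutativeRing = ≈-isCommutativeRing }

Ser-almost : ACR.AlmostCommutativeRing 0ℓ 0ℓ
Ser-almost = ACR.fromCommutativeRing Ser-commutativeRing

κ-homo : ∀ a b → κ (a *ᶻ b) ≈ κ a *ˢ κ b
κ-homo a b zero = refl
κ-homo a b (suc k) = sym (trans (κ-*ˢ a (κ b) (suc k)) (ℤ.*-zeroʳ a))

κ-morphism : CommutativeRing.rawRing ℤ.+-*-commutativeRing ACR.-Raw-AlmostCommutative⟶ Ser-almost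
κ-morphism = record
  { ⟦_⟧ = κ
  ; +-homo = λ { a b zero → refl ; a b (suc k) → refl }
  ; *-homo = κ-homo
  ; -‿homo = λ { a zero → refl ; a (suc k) → refl }
  ; 0-homo = λ { zero → refl ; (suc k) → refl }
  ; 1-homo = λ _ → refl }

κ-≟ : ∀ a b → Maybe (κ a ≈ κ b)
κ-≟ a b with a ℤ.≟ b
... | yes refl = just (λ _ → refl)
... | no _ = nothing

open Algebra.Solver.Ring (CommutativeRing.rawRing ℤ.+-*-commutativeRing) Ser-almost κ-morphism κ-≟ public
  using (solve; _:=_; _:+_; _:*_; _:-_; :-_; _:^_; con)

module ≈ = CommutativeRing Ser-commutativeRing

infixr 8 _^ˢ_
_^ˢ_ : Ser → ℕ → Ser
f ^ˢ zero = 1ˢ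
f ^ˢ suc k = f *ˢ f ^ˢ k

X 1+X 1-X : Ser
X 1 = 1ℤ
X _ = 0ℤ
1+X = κ 1ℤ +ˢ X
1-X = κ 1ℤ +ˢ -ˢ X

reflˢ : ∀ {f} → f ≈ f
reflˢ _ = refl

symˢ : ∀ {f g} → f ≈ g → g ≈ f
symˢ p k = sym (p k)

infixr 5 _⟫_
_⟫_ : ∀ {f g h} → f ≈ g → g ≈ h → f ≈ h
(p ⟫ q) k = trans (p k) (q k)

X*-zero : ∀ f → (X *ˢ f) 0 ≡ 0ℤ
X*-zero f = ℤ.*-zeroˡ (f 0)

tail-X : tail X ≈ 1ˢ
tail-X zero = refl
tail-X (suc k) = refl

X*-suc : ∀ f k → (X *ˢ f) (suc k) ≡ f k
X*-suc f k = trans (cong₂ _+ᶻ_ (ℤ.*-zeroˡ (f (suc k)))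
  (trans (*ˢ-cong {g = f} tail-X (λ _ → refl) k) (*ˢ-identityˡ f k))) (ℤ.+-identityˡ (f k))

Vanish : ℕ → Ser → Set
Vanish k f = ∀ j → j ℕ.< k → f j ≡ 0ℤ

Gap : Ser → Set
Gap f = ∀ a s → 1 ≤ s → s ≤ 3 → f (a * 4 + s) ≡ 0ℤ

Vanish-cong : ∀ {k f g} → f ≈ g → Vanish k f → Vanish k g
Vanish-cong p V j lt = trans (sym (p j)) (V j lt)

X-tail : ∀ f → f 0 ≡ 0ℤ → f ≈ X *ˢ tail f
X-tail f e zero = trans e (sym (X*-zero (tail f)))
X-tail f e (suc k) = sym (X*-suc (tail f) k)

unit-cancel : ∀ u f → u 0 ≡ 1ℤ → ∀ k → Vanish k (u *ˢ f) → Vanish k f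
unit-cancel u f u₀ (suc k) V zero _ =
  trans (sym (ℤ.*-identityˡ (f 0))) (trans (cong (_*ᶻ f 0) (sym u₀)) (V 0 (s≤s z≤n)))
unit-cancel u f u₀ (suc k) V (suc j) (s≤s lt) = unit-cancel u (tail f) u₀ k V′ j lt
  where
  f₀ : f 0 ≡ 0ℤ
  f₀ = unit-cancel u f u₀ (suc k) V 0 (s≤s z≤n)
  swap : u *ˢ f ≈ X *ˢ (u *ˢ tail f)
  swap = *ˢ-cong {u} {u} reflˢ (X-tail f f₀) ⟫ solve 3 (λ u x g → u :* (x :* g) := x :* (u :* g)) reflˢ u X (tail f)
  V′ : Vanish k (u *ˢ tail f)
  V′ i i<k = trans (sym (X*-suc (u *ˢ tail f) i)) (trans (sym (swap (suc i))) (V (suc i) (s≤s i<k)))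

unit-cancel-≈ : ∀ u f → u 0 ≡ 1ℤ → u *ˢ f ≈ 0ˢ → f ≈ 0ˢ
unit-cancel-≈ u f u₀ e k = unit-cancel u f u₀ (suc k) (λ j _ → e j) k ℕ.≤-refl

unit-cancelˡ : ∀ u f g → u 0 ≡ 1ℤ → u *ˢ f ≈ u *ˢ g → f ≈ g
unit-cancelˡ u f g u₀ e k = ℤ.i-j≡0⇒i≡j (f k) (g k) (unit-cancel-≈ u (f +ˢ -ˢ g) u₀ e′ k)
  where
  e′ : u *ˢ (f +ˢ -ˢ g) ≈ 0ˢ
  e′ k = trans (solve 3 (λ u f g → u :* (f :+ :- g) := u :* f :+ :- (u :* g)) reflˢ u f g k)
    (trans (cong (λ t → (u *ˢ f) k +ᶻ -ᶻ t) (sym (e k))) (ℤ.+-inverseʳ ((u *ˢ f) k)))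

^ˢ-zero : ∀ u → u 0 ≡ 1ℤ → ∀ k → (u ^ˢ k) 0 ≡ 1ℤ
^ˢ-zero u e zero = refl
^ˢ-zero u e (suc k) rewrite e | ^ˢ-zero u e k = refl

^ˢ-cong : ∀ {f g} → f ≈ g → ∀ k → f ^ˢ k ≈ g ^ˢ k
^ˢ-cong p zero = reflˢ
^ˢ-cong p (suc k) = *ˢ-cong p (^ˢ-cong p k)

^ˢ-+ : ∀ f a b → f ^ˢ (a + b) ≈ f ^ˢ a *ˢ f ^ˢ b
^ˢ-+ f zero b = symˢ (*ˢ-identityˡ (f ^ˢ b))
^ˢ-+ f (suc a) b = *ˢ-cong {f} reflˢ (^ˢ-+ f a b) ⟫ symˢ (*ˢ-assoc f (f ^ˢ a) (f ^ˢ b))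

^ˢ-distrib : ∀ f g k → (f *ˢ g) ^ˢ k ≈ f ^ˢ k *ˢ g ^ˢ k
^ˢ-distrib f g zero = symˢ (*ˢ-identityˡ 1ˢ)
^ˢ-distrib f g (suc k) = *ˢ-cong {f *ˢ g} reflˢ (^ˢ-distrib f g k)
  ⟫ solve 4 (λ f g a b → f :* g :* (a :* b) := f :* a :* (g :* b)) reflˢ f g (f ^ˢ k) (g ^ˢ k)

-- The form Σ eᵢ A^(L-i) Bⁱ; later A = (1+X)⁴ and B = (1-X)⁴.
form : Ser → Ser → ℕ → Ser → Ser
form A B zero e = κ (e 0)
form A B (suc L) e = κ (e 0) *ˢ A ^ˢ suc L +ˢ B *ˢ form A B L (tail e)

form-cong : ∀ A B L {e e′} → (∀ i → i ≤ L → e i ≡ e′ i) → form A B L e ≈ form A B L e′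
form-cong A B zero p k = cong (λ a → κ a k) (p 0 z≤n)
form-cong A B (suc L) {e} {e′} p k = cong₂ _+ᶻ_ (cong (λ a → (κ a *ˢ A ^ˢ suc L) k) (p 0 z≤n))
  (*ˢ-cong {B} reflˢ (form-cong A B L (λ i i≤L → p (suc i) (s≤s i≤L))) k)

-- `prefix e` is the sequence of partial sums of `e`. It is computed by folding the first two
-- entries into one, so that its recursion keeps pace with `form`, which peels off the leading
-- coefficient.
merge prefix : Ser → Ser
merge e zero = e 0 +ᶻ e 1
merge e (suc i) = e (suc (suc i))
prefix e zero = e 0
prefix e (suc i) = prefix (merge e) i

prefix-suc : ∀ e i → prefix e (suc i) ≡ prefix e i +ᶻ e (suc i)
prefix-suc e zero = refl
prefix-suc e (suc i) = prefix-suc (merge e) i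

form-merge : ∀ A B L e → form A B L (merge e) ≈ form A B L (tail e) +ˢ κ (e 0) *ˢ A ^ˢ L
form-merge A B zero e zero = trans (ℤ.+-comm (e 0) (e 1)) (cong (e 1 +ᶻ_) (sym (ℤ.*-identityʳ (e 0))))
form-merge A B zero e (suc k) = sym (trans (ℤ.+-identityˡ _) (trans (κ-*ˢ (e 0) 1ˢ (suc k)) (ℤ.*-zeroʳ (e 0))))
form-merge A B (suc L) e = (λ k → cong (_+ᶻ (B *ˢ form A B L (tail (merge e))) k)
    (*ˢ-cong {κ (e 0 +ᶻ e 1)} {κ (e 0) +ˢ κ (e 1)} (λ { zero → refl ; (suc _) → refl }) (reflˢ {A ^ˢ suc L}) k))
  ⟫ solve 4 (λ a b c d → (a :+ b) :* c :+ d := b :* c :+ d :+ a :* c) reflˢ (κ (e 0)) (κ (e 1)) (A ^ˢ suc L)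
    (B *ˢ form A B L (tail (tail e)))

-- Synthetic division by A - B (Abel summation): the quotient has the partial sums as coefficients,
-- and the remainder is what the form becomes at A = B.
form-prefix : ∀ A B L e →
  form A B (suc L) e ≈ (A +ˢ -ˢ B) *ˢ form A B L (prefix e) +ˢ κ (prefix e (suc L)) *ˢ B ^ˢ suc L
form-prefix A B zero e = ≈.+-cong (≈.refl {κ (e 0) *ˢ A ^ˢ 1}) (≈.refl {B *ˢ κ (e 1)})
  ⟫ solve 4 (λ a b c d → c :* (a :* con (+ 1)) :+ b :* d := (a :+ :- b) :* c :+ (c :+ d) :* (b :* con (+ 1))) reflˢ A B
    (κ (e 0)) (κ (e 1))
  ⟫ ≈.+-cong (≈.refl {(A +ˢ -ˢ B) *ˢ κ (e 0)})
    (*ˢ-cong {κ (e 0) +ˢ κ (e 1)} {κ (e 0 +ᶻ e 1)} (λ { zero → refl ; (suc _) → refl }) reflˢ)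
form-prefix A B (suc L) e = step1 ⟫ step2
  where
  m = merge e
  G = form A B L (prefix m)
  T = κ (prefix m (suc L))
  step1 : form A B (suc (suc L)) e ≈ κ (e 0) *ˢ A ^ˢ suc (suc L) +ˢ B *ˢ
    (((A +ˢ -ˢ B) *ˢ G +ˢ T *ˢ B ^ˢ suc L) +ˢ -ˢ (κ (e 0) *ˢ A ^ˢ suc L))
  step1 = ≈.+-cong (≈.refl {κ (e 0) *ˢ A ^ˢ suc (suc L)}) (*ˢ-cong {B} reflˢ
    (λ k → trans (lem (form A B (suc L) (tail e) k) ((κ (e 0) *ˢ A ^ˢ suc L) k))
      (cong (_+ᶻ -ᶻ (κ (e 0) *ˢ A ^ˢ suc L) k) (trans (sym (form-merge A B (suc L) e k)) (form-prefix A B L m k)))))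
    where
    lem : ∀ a b → a ≡ a +ᶻ b +ᶻ -ᶻ b
    lem = solve-∀
  step2 = solve 7 (λ A B a P G T Q →
      a :* (A :* (A :* P)) :+ B :* (((A :+ :- B) :* G :+ T :* (B :* Q)) :+ :- (a :* (A :* P)))
      := (A :+ :- B) :* (a :* (A :* P) :+ B :* G) :+ T :* (B :* (B :* Q)))
    reflˢ A B (κ (e 0)) (A ^ˢ L) G T (B ^ˢ L)

-- Here `X` marks the index of the coefficients, whereas inside a form it is the variable of A and
-- B. Division of a form by A - B thus corresponds to division of its coefficient series by 1-X.
1-X-prefix : ∀ e → e ≈ 1-X *ˢ prefix e
1-X-prefix e k = trans (lem k) (solve 2 (λ x s → s :+ :- (x :* s) := (con (+ 1) :+ :- x) :* s) reflˢ X (prefix e) k)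
  where
  lem : ∀ k → e k ≡ prefix e k +ᶻ -ᶻ (X *ˢ prefix e) k
  lem zero = sym (trans (cong (λ t → e 0 +ᶻ -ᶻ t) (X*-zero (prefix e))) (ℤ.+-identityʳ (e 0)))
  lem (suc k) = sym (trans (cong₂ (λ s t → s +ᶻ -ᶻ t) (prefix-suc e k) (X*-suc (prefix e) k)) (l2 (prefix e k) (e (suc k))))
    where
    l2 : ∀ a b → a +ᶻ b +ᶻ -ᶻ a ≡ b
    l2 = solve-∀

prefix-const : ∀ e L → (∀ i → L ℕ.< i → e i ≡ 0ℤ) → ∀ i → L ≤ i → prefix e i ≡ prefix e L
prefix-const e L z i L≤i with ℕ.m≤n⇒m<n∨m≡n L≤i
... | inj₂ refl = refl
prefix-const e L z (suc i) L≤i | inj₁ (s≤s lt) = trans (prefix-suc e i)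
  (trans (cong₂ _+ᶻ_ (prefix-const e L z i lt) (z (suc i) (s≤s lt))) (ℤ.+-identityʳ _))

-- Forms in (1+X)⁴ and (1-X)⁴ that vanish to high order

A B U : Ser
A = 1+X *ˢ 1+X *ˢ 1+X *ˢ 1+X
B = 1-X *ˢ 1-X *ˢ 1-X *ˢ 1-X
U = κ (+ 8) *ˢ (1ˢ +ˢ X *ˢ X)

A-B : A +ˢ -ˢ B ≈ X *ˢ U
A-B = solve 1 (λ x → let p = con (+ 1) :+ x ; q = con (+ 1) :+ :- x in
    p :* p :* p :* p :+ :- (q :* q :* q :* q) := x :* (con (+ 8) :* (con (+ 1) :+ x :* x))) reflˢ X

hform : ℕ → Ser → Ser
hform = form A B

XU-Vanish : ∀ k f → Vanish (suc k) (X *ˢ U *ˢ f) → Vanish k f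
XU-Vanish k f V = unit-cancel (1ˢ +ˢ X *ˢ X) f refl k V′
  where
  g = (1ˢ +ˢ X *ˢ X) *ˢ f
  e : X *ˢ U *ˢ f ≈ X *ˢ (κ (+ 8) *ˢ g)
  e = solve 2 (λ x f → x :* (con (+ 8) :* (con (+ 1) :+ x :* x)) :* f := x :*
    (con (+ 8) :* ((con (+ 1) :+ x :* x) :* f))) reflˢ X f
  V′ : Vanish k g
  V′ j lt = suc-cancel 7 (g j) (trans (sym (κ-*ˢ (+ 8) g j)) (trans (sym (X*-suc (κ (+ 8) *ˢ g) j))
    (trans (sym (e (suc j))) (V (suc j) (s≤s lt)))))

-- Two readings of one coefficient sequence: its generating series has the factor (1-X)ᵛ, its form
-- the factor (XU)ᵛ, with the same cofactor `Q`.
record Shape (v q : ℕ) (e : Ser) : Set where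
  field
    Q : Ser
    Q-above : ∀ i → q ℕ.< i → Q i ≡ 0ℤ
    e≈ : e ≈ 1-X ^ˢ v *ˢ Q
    form≈ : hform (v + q) e ≈ (X *ˢ U) ^ˢ v *ˢ hform q Q

-- At X = 0 both A and B equal 1, so a form without constant term has coefficient sum 0; then
-- `form-prefix` has no remainder and splits off A - B = XU. Each order of vanishing pays for one
-- such division.
shape : ∀ v q e → (∀ i → v + q ℕ.< i → e i ≡ 0ℤ) → Vanish v (hform (v + q) e) → Shape v q e
shape zero q e z V = record { Q = e ; Q-above = z ; e≈ = symˢ (*ˢ-identityˡ e) ; form≈ = symˢ (*ˢ-identityˡ (hform q e)) }
shape (suc v) q e z V = record
  { Q = Q ; Q-above = Q-above
  ; e≈ = 1-X-prefix e ⟫ *ˢ-cong {1-X} reflˢ e≈ ⟫ symˢ (*ˢ-assoc 1-X (1-X ^ˢ v) Q)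
  ; form≈ = step ⟫ *ˢ-cong {X *ˢ U} reflˢ form≈ ⟫ symˢ (*ˢ-assoc (X *ˢ U) ((X *ˢ U) ^ˢ v) (hform q Q)) }
  where
  L = v + q
  tot : prefix e (suc L) ≡ 0ℤ
  tot = trans (sym (lem (prefix e (suc L)) (^ˢ-zero B refl (suc L))))
    (trans (sym (≈.trans (form-prefix A B L e)
    (≈.+-cong (*ˢ-cong A-B (reflˢ {hform L (prefix e)})) (reflˢ {κ (prefix e (suc L)) *ˢ B ^ˢ suc L})) 0))
    (V 0 (s≤s z≤n)))
    where
    lem : ∀ a → (B ^ˢ suc L) 0 ≡ 1ℤ → (X *ˢ U *ˢ hform L (prefix e) +ˢ κ a *ˢ B ^ˢ suc L) 0 ≡ a
    lem a b rewrite b = trans (cong₂ _+ᶻ_ (ℤ.*-zeroˡ (hform L (prefix e) 0)) (ℤ.*-identityʳ a)) (ℤ.+-identityˡ a)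
  step : hform (suc L) e ≈ X *ˢ U *ˢ hform L (prefix e)
  step = form-prefix A B L e ⟫ ≈.+-cong (*ˢ-cong A-B (reflˢ {hform L (prefix e)}))
    (λ k → trans (cong (λ a → (κ a *ˢ B ^ˢ suc L) k) tot)
    (trans (κ-*ˢ 0ℤ (B ^ˢ suc L) k) (ℤ.*-zeroˡ ((B ^ˢ suc L) k)))) ⟫ ≈.+-identityʳ (X *ˢ U *ˢ hform L (prefix e))
  rec : Shape v q (prefix e)
  rec = shape v q (prefix e)
    (λ { (suc i) (s≤s lt) → trans (prefix-const e (suc L) z (suc i) (s≤s lt)) tot })
    (XU-Vanish v _ (Vanish-cong step V))
  open Shape rec

-- Invariant forms

-- The weight enumerator of the extended Hamming code of length 8, with one power of X for four
-- units of weight.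
F : Ser
F = 1ˢ +ˢ κ (+ 14) *ˢ X +ˢ X *ˢ X

X⁴ 1-X⁴ : Ser
X⁴ = X *ˢ (X *ˢ (X *ˢ X))
1-X⁴ = 1ˢ +ˢ -ˢ X⁴

X^-+ : ∀ v f j → (X ^ˢ v *ˢ f) (v + j) ≡ f j
X^-+ zero f j = *ˢ-identityˡ f j
X^-+ (suc v) f j = trans (*ˢ-assoc X (X ^ˢ v) f (suc (v + j))) (trans (X*-suc (X ^ˢ v *ˢ f) (v + j)) (X^-+ v f j))

XU^-Vanish : ∀ v k f → Vanish (v + k) ((X *ˢ U) ^ˢ v *ˢ f) → Vanish k f
XU^-Vanish zero k f V = Vanish-cong (*ˢ-identityˡ f) V
XU^-Vanish (suc v) k f V = XU^-Vanish v k f (XU-Vanish (v + k) _ (Vanish-cong (*ˢ-assoc (X *ˢ U) ((X *ˢ U) ^ˢ v) f) V))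

-- After L divisions by XU only a constant is left, and one further order of vanishing kills it.
shape-zero : ∀ L e → (∀ i → L ℕ.< i → e i ≡ 0ℤ) → Vanish (suc L) (hform L e) → e ≈ 0ˢ
shape-zero L e z V k = trans (e≈ k) (trans (*ˢ-cong {1-X ^ˢ L} reflˢ Q≈0 k) (≈.zeroʳ (1-X ^ˢ L) k))
  where
  sh : Shape L 0 e
  sh = shape L 0 e (λ i lt → z i (subst (ℕ._< i) (ℕ.+-identityʳ L) lt))
    (subst (λ l → Vanish L (hform l e)) (sym (ℕ.+-identityʳ L)) (λ j lt → V j (ℕ.m<n⇒m<1+n lt)))
  open Shape sh
  V′ : Vanish (L + 1) ((X *ˢ U) ^ˢ L *ˢ hform 0 Q)
  V′ = Vanish-cong form≈ (subst₂ (λ a b → Vanish a (hform b e)) (ℕ.+-comm 1 L) (sym (ℕ.+-identityʳ L)) V)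
  Q≈0 : Q ≈ 0ˢ
  Q≈0 zero = XU^-Vanish L 1 (hform 0 Q) V′ 0 (s≤s z≤n)
  Q≈0 (suc i) = Q-above (suc i) (s≤s z≤n)

X⁴*-low : ∀ f s → s ℕ.< 4 → (X⁴ *ˢ f) s ≡ 0ℤ
X⁴*-low f s lt = trans (eq s) (go s lt)
  where
  eq : X⁴ *ˢ f ≈ X *ˢ (X *ˢ (X *ˢ (X *ˢ f)))
  eq = solve 2 (λ x f → x :* (x :* (x :* x)) :* f := x :* (x :* (x :* (x :* f)))) reflˢ X f
  g₁ = X *ˢ f
  g₂ = X *ˢ g₁
  g₃ = X *ˢ g₂
  go : ∀ s → s ℕ.< 4 → (X *ˢ g₃) s ≡ 0ℤ
  go 0 _ = X*-zero g₃
  go 1 _ = trans (X*-suc g₃ 0) (X*-zero g₂)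
  go 2 _ = trans (X*-suc g₃ 1) (trans (X*-suc g₂ 0) (X*-zero g₁))
  go 3 _ = trans (X*-suc g₃ 2) (trans (X*-suc g₂ 1) (trans (X*-suc g₁ 0) (X*-zero f)))
  go (suc (suc (suc (suc s)))) (s≤s (s≤s (s≤s (s≤s ()))))

X⁴*-+4 : ∀ f j → (X⁴ *ˢ f) (4 + j) ≡ f j
X⁴*-+4 f j = trans (solve 2 (λ x f → x :* (x :* (x :* x)) :* f := x :* (x :* (x :* (x :* f)))) reflˢ X f (4 + j))
  (trans (X*-suc g₃ (3 + j)) (trans (X*-suc g₂ (2 + j)) (trans (X*-suc g₁ (1 + j)) (X*-suc f j))))
  where
  g₁ = X *ˢ f
  g₂ = X *ˢ g₁
  g₃ = X *ˢ g₂

Gap-cong : ∀ {f g} → f ≈ g → Gap f → Gap g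
Gap-cong p G a s l u = trans (sym (p (a * 4 + s))) (G a s l u)

Gap-cancel : ∀ f → Gap (1-X⁴ *ˢ f) → Gap f
Gap-cancel f G a s l u = go a
  where
  eq : ∀ j → f j ≡ (1-X⁴ *ˢ f) j +ᶻ (X⁴ *ˢ f) j
  eq = solve 2 (λ w f → f := (con (+ 1) :+ :- w) :* f :+ w :* f) reflˢ X⁴ f
  go : ∀ a → f (a * 4 + s) ≡ 0ℤ
  go zero = trans (eq s) (cong₂ _+ᶻ_ (G 0 s l u) (X⁴*-low f s (s≤s u)))
  go (suc a) = trans (eq (4 + (a * 4 + s))) (cong₂ _+ᶻ_ (G (suc a) s l u) (trans (X⁴*-+4 f (a * 4 + s)) (go a)))

Gap-cancel^ : ∀ v f → Gap (1-X⁴ ^ˢ v *ˢ f) → Gap f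
Gap-cancel^ zero f G = Gap-cong (*ˢ-identityˡ f) G
Gap-cancel^ (suc v) f G = Gap-cancel^ v f (Gap-cancel (1-X⁴ ^ˢ v *ˢ f) (Gap-cong (*ˢ-assoc 1-X⁴ (1-X⁴ ^ˢ v) f) G))

-- The factor that two coordinates with different entries contribute to (1+X)^(n-|c|) (1-X)^|c|.
pq : Ser
pq = 1+X *ˢ 1-X

pq^-XU^ : ∀ v → pq ^ˢ v *ˢ (X *ˢ U) ^ˢ v ≈ κ (+ 8) ^ˢ v *ˢ (X ^ˢ v *ˢ 1-X⁴ ^ˢ v)
pq^-XU^ v = symˢ (^ˢ-distrib pq (X *ˢ U) v)
  ⟫ ^ˢ-cong (solve 1 (λ x → let p = con (+ 1) :+ x ; q = con (+ 1) :+ :- x in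
      p :* q :* (x :* (con (+ 8) :* (con (+ 1) :+ x :* x))) := con (+ 8) :*
        (x :* (con (+ 1) :+ :- (x :* (x :* (x :* x)))))) reflˢ X) v
  ⟫ ^ˢ-distrib (κ (+ 8)) (X *ˢ 1-X⁴) v ⟫ *ˢ-cong {κ (+ 8) ^ˢ v} reflˢ (^ˢ-distrib X 1-X⁴ v)

eight^-cancel : ∀ v f k → (κ (+ 8) ^ˢ v *ˢ f) k ≡ 0ℤ → f k ≡ 0ℤ
eight^-cancel zero f k e = trans (sym (*ˢ-identityˡ f k)) e
eight^-cancel (suc v) f k e = eight^-cancel v f k (suc-cancel 7 _
  (trans (sym (κ-*ˢ (+ 8) (κ (+ 8) ^ˢ v *ˢ f) k)) (trans (sym (*ˢ-assoc (κ (+ 8)) (κ (+ 8) ^ˢ v) f k)) e)))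

-- Since pqᵛ (XU)ᵛ = 8ᵛ Xᵛ (1-X⁴)ᵛ, the prefactor is a series in X⁴ apart from the shift by v, and
-- cancelling it does not disturb the gaps.
Q-gap : ∀ v f → (∀ a s → 1 ≤ s → s ≤ 3 → (pq ^ˢ v *ˢ ((X *ˢ U) ^ˢ v *ˢ f)) (v + (a * 4 + s)) ≡ 0ℤ) → Gap f
Q-gap v f G = Gap-cancel^ v f λ a s l u → eight^-cancel v (1-X⁴ ^ˢ v *ˢ f) (a * 4 + s)
  (trans (sym (X^-+ v (κ (+ 8) ^ˢ v *ˢ (1-X⁴ ^ˢ v *ˢ f)) (a * 4 + s))) (trans (eq (v + (a * 4 + s))) (G a s l u)))
  where
  eq : X ^ˢ v *ˢ (κ (+ 8) ^ˢ v *ˢ (1-X⁴ ^ˢ v *ˢ f)) ≈ pq ^ˢ v *ˢ ((X *ˢ U) ^ˢ v *ˢ f)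
  eq = solve 4 (λ x k w f → x :* (k :* (w :* f)) := k :* (x :* w) :* f) reflˢ (X ^ˢ v) (κ (+ 8) ^ˢ v) (1-X⁴ ^ˢ v) f
    ⟫ *ˢ-cong {κ (+ 8) ^ˢ v *ˢ (X ^ˢ v *ˢ 1-X⁴ ^ˢ v)} {g = f} (symˢ (pq^-XU^ v)) reflˢ
    ⟫ *ˢ-assoc (pq ^ˢ v) ((X *ˢ U) ^ˢ v) f

-- The coefficients of X and X² are 4(a-b) and 6(a+b), so the gaps force a = b = 0.
module Form1 (Q : Ser) where
  a = Q 0
  b = Q 1
  expand : hform 1 Q ≈ κ a *ˢ A +ˢ κ b *ˢ B
  expand = solve 4 (λ A B a b → a :* (A :* con (+ 1)) :+ B :* b := a :* A :+ b :* B) reflˢ A B (κ a) (κ b)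
  coeff : ∀ k → hform 1 Q k ≡ a *ᶻ A k +ᶻ b *ᶻ B k
  coeff k = trans (expand k) (cong₂ _+ᶻ_ (κ-*ˢ a A k) (κ-*ˢ b B k))
  solution : Gap (hform 1 Q) → Q 0 ≡ 0ℤ × Q 1 ≡ 0ℤ
  solution G = suc-cancel 47 a (trans (l₁ a b) (cong₂ (λ s t → + 6 *ᶻ s +ᶻ + 4 *ᶻ t) e₁ e₂))
    , suc-cancel 47 b (trans (l₂ a b) (cong₂ (λ s t → + 4 *ᶻ t +ᶻ -ᶻ (+ 6 *ᶻ s)) e₁ e₂))
    where
    e₁ : a *ᶻ + 4 +ᶻ b *ᶻ -[1+ 3 ] ≡ 0ℤ
    e₁ = trans (sym (coeff 1)) (G 0 1 (s≤s z≤n) (s≤s z≤n))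
    e₂ : a *ᶻ + 6 +ᶻ b *ᶻ + 6 ≡ 0ℤ
    e₂ = trans (sym (coeff 2)) (G 0 2 (s≤s z≤n) (s≤s (s≤s z≤n)))
    l₁ : ∀ a b → + 48 *ᶻ a ≡ + 6 *ᶻ (a *ᶻ + 4 +ᶻ b *ᶻ -[1+ 3 ]) +ᶻ + 4 *ᶻ (a *ᶻ + 6 +ᶻ b *ᶻ + 6)
    l₁ = solve-∀
    l₂ : ∀ a b → + 48 *ᶻ b ≡ + 4 *ᶻ (a *ᶻ + 6 +ᶻ b *ᶻ + 6) +ᶻ -ᶻ (+ 6 *ᶻ (a *ᶻ + 4 +ᶻ b *ᶻ -[1+ 3 ]))
    l₂ = solve-∀

module Form2 (Q : Ser) where
  a = Q 0
  b = Q 1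
  c = Q 2
  M₀ = A *ˢ A
  M₁ = A *ˢ B
  M₂ = B *ˢ B
  expand : hform 2 Q ≈ κ a *ˢ M₀ +ˢ κ b *ˢ M₁ +ˢ κ c *ˢ M₂
  expand = solve 5 (λ A B a b c → a :* (A :* (A :* con (+ 1))) :+ B :* (b :* (A :* con (+ 1)) :+ B :* c)
    := a :* (A :* A) :+ b :* (A :* B) :+ c :* (B :* B)) reflˢ A B (κ a) (κ b) (κ c)
  coeff : ∀ k → hform 2 Q k ≡ a *ᶻ M₀ k +ᶻ b *ᶻ M₁ k +ᶻ c *ᶻ M₂ k
  coeff k = trans (expand k) (cong₂ _+ᶻ_ (cong₂ _+ᶻ_ (κ-*ˢ a M₀ k) (κ-*ˢ b M₁ k)) (κ-*ˢ c M₂ k))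
  solution : Gap (hform 2 Q) → Q 1 ≡ + 14 *ᶻ Q 0 × Q 2 ≡ Q 0
  solution G = ℤ.i-j≡0⇒i≡j _ _ (suc-cancel 7 _ (trans (l₁ a b c) (cong₂ (λ s t → -ᶻ (+ 7 *ᶻ s +ᶻ + 2 *ᶻ t)) e₁ e₂)))
    , ℤ.i-j≡0⇒i≡j _ _ (suc-cancel 7 _ (trans (l₂ a b c) (cong -ᶻ_ e₁)))
    where
    e₁ : a *ᶻ + 8 +ᶻ b *ᶻ 0ℤ +ᶻ c *ᶻ -[1+ 7 ] ≡ 0ℤ
    e₁ = trans (sym (coeff 1)) (G 0 1 (s≤s z≤n) (s≤s z≤n))
    e₂ : a *ᶻ + 28 +ᶻ b *ᶻ -[1+ 3 ] +ᶻ c *ᶻ + 28 ≡ 0ℤ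
    e₂ = trans (sym (coeff 2)) (G 0 2 (s≤s z≤n) (s≤s (s≤s z≤n)))
    l₁ : ∀ a b c → + 8 *ᶻ (b -ᶻ + 14 *ᶻ a) ≡ -ᶻ
      (+ 7 *ᶻ (a *ᶻ + 8 +ᶻ b *ᶻ 0ℤ +ᶻ c *ᶻ -[1+ 7 ]) +ᶻ + 2 *ᶻ (a *ᶻ + 28 +ᶻ b *ᶻ -[1+ 3 ] +ᶻ c *ᶻ + 28))
    l₁ = solve-∀
    l₂ : ∀ a b c → + 8 *ᶻ (c -ᶻ a) ≡ -ᶻ (a *ᶻ + 8 +ᶻ b *ᶻ 0ℤ +ᶻ c *ᶻ -[1+ 7 ])
    l₂ = solve-∀

-- The coefficients of X and X³ force e = a and d = b; those of X² and X⁶ then leave only the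
-- multiples of 1, 28, 198, 28, 1, the coefficients of F².
module Form4 (Q : Ser) where
  a = Q 0
  b = Q 1
  c = Q 2
  d = Q 3
  e = Q 4
  M₀ = A *ˢ A *ˢ (A *ˢ A)
  M₁ = A *ˢ A *ˢ (A *ˢ B)
  M₂ = A *ˢ A *ˢ (B *ˢ B)
  M₃ = A *ˢ B *ˢ (B *ˢ B)
  M₄ = B *ˢ B *ˢ (B *ˢ B)
  expand : hform 4 Q ≈ κ a *ˢ M₀ +ˢ κ b *ˢ M₁ +ˢ κ c *ˢ M₂ +ˢ κ d *ˢ M₃ +ˢ κ e *ˢ M₄
  expand = solve 7 (λ A B a b c d e →
      a :* (A :* (A :* (A :* (A :* con (+ 1))))) :+ B :*
        (b :* (A :* (A :* (A :* con (+ 1)))) :+ B :*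
        (c :* (A :* (A :* con (+ 1))) :+ B :* (d :* (A :* con (+ 1)) :+ B :* e)))
    := a :* (A :* A :* (A :* A)) :+ b :* (A :* A :* (A :* B)) :+ c :* (A :* A :* (B :* B)) :+ d :* (A :* B :* (B :* B))
      :+ e :* (B :* B :* (B :* B)))
    reflˢ A B (κ a) (κ b) (κ c) (κ d) (κ e)
  coeff : ∀ k → hform 4 Q k ≡ a *ᶻ M₀ k +ᶻ b *ᶻ M₁ k +ᶻ c *ᶻ M₂ k +ᶻ d *ᶻ M₃ k +ᶻ e *ᶻ M₄ k
  coeff k = trans (expand k) (cong₂ _+ᶻ_ (cong₂ _+ᶻ_
    (cong₂ _+ᶻ_ (cong₂ _+ᶻ_ (κ-*ˢ a M₀ k) (κ-*ˢ b M₁ k)) (κ-*ˢ c M₂ k)) (κ-*ˢ d M₃ k)) (κ-*ˢ e M₄ k))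
  module _ (G : Gap (hform 4 Q)) where
    e₁ : a *ᶻ + 16 +ᶻ b *ᶻ + 8 +ᶻ c *ᶻ + 0 +ᶻ d *ᶻ -[1+ 7 ] +ᶻ e *ᶻ -[1+ 15 ] ≡ 0ℤ
    e₁ = trans (sym (coeff 1)) (G 0 1 (s≤s z≤n) (s≤s z≤n))
    e₂ : a *ᶻ + 120 +ᶻ b *ᶻ + 24 +ᶻ c *ᶻ -[1+ 7 ] +ᶻ d *ᶻ + 24 +ᶻ e *ᶻ + 120 ≡ 0ℤ
    e₂ = trans (sym (coeff 2)) (G 0 2 (s≤s z≤n) (s≤s (s≤s z≤n)))
    e₃ : a *ᶻ + 560 +ᶻ b *ᶻ + 24 +ᶻ c *ᶻ + 0 +ᶻ d *ᶻ -[1+ 23 ] +ᶻ e *ᶻ -[1+ 559 ] ≡ 0ℤ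
    e₃ = trans (sym (coeff 3)) (G 0 3 (s≤s z≤n) (s≤s (s≤s (s≤s z≤n))))
    e₆ : a *ᶻ + 8008 +ᶻ b *ᶻ -[1+ 87 ] +ᶻ c *ᶻ -[1+ 55 ] +ᶻ d *ᶻ -[1+ 87 ] +ᶻ e *ᶻ + 8008 ≡ 0ℤ
    e₆ = trans (sym (coeff 6)) (G 1 2 (s≤s z≤n) (s≤s (s≤s z≤n)))
    ae : e ≡ a
    ae = ℤ.i-j≡0⇒i≡j _ _ (suc-cancel 511 _ (trans (l a b c d e) (cong₂ (λ s t → + 3 *ᶻ s -ᶻ t) e₁ e₃)))
      where
      l : ∀ a b c d e → + 512 *ᶻ (e -ᶻ a) ≡ + 3 *ᶻ
        (a *ᶻ + 16 +ᶻ b *ᶻ + 8 +ᶻ c *ᶻ + 0 +ᶻ d *ᶻ -[1+ 7 ] +ᶻ e *ᶻ -[1+ 15 ]) -ᶻ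
        (a *ᶻ + 560 +ᶻ b *ᶻ + 24 +ᶻ c *ᶻ + 0 +ᶻ d *ᶻ -[1+ 23 ] +ᶻ e *ᶻ -[1+ 559 ])
      l = solve-∀
    bd : d ≡ b
    bd = ℤ.i-j≡0⇒i≡j _ _ (suc-cancel 255 _ (trans (l a b c d e) (cong₂ (λ s t → t -ᶻ + 35 *ᶻ s) e₁ e₃)))
      where
      l : ∀ a b c d e → + 256 *ᶻ (d -ᶻ b) ≡ (a *ᶻ + 560 +ᶻ b *ᶻ + 24 +ᶻ c *ᶻ + 0 +ᶻ d *ᶻ -[1+ 23 ] +ᶻ e *ᶻ -[1+ 559 ])
        -ᶻ + 35 *ᶻ (a *ᶻ + 16 +ᶻ b *ᶻ + 8 +ᶻ c *ᶻ + 0 +ᶻ d *ᶻ -[1+ 7 ] +ᶻ e *ᶻ -[1+ 15 ])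
      l = solve-∀
    b28 : b ≡ + 28 *ᶻ a
    b28 = ℤ.i-j≡0⇒i≡j _ _ (suc-cancel 511 _ (trans (l a b c) (cong₂ (λ s t → + 7 *ᶻ s -ᶻ t) e₂′ e₆′)))
      where
      e₂′ : a *ᶻ + 120 +ᶻ b *ᶻ + 24 +ᶻ c *ᶻ -[1+ 7 ] +ᶻ b *ᶻ + 24 +ᶻ a *ᶻ + 120 ≡ 0ℤ
      e₂′ = trans (cong₂ (λ d e → a *ᶻ + 120 +ᶻ b *ᶻ + 24 +ᶻ c *ᶻ -[1+ 7 ] +ᶻ d *ᶻ + 24 +ᶻ e *ᶻ + 120) (sym bd) (sym ae)) e₂
      e₆′ : a *ᶻ + 8008 +ᶻ b *ᶻ -[1+ 87 ] +ᶻ c *ᶻ -[1+ 55 ] +ᶻ b *ᶻ -[1+ 87 ] +ᶻ a *ᶻ + 8008 ≡ 0ℤ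
      e₆′ = trans (cong₂ (λ d e → a *ᶻ + 8008 +ᶻ b *ᶻ -[1+ 87 ] +ᶻ c *ᶻ -[1+ 55 ] +ᶻ d *ᶻ -[1+ 87 ] +ᶻ e *ᶻ + 8008)
        (sym bd) (sym ae)) e₆
      l : ∀ a b c → + 512 *ᶻ (b -ᶻ + 28 *ᶻ a) ≡ + 7 *ᶻ
        (a *ᶻ + 120 +ᶻ b *ᶻ + 24 +ᶻ c *ᶻ -[1+ 7 ] +ᶻ b *ᶻ + 24 +ᶻ a *ᶻ + 120) -ᶻ
        (a *ᶻ + 8008 +ᶻ b *ᶻ -[1+ 87 ] +ᶻ c *ᶻ -[1+ 55 ] +ᶻ b *ᶻ -[1+ 87 ] +ᶻ a *ᶻ + 8008)
      l = solve-∀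
    c198 : c ≡ + 198 *ᶻ a
    c198 = ℤ.i-j≡0⇒i≡j _ _ (suc-cancel 7 _ (trans (l a c)
      (cong -ᶻ_ (trans (cong₂ (λ b d → a *ᶻ + 120 +ᶻ b *ᶻ + 24 +ᶻ c *ᶻ -[1+ 7 ] +ᶻ d *ᶻ + 24 +ᶻ a *ᶻ + 120) (sym b28)
      (trans (sym b28) (sym bd))) (trans (cong (λ e
      → a *ᶻ + 120 +ᶻ b *ᶻ + 24 +ᶻ c *ᶻ -[1+ 7 ] +ᶻ d *ᶻ + 24 +ᶻ e *ᶻ + 120) (sym ae)) e₂)))))
      where
      l : ∀ a c → + 8 *ᶻ (c -ᶻ + 198 *ᶻ a) ≡ -ᶻ
        (a *ᶻ + 120 +ᶻ (+ 28 *ᶻ a) *ᶻ + 24 +ᶻ c *ᶻ -[1+ 7 ] +ᶻ (+ 28 *ᶻ a) *ᶻ + 24 +ᶻ a *ᶻ + 120)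
      l = solve-∀

-- Character sums

ΣW : ∀ {n} → (Subset n → ℤ) → ℤ
ΣW {zero} f = f []
ΣW {suc n} f = ΣW (λ c → f (true ∷ c)) +ᶻ ΣW (λ c → f (false ∷ c))

ΣW-cong : ∀ {n} {f g : Subset n → ℤ} → (∀ c → f c ≡ g c) → ΣW f ≡ ΣW g
ΣW-cong {zero} p = p []
ΣW-cong {suc n} p = cong₂ _+ᶻ_ (ΣW-cong (p ∘ (true ∷_))) (ΣW-cong (p ∘ (false ∷_)))

+-interchange : ∀ a b c d → (a +ᶻ b) +ᶻ (c +ᶻ d) ≡ (a +ᶻ c) +ᶻ (b +ᶻ d)
+-interchange = solve-∀

ΣW-+ : ∀ {n} (f g : Subset n → ℤ) → ΣW (λ c → f c +ᶻ g c) ≡ ΣW f +ᶻ ΣW g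
ΣW-+ {zero} f g = refl
ΣW-+ {suc n} f g = trans (cong₂ _+ᶻ_ (ΣW-+ (f ∘ (true ∷_)) (g ∘ (true ∷_))) (ΣW-+ (f ∘ (false ∷_)) (g ∘ (false ∷_))))
  (+-interchange (ΣW (f ∘ (true ∷_))) _ _ _)

ΣW-*ˡ : ∀ {n} a (f : Subset n → ℤ) → ΣW (λ c → a *ᶻ f c) ≡ a *ᶻ ΣW f
ΣW-*ˡ {zero} a f = refl
ΣW-*ˡ {suc n} a f = trans (cong₂ _+ᶻ_ (ΣW-*ˡ a (f ∘ (true ∷_))) (ΣW-*ˡ a (f ∘ (false ∷_)))) (sym (ℤ.*-distribˡ-+ a _ _))

ΣW-0 : ∀ {n} → ΣW {n} (λ _ → 0ℤ) ≡ 0ℤ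
ΣW-0 {zero} = refl
ΣW-0 {suc n} = cong₂ _+ᶻ_ (ΣW-0 {n}) (ΣW-0 {n})

ΣW-swap : ∀ {m n} (f : Subset m → Subset n → ℤ) → ΣW (λ x → ΣW (f x)) ≡ ΣW (λ c → ΣW (λ x → f x c))
ΣW-swap {zero} f = refl
ΣW-swap {suc m} f = trans (cong₂ _+ᶻ_ (ΣW-swap (f ∘ (true ∷_))) (ΣW-swap (f ∘ (false ∷_))))
  (sym (ΣW-+ (λ c → ΣW (λ x → f (true ∷ x) c)) (λ c → ΣW (λ x → f (false ∷ x) c))))

ΣW-⊕ : ∀ {n} (f : Subset n → ℤ) x → ΣW f ≡ ΣW (λ c → f (x ⊕ c))
ΣW-⊕ {zero} f [] = refl
ΣW-⊕ {suc n} f (true ∷ x) = trans (ℤ.+-comm (ΣW (f ∘ (true ∷_))) _)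
  (cong₂ _+ᶻ_ (ΣW-⊕ (f ∘ (false ∷_)) x) (ΣW-⊕ (f ∘ (true ∷_)) x))
ΣW-⊕ {suc n} f (false ∷ x) = cong₂ _+ᶻ_ (ΣW-⊕ (f ∘ (true ∷_)) x) (ΣW-⊕ (f ∘ (false ∷_)) x)

⟦_⟧ : Bool → ℤ
⟦ true ⟧ = 1ℤ
⟦ false ⟧ = 0ℤ

sgn : Bool → ℤ
sgn true = -1ℤ
sgn false = 1ℤ

sgn-⟦⟧ : ∀ b → sgn b ≡ 1ℤ -ᶻ + 2 *ᶻ ⟦ b ⟧
sgn-⟦⟧ true = refl
sgn-⟦⟧ false = refl

-- The additive character (-1)^⟨u,c⟩ of F₂ⁿ.
χ : ∀ {n} → Subset n → Subset n → ℤ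
χ [] [] = 1ℤ
χ (true ∷ u) (b ∷ c) = sgn b *ᶻ χ u c
χ (false ∷ u) (b ∷ c) = χ u c

χ-parity : ∀ {n} (u c : Subset n) → (χ u c ≡ 1ℤ × Orth u c) ⊎ (χ u c ≡ -1ℤ × ¬ Orth u c)
χ-parity [] [] = inj₁ (refl , divides 0 refl)
χ-parity (false ∷ u) (b ∷ c) = χ-parity u c
χ-parity (true ∷ u) (false ∷ c) with χ-parity u c
... | inj₁ (e , o) = inj₁ (trans (ℤ.*-identityˡ _) e , o)
... | inj₂ (e , o) = inj₂ (trans (ℤ.*-identityˡ _) e , o)
χ-parity (true ∷ u) (true ∷ c) with χ-parity u c
... | inj₁ (e , o) = inj₂ (cong (-1ℤ *ᶻ_) e , λ o′ → two∤one (∣m+n∣m⇒∣n (subst (2 ∣ⁿ_) (ℕ.+-comm 1 ∣ u ∩ c ∣) o′) o))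
  where
  two∤one : ¬ 2 ∣ⁿ 1
  two∤one (divides zero ())
  two∤one (divides (suc k) ())
... | inj₂ (e , o) = inj₁ (cong (-1ℤ *ᶻ_) e , even-suc ∣ u ∩ c ∣ o)
  where
  even-suc : ∀ k → ¬ 2 ∣ⁿ k → 2 ∣ⁿ suc k
  even-suc zero o = contradiction (divides 0 refl) o
  even-suc (suc zero) o = divides 1 refl
  even-suc (suc (suc k)) o = ∣m∣n⇒∣m+n ∣-refl (even-suc k (λ d → o (∣m∣n⇒∣m+n ∣-refl d)))

sgn-xor : ∀ a b → sgn (a xor b) ≡ sgn a *ᶻ sgn b
sgn-xor true true = refl
sgn-xor true false = refl
sgn-xor false true = refl
sgn-xor false false = refl

χ-⊕ : ∀ {n} (u x c : Subset n) → χ u (x ⊕ c) ≡ χ u x *ᶻ χ u c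
χ-⊕ [] [] [] = refl
χ-⊕ (false ∷ u) (a ∷ x) (b ∷ c) = χ-⊕ u x c
χ-⊕ (true ∷ u) (a ∷ x) (b ∷ c) = trans (cong₂ _*ᶻ_ (sgn-xor a b) (χ-⊕ u x c)) (lem (sgn a) (sgn b) (χ u x) (χ u c))
  where
  lem : ∀ p q r s → p *ᶻ q *ᶻ (r *ᶻ s) ≡ p *ᶻ r *ᶻ (q *ᶻ s)
  lem = solve-∀

χ-sym : ∀ {n} (u c : Subset n) → χ u c ≡ χ c u
χ-sym [] [] = refl
χ-sym (true ∷ u) (true ∷ c) = cong (-1ℤ *ᶻ_) (χ-sym u c)
χ-sym (true ∷ u) (false ∷ c) = trans (ℤ.*-identityˡ _) (χ-sym u c)
χ-sym (false ∷ u) (true ∷ c) = trans (χ-sym u c) (sym (ℤ.*-identityˡ _))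
χ-sym (false ∷ u) (false ∷ c) = χ-sym u c

⊕-cancel : ∀ {n} (x c : Subset n) → x ⊕ (x ⊕ c) ≡ c
⊕-cancel [] [] = refl
⊕-cancel (true ∷ x) (true ∷ c) = cong (true ∷_) (⊕-cancel x c)
⊕-cancel (true ∷ x) (false ∷ c) = cong (false ∷_) (⊕-cancel x c)
⊕-cancel (false ∷ x) (b ∷ c) = cong (b ∷_) (⊕-cancel x c)

x≡-x⇒x≡0 : ∀ {a} → a ≡ -1ℤ *ᶻ a → a ≡ 0ℤ
x≡-x⇒x≡0 {a} e = suc-cancel 1 a (trans (l a) (trans (cong (_-ᶻ (-1ℤ *ᶻ a)) e) (ℤ.+-inverseʳ (-1ℤ *ᶻ a))))
  where
  l : ∀ a → + 2 *ᶻ a ≡ a -ᶻ -1ℤ *ᶻ a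
  l = solve-∀

module SelfDual {n} (C : Code n) (lin : IsLinear C) (sd : IsSelfDual C) where

  ΣC : (Subset n → ℤ) → ℤ
  ΣC f = ΣW (λ c → ⟦ C c ⟧ *ᶻ f c)

  ΣC-cong : ∀ {f g} → (∀ c → c ∈C C → f c ≡ g c) → ΣC f ≡ ΣC g
  ΣC-cong {f} {g} p = ΣW-cong pt
    where
    pt : ∀ c → ⟦ C c ⟧ *ᶻ f c ≡ ⟦ C c ⟧ *ᶻ g c
    pt c with C c in e
    ... | true = cong (1ℤ *ᶻ_) (p c e)
    ... | false = refl

  ΣC-+ : ∀ f g → ΣC (λ c → f c +ᶻ g c) ≡ ΣC f +ᶻ ΣC g
  ΣC-+ f g = trans (ΣW-cong (λ c → ℤ.*-distribˡ-+ ⟦ C c ⟧ (f c) (g c))) (ΣW-+ (λ c → ⟦ C c ⟧ *ᶻ f c) (λ c → ⟦ C c ⟧ *ᶻ g c))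

  ΣC-*ˡ : ∀ a f → ΣC (λ c → a *ᶻ f c) ≡ a *ᶻ ΣC f
  ΣC-*ˡ a f = trans (ΣW-cong (λ c → l ⟦ C c ⟧ a (f c))) (ΣW-*ˡ a (λ c → ⟦ C c ⟧ *ᶻ f c))
    where
    l : ∀ b a x → b *ᶻ (a *ᶻ x) ≡ a *ᶻ (b *ᶻ x)
    l = solve-∀

  ΣC-0 : ΣC (λ _ → 0ℤ) ≡ 0ℤ
  ΣC-0 = trans (ΣW-cong (λ c → ℤ.*-zeroʳ ⟦ C c ⟧)) (ΣW-0 {n})

  ΣC-zero : ∀ {f} → (∀ c → c ∈C C → f c ≡ 0ℤ) → ΣC f ≡ 0ℤ
  ΣC-zero p = trans (ΣC-cong p) ΣC-0

  C-⊕ : ∀ {x} → x ∈C C → ∀ c → C (x ⊕ c) ≡ C c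
  C-⊕ {x} x∈ c with C c in e
  ... | true = proj₂ lin x c x∈ e
  ... | false with C (x ⊕ c) in e′
  ...   | false = refl
  ...   | true = trans (sym (trans (cong C (sym (⊕-cancel x c))) (proj₂ lin x (x ⊕ c) x∈ e′))) e

  ΣC-⊕ : ∀ {x} → x ∈C C → ∀ f → ΣC f ≡ ΣC (λ c → f (x ⊕ c))
  ΣC-⊕ {x} x∈ f = trans (ΣW-⊕ _ x) (ΣW-cong (λ c → cong (λ b → ⟦ b ⟧ *ᶻ f (x ⊕ c)) (C-⊕ x∈ c)))

  -- A word outside C = C^⊥ has odd intersection with some y in C, and translation of the sum by y
  -- changes its sign.
  ΣC-χ : ∀ u → ¬ (u ∈C C) → ΣC (χ u) ≡ 0ℤ
  ΣC-χ u u∉ with anySubset? (λ y → (C y Bool.≟ true) ×-dec ¬? (2 ∣? ∣ u ∩ y ∣))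
  ... | no none = contradiction (Equivalence.from (sd u)
        (λ y y∈ → decidable-stable (2 ∣? ∣ u ∩ y ∣) (λ o → none (y , y∈ , o)))) u∉
  ... | yes (y , y∈ , odd) with χ-parity u y
  ...   | inj₁ (_ , o) = contradiction o odd
  ...   | inj₂ (e , _) = x≡-x⇒x≡0 (trans (ΣC-⊕ y∈ (χ u))
    (trans (ΣC-cong (λ c _ → trans (χ-⊕ u y c) (cong (_*ᶻ χ u c) e))) (ΣC-*ˡ -1ℤ (χ u))))

  ΣC-χ∈ : ∀ u → u ∈C C → ΣC (χ u) ≡ ΣC (λ _ → 1ℤ)
  ΣC-χ∈ u u∈ = ΣC-cong pt
    where
    pt : ∀ c → c ∈C C → χ u c ≡ 1ℤ
    pt c c∈ with χ-parity u c
    ... | inj₁ (e , _) = e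
    ... | inj₂ (_ , o) = contradiction (Equivalence.to (sd u) u∈ c c∈) o

-- Combinations of characters of a fixed weight

data Span {n} : ℕ → (Subset n → ℤ) → Set where
  char : ∀ u → Span ∣ u ∣ (χ u)
  nil : ∀ {k} → Span k (λ _ → 0ℤ)
  add : ∀ {k f g} → Span k f → Span k g → Span k (λ c → f c +ᶻ g c)
  scale : ∀ {k f} a → Span k f → Span k (λ c → a *ᶻ f c)
  pointwise : ∀ {k f g} → (∀ c → f c ≡ g c) → Span k f → Span k g

lift : ∀ {n k} {g : Subset n → ℤ} → Span k g → Span k (λ c → g (Vec.tail c))
lift (char u) = pointwise (λ { (b ∷ c) → refl }) (char (false ∷ u))
lift nil = nil
lift (add s t) = add (lift s) (lift t)
lift (scale a s) = scale a (lift s)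
lift (pointwise p s) = pointwise (λ c → p (Vec.tail c)) (lift s)

liftχ : ∀ {n k} {g : Subset n → ℤ} → Span k g → Span (suc k) (λ c → sgn (Vec.head c) *ᶻ g (Vec.tail c))
liftχ (char u) = pointwise (λ { (b ∷ c) → refl }) (char (true ∷ u))
liftχ nil = pointwise (λ c → sym (ℤ.*-zeroʳ (sgn (Vec.head c)))) nil
liftχ (add s t) = pointwise (λ c → sym (ℤ.*-distribˡ-+ (sgn (Vec.head c)) _ _)) (add (liftχ s) (liftχ t))
liftχ (scale a s) = pointwise (λ c → l a (sgn (Vec.head c)) _) (scale a (liftχ s))
  where
  l : ∀ a b x → a *ᶻ (b *ᶻ x) ≡ b *ᶻ (a *ᶻ x)
  l = solve-∀
liftχ (pointwise p s) = pointwise (λ c → cong (sgn (Vec.head c) *ᶻ_) (p (Vec.tail c))) (liftχ s)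

-- The roles of a coordinate in the generating product: `out` contributes 1 ± X, `off` is a point of
-- a pair and taken out of the product, `on` is a point already chosen for the character and
-- contributes its sign.
data Label : Set where
  out off on : Label

#on : ∀ {n} → Vec Label n → ℕ
#on [] = 0
#on (on ∷ L) = suc (#on L)
#on (_ ∷ L) = #on L

factor : Bool → Ser
factor true = 1-X
factor false = 1+X

gen : ∀ {n} → Vec Label n → Subset n → Ser
gen [] [] = 1ˢ
gen (out ∷ L) (b ∷ c) = factor b *ˢ gen L c
gen (off ∷ L) (b ∷ c) = gen L c
gen (on ∷ L) (b ∷ c) = κ (sgn b) *ˢ gen L c

factor-* : ∀ b f → factor b *ˢ f ≈ f +ˢ κ (sgn b) *ˢ (X *ˢ f)
factor-* true f = solve 2 (λ x f → (con (+ 1) :+ :- x) :* f := f :+ con -1ℤ :* (x :* f)) reflˢ X f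
factor-* false f = solve 2 (λ x f → (con (+ 1) :+ x) :* f := f :+ con 1ℤ :* (x :* f)) reflˢ X f

-- Expanding the product, the coefficient of X^j picks j of the `out` coordinates; together with the
-- `on` coordinates they are the support of a character.
gen-Span : ∀ {n} (L : Vec Label n) j → Span (#on L + j) (λ c → gen L c j)
gen-Span [] zero = pointwise (λ { [] → refl }) (char [])
gen-Span [] (suc j) = pointwise (λ { [] → refl }) nil
gen-Span (off ∷ L) j = pointwise (λ { (b ∷ c) → refl }) (lift (gen-Span L j))
gen-Span (on ∷ L) j = pointwise (λ { (b ∷ c) → sym (κ-*ˢ (sgn b) (gen L c) j) }) (liftχ (gen-Span L j))
gen-Span (out ∷ L) zero = pointwise (λ { (true ∷ c) → sym (ℤ.*-identityˡ (gen L c 0)) ; (false ∷ c)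
  → sym (ℤ.*-identityˡ (gen L c 0)) })
  (lift (gen-Span L zero))
gen-Span {suc n} (out ∷ L) (suc j) = pointwise (λ { (b ∷ c) → sym (eq b c) })
  (add (lift (gen-Span L (suc j))) (subst (λ k → Span k g) (sym (ℕ.+-suc (#on L) j)) (liftχ (gen-Span L j))))
  where
  g : Subset (suc n) → ℤ
  g c = sgn (Vec.head c) *ᶻ gen L (Vec.tail c) j
  eq : ∀ b c → gen (out ∷ L) (b ∷ c) (suc j) ≡ gen L c (suc j) +ᶻ sgn b *ᶻ gen L c j
  eq b c = trans (factor-* b (gen L c) (suc j)) (cong (gen L c (suc j) +ᶻ_)
    (trans (κ-*ˢ (sgn b) (X *ˢ gen L c) (suc j)) (cong (sgn b *ᶻ_) (X*-suc (gen L c) j))))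

-- Specht sums

Pairs : ℕ → Set
Pairs n = List (Fin n × Fin n)

points : ∀ {n} → Pairs n → List (Fin n)
points [] = []
points ((a , b) ∷ P) = a ∷ b ∷ points P

specht : ∀ {n} → Pairs n → Subset n → ℤ
specht [] c = 1ℤ
specht ((a , b) ∷ P) c = (⟦ lookup c a ⟧ -ᶻ ⟦ lookup c b ⟧) *ᶻ specht P c

gen-on : ∀ {n} (L : Vec Label n) c i → lookup L i ≡ off → gen (L [ i ]≔ on) c ≈ κ (sgn (lookup c i)) *ˢ gen L c
gen-on (off ∷ L) (b ∷ c) zero e = reflˢ
gen-on (off ∷ L) (b ∷ c) (suc i) e = gen-on L c i e
gen-on (out ∷ L) (b ∷ c) (suc i) e = *ˢ-cong {factor b} reflˢ (gen-on L c i e)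
  ⟫ solve 3 (λ f s g → f :* (s :* g) := s :* (f :* g)) reflˢ (factor b) (κ (sgn (lookup c i))) (gen L c)
gen-on (on ∷ L) (b ∷ c) (suc i) e = *ˢ-cong {κ (sgn b)} reflˢ (gen-on L c i e)
  ⟫ solve 3 (λ f s g → f :* (s :* g) := s :* (f :* g)) reflˢ (κ (sgn b)) (κ (sgn (lookup c i))) (gen L c)

gen-off : ∀ {n} (L : Vec Label n) c i → lookup L i ≡ out → factor (lookup c i) *ˢ gen (L [ i ]≔ off) c ≈ gen L c
gen-off (out ∷ L) (b ∷ c) zero e = reflˢ
gen-off (off ∷ L) (b ∷ c) (suc i) e = gen-off L c i e
gen-off (out ∷ L) (b ∷ c) (suc i) e = solve 3 (λ f s g → f :* (s :* g) := s :* (f :* g)) reflˢ (factor (lookup c i))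
  (factor b) (gen (L [ i ]≔ off) c)
  ⟫ *ˢ-cong {factor b} reflˢ (gen-off L c i e)
gen-off (on ∷ L) (b ∷ c) (suc i) e = solve 3 (λ f s g → f :* (s :* g) := s :* (f :* g)) reflˢ (factor (lookup c i))
  (κ (sgn b)) (gen (L [ i ]≔ off) c)
  ⟫ *ˢ-cong {κ (sgn b)} reflˢ (gen-off L c i e)

#on-on : ∀ {n} (L : Vec Label n) i → lookup L i ≡ off → #on (L [ i ]≔ on) ≡ suc (#on L)
#on-on (off ∷ L) zero e = refl
#on-on (off ∷ L) (suc i) e = #on-on L i e
#on-on (out ∷ L) (suc i) e = #on-on L i e
#on-on (on ∷ L) (suc i) e = cong suc (#on-on L i e)

#on-off : ∀ {n} (L : Vec Label n) i → lookup L i ≡ out → #on (L [ i ]≔ off) ≡ #on L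
#on-off (out ∷ L) zero e = refl
#on-off (off ∷ L) (suc i) e = #on-off L i e
#on-off (out ∷ L) (suc i) e = #on-off L i e
#on-off (on ∷ L) (suc i) e = cong suc (#on-off L i e)

free : ∀ {n} → Vec Label n
free {n} = replicate n out

labels : ∀ {n} → Pairs n → Vec Label n
labels [] = free
labels ((a , b) ∷ P) = labels P [ a ]≔ off [ b ]≔ off

labels-out : ∀ {n} (P : Pairs n) i → All (i ≢_) (points P) → lookup (labels P) i ≡ out
labels-out [] i _ = lookup-replicate i out
labels-out ((a , b) ∷ P) i (i≢a ∷ i≢b ∷ r) =
  trans (lookup∘update′ i≢b (labels P [ a ]≔ off) off) (trans (lookup∘update′ i≢a (labels P) off) (labels-out P i r))

update-off : ∀ {n} (L : Vec Label n) i j → lookup L j ≡ off → lookup (L [ i ]≔ off) j ≡ off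
update-off L i j e with j Fin.≟ i
... | yes refl = lookup∘update i L off
... | no j≢i = trans (lookup∘update′ j≢i L off) e

labels-off : ∀ {n} (P : Pairs n) → All (λ i → lookup (labels P) i ≡ off) (points P)
labels-off [] = []
labels-off ((a , b) ∷ P) = update-off (labels P [ a ]≔ off) b a (lookup∘update a (labels P) off)
  ∷ lookup∘update b (labels P [ a ]≔ off) off
  ∷ All.map (λ {i} e → update-off (labels P [ a ]≔ off) b i (update-off (labels P) a i e)) (labels-off P)

#on-labels : ∀ {n} (P : Pairs n) → Unique (points P) → #on (labels P) ≡ 0
#on-labels {n} [] _ = go n
  where
  go : ∀ n → #on (replicate n out) ≡ 0
  go zero = refl
  go (suc n) = go n
#on-labels ((a , b) ∷ P) ((a≢b ∷ a≢) ∷ b≢ ∷ u) = trans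
  (#on-off (labels P [ a ]≔ off) b (trans (lookup∘update′ (a≢b ∘ sym) (labels P) off) (labels-out P b b≢)))
  (trans (#on-off (labels P) a (labels-out P a a≢)) (#on-labels P u))

factor-pair : ∀ b b′ → ⟦ b ⟧ -ᶻ ⟦ b′ ⟧ ≡ 0ℤ ⊎ factor b *ˢ factor b′ ≈ pq
factor-pair true true = inj₁ refl
factor-pair false false = inj₁ refl
factor-pair true false = inj₂ (*ˢ-comm 1-X 1+X)
factor-pair false true = inj₂ reflˢ

-- If the Specht product does not vanish, the two entries of each pair differ, so each pair accounts
-- for exactly (1+X)(1-X) in the full product.
gen-labels : ∀ {n} (P : Pairs n) c → Unique (points P) →
  specht P c ≡ 0ℤ ⊎ pq ^ˢ length P *ˢ gen (labels P) c ≈ gen free c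
gen-labels [] c _ = inj₂ (*ˢ-identityˡ (gen free c))
gen-labels ((a , b) ∷ P) c ((a≢b ∷ a≢) ∷ b≢ ∷ u) with factor-pair (lookup c a) (lookup c b) | gen-labels P c u
... | inj₁ z | _ = inj₁ (trans (cong (_*ᶻ specht P c) z) (ℤ.*-zeroˡ (specht P c)))
... | inj₂ _ | inj₁ z = inj₁ (trans (cong ((⟦ lookup c a ⟧ -ᶻ ⟦ lookup c b ⟧) *ᶻ_) z)
  (ℤ.*-zeroʳ (⟦ lookup c a ⟧ -ᶻ ⟦ lookup c b ⟧)))
... | inj₂ e | inj₂ ih = inj₂ (solve 3 (λ p q g → p :* q :* g := q :* (p :* g)) reflˢ pq (pq ^ˢ length P) g
    ⟫ *ˢ-cong {pq ^ˢ length P} reflˢ (*ˢ-cong {g = g} (symˢ e) reflˢ ⟫ *ˢ-assoc fa fb g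
    ⟫ *ˢ-cong {fa} reflˢ (gen-off (labels P [ a ]≔ off) c b
      (trans (lookup∘update′ (a≢b ∘ sym) (labels P) off) (labels-out P b b≢)))
    ⟫ gen-off (labels P) c a (labels-out P a a≢)) ⟫ ih)
  where
  g = gen (labels P [ a ]≔ off [ b ]≔ off) c
  fa = factor (lookup c a)
  fb = factor (lookup c b)

gen-free : ∀ {n} (c : Subset n) → Σ ℕ λ z → n ≡ z + ∣ c ∣ × gen free c ≈ 1+X ^ˢ z *ˢ 1-X ^ˢ ∣ c ∣
gen-free [] = 0 , refl , symˢ (*ˢ-identityˡ 1ˢ)
gen-free (true ∷ c) with gen-free c
... | z , e , p = z , trans (cong suc e) (sym (ℕ.+-suc z ∣ c ∣)) , (*ˢ-cong {1-X} reflˢ p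
  ⟫ solve 3 (λ f s g → f :* (s :* g) := s :* (f :* g)) reflˢ 1-X (1+X ^ˢ z) (1-X ^ˢ ∣ c ∣))
gen-free (false ∷ c) with gen-free c
... | z , e , p = suc z , cong suc e , (*ˢ-cong {1+X} reflˢ p ⟫ symˢ (*ˢ-assoc 1+X (1+X ^ˢ z) (1-X ^ˢ ∣ c ∣)))

^ˢ-*4 : ∀ f k → f ^ˢ (k * 4) ≈ (f *ˢ f *ˢ f *ˢ f) ^ˢ k
^ˢ-*4 f zero = reflˢ
^ˢ-*4 f (suc k) = solve 2 (λ f g → f :* (f :* (f :* (f :* g))) := f :* f :* f :* f :* g) reflˢ f (f ^ˢ (k * 4))
  ⟫ *ˢ-cong {f *ˢ f *ˢ f *ˢ f} reflˢ (^ˢ-*4 f k)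

hform-zero : ∀ M f → (∀ i → i ≤ M → f i ≡ 0ℤ) → hform M f ≈ 0ˢ
hform-zero zero f z k = trans (cong (λ a → κ a k) (z 0 z≤n)) (lem k)
  where
  lem : ∀ k → κ 0ℤ k ≡ 0ℤ
  lem zero = refl
  lem (suc k) = refl
hform-zero (suc M) f z k = cong₂ _+ᶻ_
  (trans (κ-*ˢ (f 0) (A ^ˢ suc M) k) (trans (cong (_*ᶻ (A ^ˢ suc M) k) (z 0 z≤n)) (ℤ.*-zeroˡ ((A ^ˢ suc M) k))))
  (trans (*ˢ-cong {B} reflˢ (hform-zero M (tail f) (λ i le → z (suc i) (s≤s le))) k) (≈.zeroʳ B k))

hform-at : ∀ s b f → (∀ a → a ≢ b → f a ≡ 0ℤ) → hform (s + b) f ≈ κ (f b) *ˢ (A ^ˢ s *ˢ B ^ˢ b)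
hform-at zero zero f z = solve 1 (λ a → a := a :* (con 1ℤ :* con 1ℤ)) reflˢ (κ (f 0))
hform-at (suc s) zero f z rewrite ℕ.+-identityʳ s =
  ≈.+-cong (reflˢ {κ (f 0) *ˢ A ^ˢ suc s}) (*ˢ-cong {B} reflˢ (hform-zero s (tail f) (λ i _ → z (suc i) (λ ()))) ⟫ ≈.zeroʳ B)
  ⟫ ≈.+-identityʳ _ ⟫ solve 2 (λ a p → a :* p := a :* (p :* con 1ℤ)) reflˢ (κ (f 0)) (A ^ˢ suc s)
hform-at s (suc b) f z rewrite ℕ.+-suc s b =
  ≈.+-cong ((λ k → trans (κ-*ˢ (f 0) (A ^ˢ suc (s + b)) k)
    (trans (cong (_*ᶻ (A ^ˢ suc (s + b)) k) (z 0 (λ ()))) (ℤ.*-zeroˡ ((A ^ˢ suc (s + b)) k)))) ⟫ reflˢ {0ˢ})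
    (*ˢ-cong {B} reflˢ (hform-at s b (tail f) (λ a a≢b → z (suc a) (a≢b ∘ ℕ.suc-injective))))
  ⟫ ≈.+-identityˡ _
  ⟫ solve 4 (λ B a p q → B :* (a :* (p :* q)) := a :* (p :* (B :* q))) reflˢ B (κ (f (suc b))) (A ^ˢ s) (B ^ˢ b)

hform-low : ∀ k L e → (∀ a → a ℕ.< k → e a ≡ 0ℤ) → hform (k + L) e ≈ B ^ˢ k *ˢ hform L (λ i → e (k + i))
hform-low zero L e z = symˢ (*ˢ-identityˡ (hform L e))
hform-low (suc k) L e z =
  ≈.+-cong ((λ j → trans (κ-*ˢ (e 0) (A ^ˢ suc (k + L)) j)
    (trans (cong (_*ᶻ (A ^ˢ suc (k + L)) j) (z 0 (s≤s z≤n))) (ℤ.*-zeroˡ ((A ^ˢ suc (k + L)) j)))) ⟫ reflˢ {0ˢ})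
    (*ˢ-cong {B} reflˢ (hform-low k L (tail e) (λ a lt → z (suc a) (s≤s lt))))
  ⟫ ≈.+-identityˡ _ ⟫ symˢ (*ˢ-assoc B (B ^ˢ k) _)

hform-top : ∀ k L e → (∀ a → L ℕ.< a → e a ≡ 0ℤ) → hform (L + k) e ≈ A ^ˢ k *ˢ hform L e
hform-top zero zero e z = symˢ (*ˢ-identityˡ (κ (e 0)))
hform-top (suc k) zero e z = ≈.+-cong (reflˢ {κ (e 0) *ˢ A ^ˢ suc k})
  (*ˢ-cong {B} reflˢ (hform-zero k (tail e) (λ i _ → z (suc i) (s≤s z≤n))) ⟫ ≈.zeroʳ B)
  ⟫ ≈.+-identityʳ _ ⟫ *ˢ-comm (κ (e 0)) (A ^ˢ suc k)
hform-top k (suc L) e z = ≈.+-cong (*ˢ-cong {κ (e 0)} reflˢ (^ˢ-+ A (suc L) k))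
  (*ˢ-cong {B} reflˢ (hform-top k L (tail e) (λ a lt → z (suc a) (s≤s lt))))
  ⟫ solve 5 (λ a p q B h → a :* (p :* q) :+ B :* (q :* h) := q :* (a :* p :+ B :* h)) reflˢ (κ (e 0)) (A ^ˢ suc L)
    (A ^ˢ k) B (hform L (tail e))

-- The Kronecker delta, built on `==ℕ` because this is the test by which `blocksThrough` selects the
-- weight.
δ : ℕ → ℕ → ℤ
δ w k = ⟦ w ==ℕ k ⟧

δ-refl : ∀ w → δ w w ≡ 1ℤ
δ-refl zero = refl
δ-refl (suc w) = δ-refl w

δ-≢ : ∀ w k → w ≢ k → δ w k ≡ 0ℤ
δ-≢ zero zero ne = contradiction refl ne
δ-≢ zero (suc k) ne = refl
δ-≢ (suc w) zero ne = refl
δ-≢ (suc w) (suc k) ne = δ-≢ w k (ne ∘ cong suc)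

hform-+ : ∀ M f g → hform M (f +ˢ g) ≈ hform M f +ˢ hform M g
hform-+ zero f g zero = refl
hform-+ zero f g (suc k) = refl
hform-+ (suc M) f g = ≈.+-cong (*ˢ-cong {κ (f 0 +ᶻ g 0)} {κ (f 0) +ˢ κ (g 0)} {A ^ˢ suc M}
  (λ { zero → refl ; (suc k) → refl }) reflˢ) (*ˢ-cong {B} reflˢ (hform-+ M (tail f) (tail g)))
  ⟫ solve 6 (λ a b p B h g → (a :+ b) :* p :+ B :* (h :+ g) := a :* p :+ B :* h :+ (b :* p :+ B :* g)) reflˢ
    (κ (f 0)) (κ (g 0)) (A ^ˢ suc M) B (hform M (tail f)) (hform M (tail g))

hform-ΣW : ∀ {n} M (φ : Subset n → Ser) k → hform M (λ a → ΣW (λ c → φ c a)) k ≡ ΣW (λ c → hform M (φ c) k)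
hform-ΣW {zero} M φ k = refl
hform-ΣW {suc n} M φ k = trans (hform-+ M (λ a → ΣW (λ c → φ (true ∷ c) a)) (λ a → ΣW (λ c → φ (false ∷ c) a)) k)
  (cong₂ _+ᶻ_ (hform-ΣW M (φ ∘ (true ∷_)) k) (hform-ΣW M (φ ∘ (false ∷_)) k))

*ˢ-ΣW : ∀ {n} f (φ : Subset n → Ser) k → (f *ˢ (λ a → ΣW (λ c → φ c a))) k ≡ ΣW (λ c → (f *ˢ φ c) k)
*ˢ-ΣW {zero} f φ k = refl
*ˢ-ΣW {suc n} f φ k = trans (*ˢ-distribˡ f (λ a → ΣW (λ c → φ (true ∷ c) a)) (λ a → ΣW (λ c → φ (false ∷ c) a)) k)
  (cong₂ _+ᶻ_ (*ˢ-ΣW f (φ ∘ (true ∷_)) k) (*ˢ-ΣW f (φ ∘ (false ∷_)) k))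

-- MacWilliams' identity for Specht sums

module Enumerators {n} (C : Code n) (lin : IsLinear C) (sd : IsSelfDual C) (de : IsDoublyEven C) where
  open SelfDual C lin sd public

  Span-sum : ∀ {k f} → (∀ x → x ∈C C → ∣ x ∣ ≢ k) → Span k f → ΣC f ≡ 0ℤ
  Span-sum h (char u) = ΣC-χ u (λ u∈ → h u u∈ refl)
  Span-sum h nil = ΣC-0
  Span-sum h (add {f = f} {g} s t) = trans (ΣC-+ f g) (cong₂ _+ᶻ_ (Span-sum h s) (Span-sum h t))
  Span-sum h (scale {f = f} a s) = trans (ΣC-*ˡ a f) (trans (cong (a *ᶻ_) (Span-sum h s)) (ℤ.*-zeroʳ a))
  Span-sum h (pointwise p s) = trans (ΣC-cong (λ c _ → sym (p c))) (Span-sum h s)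

  -- From 2(c_a - c_b) = (-1)^c_b - (-1)^c_a, each pair amounts to switching one of its two points
  -- `on`. What results is a combination of characters whose weight counts one point per pair, the
  -- `on` points and j further ones.
  gen-sum : ∀ (P : Pairs n) L j → Unique (points P) → All (λ i → lookup L i ≡ off) (points P) →
    (∀ x → x ∈C C → ∣ x ∣ ≢ #on L + length P + j) → ΣC (λ c → specht P c *ᶻ gen L c j) ≡ 0ℤ
  gen-sum [] L j _ _ h = trans (ΣC-cong (λ c _ → ℤ.*-identityˡ (gen L c j)))
    (Span-sum (λ x x∈ e → h x x∈ (trans e (cong (_+ j) (sym (ℕ.+-identityʳ (#on L)))))) (gen-Span L j))
  gen-sum ((a , b) ∷ P) L j ((a≢b ∷ a≢) ∷ b≢ ∷ u) (oa ∷ ob ∷ o) h = suc-cancel 1 _ twice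
    where
    other : ∀ i → lookup L i ≡ off → All (i ≢_) (points P) → ΣC (λ c → specht P c *ᶻ gen (L [ i ]≔ on) c j) ≡ 0ℤ
    other i oi i≢ = gen-sum P (L [ i ]≔ on) j u
      (All.zipWith (λ { {k} (ne , e) → trans (lookup∘update′ (ne ∘ sym) L on) e }) (i≢ , o))
      (λ x x∈ e → h x x∈ (trans e (trans (cong (λ s → s + length P + j) (#on-on L i oi))
        (cong (_+ j) (sym (ℕ.+-suc (#on L) (length P)))))))
    pt : ∀ c → + 2 *ᶻ (specht ((a , b) ∷ P) c *ᶻ gen L c j) ≡
      specht P c *ᶻ gen (L [ b ]≔ on) c j +ᶻ -1ℤ *ᶻ (specht P c *ᶻ gen (L [ a ]≔ on) c j)
    pt c = trans (l ⟦ lookup c a ⟧ ⟦ lookup c b ⟧ (specht P c) (gen L c j))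
      (cong₂ (λ s t → specht P c *ᶻ s +ᶻ -1ℤ *ᶻ (specht P c *ᶻ t)) (side b ob) (side a oa))
      where
      l : ∀ x y d g → + 2 *ᶻ ((x -ᶻ y) *ᶻ d *ᶻ g) ≡ d *ᶻ ((1ℤ -ᶻ + 2 *ᶻ y) *ᶻ g) +ᶻ -1ℤ *ᶻ (d *ᶻ ((1ℤ -ᶻ + 2 *ᶻ x) *ᶻ g))
      l = solve-∀
      side : ∀ i → lookup L i ≡ off → (1ℤ -ᶻ + 2 *ᶻ ⟦ lookup c i ⟧) *ᶻ gen L c j ≡ gen (L [ i ]≔ on) c j
      side i oi = sym (trans (gen-on L c i oi j)
        (trans (κ-*ˢ (sgn (lookup c i)) (gen L c) j) (cong (_*ᶻ gen L c j) (sgn-⟦⟧ (lookup c i)))))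
    twice : + 2 *ᶻ ΣC (λ c → specht ((a , b) ∷ P) c *ᶻ gen L c j) ≡ 0ℤ
    twice = trans (sym (ΣC-*ˡ (+ 2) _)) (trans (ΣC-cong (λ c _ → pt c)) (trans (ΣC-+ _ _)
      (cong₂ _+ᶻ_ (other b ob b≢) (trans (ΣC-*ˡ -1ℤ _) (cong (-1ℤ *ᶻ_) (other a oa a≢))))))

  enum : (Subset n → ℤ) → Ser
  enum g a = ΣC (λ c → δ ∣ c ∣ (a * 4) *ᶻ g c)

  spechtSeries : Pairs n → Ser
  spechtSeries P j = ΣC (λ c → specht P c *ᶻ gen (labels P) c j)

  spechtSeries-zero : ∀ P → Unique (points P) → ∀ j → (∀ x → x ∈C C → ∣ x ∣ ≢ length P + j) → spechtSeries P j ≡ 0ℤ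
  spechtSeries-zero P u j h = gen-sum P (labels P) j u (labels-off P)
    (λ x x∈ e → h x x∈ (trans e (cong (λ s → s + length P + j) (#on-labels P u))))

  module _ M (n≡ : n ≡ M * 4) where

    gen-δ : ∀ c → c ∈C C → ∀ x → κ x *ˢ gen free c ≈ hform M (λ a → δ ∣ c ∣ (a * 4) *ᶻ x)
    gen-δ c c∈ x with de c c∈
    ... | divides b w≡ = lhs ⟫ symˢ rhs
      where
      z = proj₁ (gen-free c)
      s = M ∸ b
      n≡z = proj₁ (proj₂ (gen-free c))
      b≤M : b ≤ M
      b≤M = ℕ.*-cancelʳ-≤ b M 4 (subst₂ _≤_ w≡ (trans (sym n≡z) n≡) (ℕ.m≤n+m ∣ c ∣ z))
      z≡ : z ≡ s * 4
      z≡ = trans (sym (ℕ.m+n∸n≡m z ∣ c ∣)) (trans (cong₂ _∸_ (trans (sym n≡z) n≡) w≡) (sym (ℕ.*-distribʳ-∸ 4 M b)))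
      lhs : κ x *ˢ gen free c ≈ κ x *ˢ (A ^ˢ s *ˢ B ^ˢ b)
      lhs = *ˢ-cong {κ x} reflˢ (proj₂ (proj₂ (gen-free c)) ⟫ *ˢ-cong
        ((λ k → cong (λ e → (1+X ^ˢ e) k) z≡) ⟫ ^ˢ-*4 1+X s) ((λ k → cong (λ e → (1-X ^ˢ e) k) w≡) ⟫ ^ˢ-*4 1-X b))
      rhs : hform M (λ a → δ ∣ c ∣ (a * 4) *ᶻ x) ≈ κ x *ˢ (A ^ˢ s *ˢ B ^ˢ b)
      rhs = (λ k → cong (λ N → hform N (λ a → δ ∣ c ∣ (a * 4) *ᶻ x) k) (sym (ℕ.m∸n+n≡m b≤M)))
        ⟫ hform-at s b (λ a → δ ∣ c ∣ (a * 4) *ᶻ x)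
          (λ a a≢b → trans (cong (_*ᶻ x) (δ-≢ ∣ c ∣ (a * 4) (λ e → a≢b (ℕ.*-cancelʳ-≡ a b 4 (trans (sym e) w≡))))) (ℤ.*-zeroˡ x))
        ⟫ *ˢ-cong {g = A ^ˢ s *ˢ B ^ˢ b} (λ k → cong (λ t → κ t k)
          (trans (cong (λ w → δ w (b * 4) *ᶻ x) w≡) (trans (cong (_*ᶻ x) (δ-refl (b * 4))) (ℤ.*-identityˡ x)))) reflˢ

    -- Multiplication by pq^t restores the points of the pairs: a codeword of weight 4a with nonzero
    -- Specht product then contributes (1+X)^(n-4a) (1-X)^(4a) = A^(M-a) B^a, and the other
    -- codewords contribute 0 on both sides.
    enum-form : ∀ P → Unique (points P) → pq ^ˢ length P *ˢ spechtSeries P ≈ hform M (enum (specht P))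
    enum-form P u k = trans (*ˢ-ΣW (pq ^ˢ length P) (λ c j → ⟦ C c ⟧ *ᶻ (specht P c *ᶻ gen (labels P) c j)) k)
      (trans (ΣW-cong pt) (sym (hform-ΣW M (λ c a → ⟦ C c ⟧ *ᶻ (δ ∣ c ∣ (a * 4) *ᶻ specht P c)) k)))
      where
      E = pq ^ˢ length P
      pt : ∀ c → (E *ˢ (λ j → ⟦ C c ⟧ *ᶻ (specht P c *ᶻ gen (labels P) c j))) k ≡ hform M
        (λ a → ⟦ C c ⟧ *ᶻ (δ ∣ c ∣ (a * 4) *ᶻ specht P c)) k
      pt c with C c in c∈
      ... | false = trans (*ˢ-cong {E} reflˢ (λ j → ℤ.*-zeroˡ (specht P c *ᶻ gen (labels P) c j)) k) (trans (≈.zeroʳ E k)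
            (sym (hform-zero M _ (λ a _ → ℤ.*-zeroˡ (δ ∣ c ∣ (a * 4) *ᶻ specht P c)) k)))
      ... | true = trans (lhs k) (trans (gen-δ c c∈ (specht P c) k) (form-cong A B M (λ a _ → sym (ℤ.*-identityˡ _)) k))
        where
        D = specht P c
        core : D ≡ 0ℤ ⊎ E *ˢ gen (labels P) c ≈ gen free c → κ D *ˢ (E *ˢ gen (labels P) c) ≈ κ D *ˢ gen free c
        core (inj₂ e) = *ˢ-cong {κ D} reflˢ e
        core (inj₁ z) k = trans (vanish (E *ˢ gen (labels P) c)) (sym (vanish (gen free c)))
          where
          vanish : ∀ g → (κ D *ˢ g) k ≡ 0ℤ
          vanish g = trans (κ-*ˢ D g k) (trans (cong (_*ᶻ g k) z) (ℤ.*-zeroˡ (g k)))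
        lhs : E *ˢ (λ j → 1ℤ *ᶻ (D *ᶻ gen (labels P) c j)) ≈ κ D *ˢ gen free c
        lhs = *ˢ-cong {E} reflˢ (λ j → trans (ℤ.*-identityˡ _) (sym (κ-*ˢ D (gen (labels P) c) j)))
          ⟫ solve 3 (λ e d g → e :* (d :* g) := d :* (e :* g)) reflˢ E (κ D) (gen (labels P) c) ⟫ core (gen-labels P c u)

-- Consequences of the minimum weight

ones : ∀ {n} → Subset n
ones {n} = replicate n true

lookup-∣0∣ : ∀ {n} (c : Subset n) → ∣ c ∣ ≡ 0 → ∀ i → lookup c i ≡ false
lookup-∣0∣ (false ∷ c) e zero = refl
lookup-∣0∣ (false ∷ c) e (suc i) = lookup-∣0∣ c e i

∣ones⊕∣ : ∀ {n} (c : Subset n) → ∣ ones ⊕ c ∣ + ∣ c ∣ ≡ n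
∣ones⊕∣ [] = refl
∣ones⊕∣ (true ∷ c) = trans (ℕ.+-suc ∣ ones ⊕ c ∣ ∣ c ∣) (cong suc (∣ones⊕∣ c))
∣ones⊕∣ (false ∷ c) = cong suc (∣ones⊕∣ c)

lookup-ones⊕ : ∀ {n} (c : Subset n) i → lookup (ones ⊕ c) i ≡ true xor lookup c i
lookup-ones⊕ (b ∷ c) zero = refl
lookup-ones⊕ (b ∷ c) (suc i) = lookup-ones⊕ c i

ones∩ : ∀ {n} (c : Subset n) → ones ∩ c ≡ c
ones∩ [] = refl
ones∩ (b ∷ c) = cong (b ∷_) (ones∩ c)

⟦not⟧ : ∀ b b′ → ⟦ true xor b ⟧ -ᶻ ⟦ true xor b′ ⟧ ≡ -ᶻ (⟦ b ⟧ -ᶻ ⟦ b′ ⟧)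
⟦not⟧ true true = refl
⟦not⟧ true false = refl
⟦not⟧ false true = refl
⟦not⟧ false false = refl

specht-const : ∀ {n} (P : Pairs n) c b → 1 ≤ length P → (∀ i → lookup c i ≡ b) → specht P c ≡ 0ℤ
specht-const ((x , y) ∷ P) c b _ h rewrite h x | h y = trans (cong (_*ᶻ specht P c) (ℤ.+-inverseʳ ⟦ b ⟧)) (ℤ.*-zeroˡ (specht P c))

-- The minimum weight is d = 4(m+1), and L + 1 is the number of multiples of 4 from d to n - d. The
-- three residue classes of n differ only in the relation between L and m.
module Extremal {n} (C : Code n) (lin : IsLinear C) (sd : IsSelfDual C) (de : IsDoublyEven C)
  (m L : ℕ) (n≡ : n ≡ (suc m + (L + suc m)) * 4)
  (minw : ∀ x → x ∈C C → 0 < ∣ x ∣ → suc m * 4 ≤ ∣ x ∣) where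

  open Enumerators C lin sd de public

  M : ℕ
  M = suc m + (L + suc m)

  even∈ : ∀ c → c ∈C C → 2 ∣ⁿ ∣ c ∣
  even∈ c c∈ with de c c∈
  ... | divides q e = divides (q * 2) (trans e (sym (ℕ.*-assoc q 2 2)))

  ones∈ : ones ∈C C
  ones∈ = Equivalence.from (sd ones) (λ y y∈ → subst (λ z → 2 ∣ⁿ ∣ z ∣) (sym (ones∩ y)) (even∈ y y∈))

  comp∈ : ∀ c → c ∈C C → (ones ⊕ c) ∈C C
  comp∈ c = proj₂ lin ones c ones∈

  ∣c∣≤n : ∀ (c : Subset n) → ∣ c ∣ ≤ n
  ∣c∣≤n c = subst (∣ c ∣ ≤_) (∣ones⊕∣ c) (ℕ.m≤n+m ∣ c ∣ ∣ ones ⊕ c ∣)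

  low-weight : ∀ c → c ∈C C → ∣ c ∣ < suc m * 4 → ∣ c ∣ ≡ 0
  low-weight c c∈ lt with ∣ c ∣ in e
  ... | zero = refl
  ... | suc k = contradiction (subst (suc m * 4 ≤_) e (minw c c∈ (subst (0 <_) (sym e) (s≤s z≤n)))) (ℕ.<⇒≱ lt)

  enum-low : ∀ (P : Pairs n) → 1 ≤ length P → ∀ a → a < suc m → enum (specht P) a ≡ 0ℤ
  enum-low P t≥1 a lt = ΣC-zero pt
    where
    pt : ∀ c → c ∈C C → δ ∣ c ∣ (a * 4) *ᶻ specht P c ≡ 0ℤ
    pt c c∈ with ∣ c ∣ ℕ.≟ a * 4
    ... | no ne = trans (cong (_*ᶻ specht P c) (δ-≢ _ _ ne)) (ℤ.*-zeroˡ (specht P c))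
    ... | yes e = trans (cong (δ ∣ c ∣ (a * 4) *ᶻ_) (specht-const P c false t≥1 (lookup-∣0∣ c
            (low-weight c c∈ (subst (_< suc m * 4) (sym e) (ℕ.*-monoˡ-< 4 lt)))))) (ℤ.*-zeroʳ (δ ∣ c ∣ (a * 4)))

  enum-high : ∀ (P : Pairs n) → 1 ≤ length P → ∀ a → suc m + L < a → enum (specht P) a ≡ 0ℤ
  enum-high P t≥1 a lt = ΣC-zero pt
    where
    true-xor : ∀ b → true xor b ≡ false → b ≡ true
    true-xor true _ = refl
    pt : ∀ c → c ∈C C → δ ∣ c ∣ (a * 4) *ᶻ specht P c ≡ 0ℤ
    pt c c∈ with ∣ c ∣ ℕ.≟ a * 4
    ... | no ne = trans (cong (_*ᶻ specht P c) (δ-≢ _ _ ne)) (ℤ.*-zeroˡ (specht P c))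
    ... | yes e = trans (cong (δ ∣ c ∣ (a * 4) *ᶻ_) (specht-const P c true t≥1 λ i → true-xor _ (trans (sym (lookup-ones⊕ c i))
            (lookup-∣0∣ (ones ⊕ c) (low-weight (ones ⊕ c) (comp∈ c c∈) small) i)))) (ℤ.*-zeroʳ (δ ∣ c ∣ (a * 4)))
      where
      small : ∣ ones ⊕ c ∣ < suc m * 4
      small = ℕ.+-cancelʳ-< ∣ c ∣ _ _ (begin-strict
        ∣ ones ⊕ c ∣ + ∣ c ∣        ≡⟨ trans (∣ones⊕∣ c) n≡ ⟩
        (suc m + (L + suc m)) * 4  ≡⟨ cong (_* 4) (trans (sym (ℕ.+-assoc (suc m) L (suc m))) (ℕ.+-comm (suc m + L) (suc m))) ⟩
        (suc m + (suc m + L)) * 4  ≡⟨ ℕ.*-distribʳ-+ 4 (suc m) (suc m + L) ⟩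
        suc m * 4 + (suc m + L) * 4 <⟨ ℕ.+-monoʳ-< (suc m * 4) (ℕ.*-monoˡ-< 4 lt) ⟩
        suc m * 4 + a * 4          ≡⟨ cong (λ w → suc m * 4 + w) e ⟨
        suc m * 4 + ∣ c ∣          ∎)
        where open ℕ.≤-Reasoning

  coeffs : Pairs n → Ser
  coeffs P i = enum (specht P) (suc m + i)

  coeffs-above : ∀ P → 1 ≤ length P → ∀ i → L < i → coeffs P i ≡ 0ℤ
  coeffs-above P t≥1 i lt = enum-high P t≥1 (suc m + i) (ℕ.+-monoʳ-< (suc m) lt)

  -- The m+1 empty places at either end split off (AB)^(m+1), and AB = pq⁴.
  hform-trim : ∀ e → (∀ a → a < suc m → e a ≡ 0ℤ) → (∀ a → suc m + L < a → e a ≡ 0ℤ) →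
    hform M e ≈ pq ^ˢ (suc m * 4) *ˢ hform L (λ i → e (suc m + i))
  hform-trim e low high = (hform-low (suc m) (L + suc m) e low
    ⟫ *ˢ-cong {B ^ˢ suc m} reflˢ (hform-top (suc m) L e′ (λ i lt → high (suc m + i) (ℕ.+-monoʳ-< (suc m) lt)))
    ⟫ solve 3 (λ a b c → a :* (b :* c) := b :* a :* c) reflˢ (B ^ˢ suc m) (A ^ˢ suc m) (hform L e′)
    ⟫ *ˢ-cong {g = hform L e′} (symˢ (^ˢ-distrib A B (suc m))
      ⟫ ^ˢ-cong (solve 2 (λ p q → p :* p :* p :* p :* (q :* q :* q :* q) := (p :* q) :* (p :* q) :* (p :* q) :*
        (p :* q)) reflˢ 1+X 1-X) (suc m)
      ⟫ symˢ (^ˢ-*4 pq (suc m))) reflˢ)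
    where
    e′ : Ser
    e′ i = e (suc m + i)

  module _ (P : Pairs n) (u : Unique (points P)) (t≥1 : 1 ≤ length P)
    (v : ℕ) (v≡ : length P + v ≡ suc m * 4) where

    series-form : spechtSeries P ≈ pq ^ˢ v *ˢ hform L (coeffs P)
    series-form = unit-cancelˡ (pq ^ˢ length P) _ _ (^ˢ-zero pq refl (length P))
      (enum-form M n≡ P u ⟫ hform-trim (enum (specht P)) (enum-low P t≥1) (enum-high P t≥1)
       ⟫ *ˢ-cong {g = hform L (coeffs P)} ((λ k → cong (λ w → (pq ^ˢ w) k) (sym v≡)) ⟫ ^ˢ-+ pq (length P) v) reflˢ
       ⟫ *ˢ-assoc (pq ^ˢ length P) (pq ^ˢ v) (hform L (coeffs P)))

    -- The coefficient of X^j comes from characters of weight t + j, where t is the number of pairs.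
    -- For j < v this lies strictly between 0 and d, where the code has no words.
    form-Vanish : Vanish v (hform L (coeffs P))
    form-Vanish = unit-cancel (pq ^ˢ v) _ (^ˢ-zero pq refl v) v λ j lt → trans (sym (series-form j))
      (spechtSeries-zero P u j λ x x∈ e → contradiction
        (subst (1 ≤_) (ℕ.m+n≡0⇒m≡0 (length P) (trans (sym e)
          (low-weight x x∈ (subst (_< suc m * 4) (sym e) (subst (length P + j <_) v≡ (ℕ.+-monoʳ-< (length P) lt))))))
          t≥1)
        (λ ()))

    coeffs-zero : L < v → coeffs P ≈ 0ˢ
    coeffs-zero lt = shape-zero L (coeffs P) (coeffs-above P t≥1) (λ j j≤L → form-Vanish j (ℕ.<-≤-trans j≤L lt))

    module _ (q : ℕ) (L≡ : v + q ≡ L) where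

      coeffs-shape : Shape v q (coeffs P)
      coeffs-shape = shape v q (coeffs P) (λ i lt → coeffs-above P t≥1 i (subst (_< i) L≡ lt))
        (subst (λ l → Vanish v (hform l (coeffs P))) (sym L≡) form-Vanish)

      -- As t + v = d is a multiple of 4, degree v + 4a + s belongs to characters of weight d + 4a +
      -- s, and for 1 ≤ s ≤ 3 no codeword has this weight.
      coeffs-gap : Gap (hform q (Shape.Q coeffs-shape))
      coeffs-gap = Q-gap v _ λ a s s≥1 s≤3 → trans (sym (trans (series-form (v + (a * 4 + s)))
          (*ˢ-cong {pq ^ˢ v} reflˢ ((λ k → cong (λ l → hform l (coeffs P) k) (sym L≡)) ⟫ Shape.form≈ coeffs-shape)
            (v + (a * 4 + s)))))
        (spechtSeries-zero P u (v + (a * 4 + s)) λ x x∈ e → not-div a s s≥1 s≤3 x x∈ e)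
        where
        not-div : ∀ a s → 1 ≤ s → s ≤ 3 → ∀ x → x ∈C C → ∣ x ∣ ≢ length P + (v + (a * 4 + s))
        not-div a s s≥1 s≤3 x x∈ e with de x x∈
        ... | divides k w = go s s≥1 s≤3 (trans (sym w) (trans e (trans (sym (ℕ.+-assoc (length P) v (a * 4 + s)))
              (trans (cong (_+ (a * 4 + s)) v≡) (trans (sym (ℕ.+-assoc (suc m * 4) (a * 4) s))
                (cong (_+ s) (sym (ℕ.*-distribʳ-+ 4 (suc m) a))))))))
          where
          mod-four : ∀ k b s → 1 ≤ s → s ≤ 3 → k * 4 ≢ b * 4 + s
          mod-four zero zero s s≥1 _ e = contradiction (subst (1 ≤_) (sym e) s≥1) (λ ())
          mod-four zero (suc b) s _ _ ()
          mod-four (suc k) zero s _ s≤3 e = contradiction (subst (_≤ 3) (sym e) s≤3) (ℕ.<⇒≱ (s≤s (s≤s (s≤s (s≤s z≤n)))))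
          mod-four (suc k) (suc b) s l u e = mod-four k b s l u (ℕ.+-cancelˡ-≡ 4 (k * 4) (b * 4 + s) e)
          go : ∀ s → 1 ≤ s → s ≤ 3 → k * 4 ≢ (suc m + a) * 4 + s
          go = mod-four k (suc m + a)

-- Designs

ΣFin : ∀ {n} → (Fin n → ℤ) → ℤ
ΣFin {zero} f = 0ℤ
ΣFin {suc n} f = f zero +ᶻ ΣFin (f ∘ suc)

ΣL : ∀ {A : Set} → (A → ℤ) → List A → ℤ
ΣL f [] = 0ℤ
ΣL f (x ∷ xs) = f x +ᶻ ΣL f xs

ΣFin-cong : ∀ {n} {f g : Fin n → ℤ} → (∀ i → f i ≡ g i) → ΣFin f ≡ ΣFin g
ΣFin-cong {zero} p = refl
ΣFin-cong {suc n} p = cong₂ _+ᶻ_ (p zero) (ΣFin-cong (p ∘ suc))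

ΣFin-0 : ∀ {n} → ΣFin {n} (λ _ → 0ℤ) ≡ 0ℤ
ΣFin-0 {zero} = refl
ΣFin-0 {suc n} = trans (ℤ.+-identityˡ _) (ΣFin-0 {n})

ΣFin-shift : ∀ {n} (f : Fin n → ℤ) x → ΣFin f ≡ ΣFin (λ i → f i -ᶻ x) +ᶻ + n *ᶻ x
ΣFin-shift {zero} f x = refl
ΣFin-shift {suc n} f x = trans (cong (f zero +ᶻ_) (ΣFin-shift (f ∘ suc) x))
  (trans (l (f zero) x (ΣFin (λ i → f (suc i) -ᶻ x)) (+ n))
    (cong (λ k → f zero -ᶻ x +ᶻ ΣFin (λ i → f (suc i) -ᶻ x) +ᶻ k *ᶻ x) (sym (ℤ.pos-+ 1 n))))
  where
  l : ∀ a x s n → a +ᶻ (s +ᶻ n *ᶻ x) ≡ (a -ᶻ x +ᶻ s) +ᶻ (1ℤ +ᶻ n) *ᶻ x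
  l = solve-∀

ΣFin-split : ∀ {n} (f : Fin n → ℤ) x → ΣFin f ≡ f x +ᶻ ΣFin (λ i → if does (i Fin.≟ x) then 0ℤ else f i)
ΣFin-split {suc n} f zero = cong (f zero +ᶻ_) (sym (ℤ.+-identityˡ _))
ΣFin-split {suc n} f (suc x) = trans (cong (f zero +ᶻ_) (ΣFin-split (f ∘ suc) x)) (l (f zero) (f (suc x)) _)
  where
  l : ∀ a b s → a +ᶻ (b +ᶻ s) ≡ b +ᶻ (a +ᶻ s)
  l = solve-∀

ΣL-cong : ∀ {A : Set} {f g : A → ℤ} {xs} → All (λ i → f i ≡ g i) xs → ΣL f xs ≡ ΣL g xs
ΣL-cong [] = refl
ΣL-cong (p ∷ ps) = cong₂ _+ᶻ_ p (ΣL-cong ps)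

ΣFin-support : ∀ {n} (g : Fin n → ℤ) xs → Unique xs → (∀ i → All (i ≢_) xs → g i ≡ 0ℤ) → ΣFin g ≡ ΣL g xs
ΣFin-support {n} g [] _ z = trans (ΣFin-cong (λ i → z i [])) (ΣFin-0 {n})
ΣFin-support g (x ∷ xs) (x≢ ∷ u) z = trans (ΣFin-split g x) (cong (g x +ᶻ_)
  (trans (ΣFin-support g′ xs u z′) (ΣL-cong (All.map same x≢))))
  where
  g′ : _ → ℤ
  g′ i = if does (i Fin.≟ x) then 0ℤ else g i
  z′ : ∀ i → All (i ≢_) xs → g′ i ≡ 0ℤ
  z′ i ne with i Fin.≟ x
  ... | yes _ = refl
  ... | no i≢x = z i (i≢x ∷ ne)
  same : ∀ {i} → x ≢ i → g′ i ≡ g i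
  same {i} x≢i with i Fin.≟ x
  ... | yes e = contradiction (sym e) x≢i
  ... | no _ = refl

ΣL-++ : ∀ {A : Set} (f : A → ℤ) xs ys → ΣL f (xs ++ ys) ≡ ΣL f xs +ᶻ ΣL f ys
ΣL-++ f [] ys = sym (ℤ.+-identityˡ _)
ΣL-++ f (x ∷ xs) ys = trans (cong (f x +ᶻ_) (ΣL-++ f xs ys)) (sym (ℤ.+-assoc (f x) _ _))

ΣL-shift : ∀ {A : Set} (f : A → ℤ) x xs → ΣL (λ i → f i -ᶻ x) xs ≡ ΣL f xs -ᶻ + length xs *ᶻ x
ΣL-shift f x [] = refl
ΣL-shift f x (i ∷ xs) = trans (cong (f i -ᶻ x +ᶻ_) (ΣL-shift f x xs))
  (trans (l (f i) x (ΣL f xs) (+ length xs)) (cong (λ k → f i +ᶻ ΣL f xs -ᶻ k *ᶻ x) (sym (ℤ.pos-+ 1 (length xs)))))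
  where
  l : ∀ a x s n → (a -ᶻ x) +ᶻ (s -ᶻ n *ᶻ x) ≡ (a +ᶻ s) -ᶻ (1ℤ +ᶻ n) *ᶻ x
  l = solve-∀

⟦⟧-idem : ∀ b → ⟦ b ⟧ *ᶻ ⟦ b ⟧ ≡ ⟦ b ⟧
⟦⟧-idem true = refl
⟦⟧-idem false = refl

inc : ∀ {n} → List (Fin n) → Subset n → ℤ
inc [] c = 1ℤ
inc (i ∷ R) c = ⟦ lookup c i ⟧ *ᶻ inc R c

inc-sum : ∀ {n} (R : List (Fin n)) c → ΣL (λ i → ⟦ lookup c i ⟧) R *ᶻ inc R c ≡ + length R *ᶻ inc R c
inc-sum [] c = refl
inc-sum (i ∷ R) c = trans (l ⟦ lookup c i ⟧ (ΣL (λ i → ⟦ lookup c i ⟧) R) (inc R c) )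
  (trans (cong₂ (λ s t → s *ᶻ inc R c +ᶻ ⟦ lookup c i ⟧ *ᶻ t) (⟦⟧-idem (lookup c i)) (inc-sum R c))
  (trans (l2 ⟦ lookup c i ⟧ (+ length R) (inc R c)) (cong (_*ᶻ (⟦ lookup c i ⟧ *ᶻ inc R c)) (sym (ℤ.pos-+ 1 (length R))))))
  where
  l : ∀ b s I → (b +ᶻ s) *ᶻ (b *ᶻ I) ≡ b *ᶻ b *ᶻ I +ᶻ b *ᶻ (s *ᶻ I)
  l = solve-∀
  l2 : ∀ b n I → b *ᶻ I +ᶻ b *ᶻ (n *ᶻ I) ≡ (1ℤ +ᶻ n) *ᶻ (b *ᶻ I)
  l2 = solve-∀

specht-sum : ∀ {n} (P : Pairs n) c → ΣL (λ i → ⟦ lookup c i ⟧) (points P) *ᶻ specht P c ≡ + length P *ᶻ specht P c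
specht-sum [] c = refl
specht-sum ((a , b) ∷ P) c = trans (l ⟦ lookup c a ⟧ ⟦ lookup c b ⟧ (ΣL (λ i → ⟦ lookup c i ⟧) (points P)) (specht P c))
  (trans (cong₂ (λ s t → s *ᶻ specht P c +ᶻ (⟦ lookup c a ⟧ -ᶻ ⟦ lookup c b ⟧) *ᶻ t)
    (cong₂ _-ᶻ_ (⟦⟧-idem (lookup c a)) (⟦⟧-idem (lookup c b))) (specht-sum P c))
  (trans (l2 (⟦ lookup c a ⟧ -ᶻ ⟦ lookup c b ⟧) (+ length P) (specht P c))
    (cong (_*ᶻ ((⟦ lookup c a ⟧ -ᶻ ⟦ lookup c b ⟧) *ᶻ specht P c)) (sym (ℤ.pos-+ 1 (length P))))))
  where
  l : ∀ a b s D → (a +ᶻ (b +ᶻ s)) *ᶻ ((a -ᶻ b) *ᶻ D) ≡ (a *ᶻ a -ᶻ b *ᶻ b) *ᶻ D +ᶻ (a -ᶻ b) *ᶻ (s *ᶻ D)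
  l = solve-∀
  l2 : ∀ x k D → x *ᶻ D +ᶻ x *ᶻ (k *ᶻ D) ≡ (1ℤ +ᶻ k) *ᶻ (x *ᶻ D)
  l2 = solve-∀

length-points : ∀ {n} (P : Pairs n) → + length (points P) ≡ + 2 *ᶻ + length P
length-points P = trans (cong +_ (go P)) (ℤ.pos-* 2 (length P))
  where
  go : ∀ P → length (points P) ≡ 2 * length P
  go [] = refl
  go (_ ∷ P) = trans (cong (λ l → suc (suc l)) (go P)) (sym (ℕ.*-suc 2 (length P)))

∣∣-ΣFin : ∀ {n} (c : Subset n) → ΣFin (λ i → ⟦ lookup c i ⟧) ≡ + ∣ c ∣
∣∣-ΣFin [] = refl
∣∣-ΣFin (true ∷ c) = trans (cong (1ℤ +ᶻ_) (∣∣-ΣFin c)) (sym (ℤ.pos-+ 1 ∣ c ∣))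
∣∣-ΣFin (false ∷ c) = trans (ℤ.+-identityˡ _) (∣∣-ΣFin c)

unique-mid : ∀ {A : Set} (xs : List A) r ys → Unique (xs ++ r ∷ ys) → All (r ≢_) (xs ++ ys) × Unique (xs ++ ys)
unique-mid [] r ys (r≢ ∷ u) = r≢ , u
unique-mid (x ∷ xs) r ys (x≢ ∷ u) with unique-mid xs r ys u | ++⁻ʳ xs x≢
... | r≢ , u′ | x≢r ∷ x≢ys = (λ e → x≢r (sym e)) ∷ r≢ , ++⁺ (++⁻ˡ xs x≢) x≢ys ∷ u′

ff : ℤ → ℕ → ℤ
ff x zero = 1ℤ
ff x (suc k) = x *ᶻ ff (x -ᶻ 1ℤ) k

ff-snoc : ∀ x k → ff x (suc k) ≡ ff x k *ᶻ (x -ᶻ + k)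
ff-snoc x zero = l x
  where
  l : ∀ x → x *ᶻ 1ℤ ≡ 1ℤ *ᶻ (x -ᶻ 0ℤ)
  l = solve-∀
ff-snoc x (suc k) = trans (cong (x *ᶻ_) (ff-snoc (x -ᶻ 1ℤ) k))
  (trans (l x (ff (x -ᶻ 1ℤ) k) (+ k)) (cong (λ s → x *ᶻ ff (x -ᶻ 1ℤ) k *ᶻ (x -ᶻ s)) (sym (ℤ.pos-+ 1 k))))
  where
  l : ∀ x f k → x *ᶻ (f *ᶻ (x -ᶻ 1ℤ -ᶻ k)) ≡ x *ᶻ f *ᶻ (x -ᶻ (1ℤ +ᶻ k))
  l = solve-∀

-- From Specht sums to block numbers

module Incidence {n} (C : Code n) (lin : IsLinear C) (sd : IsSelfDual C) where
  open SelfDual C lin sd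

  ΣFin-ΣC : ∀ {k} (φ : Fin k → Subset n → ℤ) → ΣFin (λ i → ΣC (φ i)) ≡ ΣC (λ c → ΣFin (λ i → φ i c))
  ΣFin-ΣC {zero} φ = sym ΣC-0
  ΣFin-ΣC {suc k} φ = trans (cong (ΣC (φ zero) +ᶻ_) (ΣFin-ΣC (φ ∘ suc))) (sym (ΣC-+ (φ zero) (λ c → ΣFin (λ i → φ (suc i) c))))

  ΣL-ΣC : ∀ {A : Set} (φ : A → Subset n → ℤ) xs → ΣL (λ i → ΣC (φ i)) xs ≡ ΣC (λ c → ΣL (λ i → φ i c) xs)
  ΣL-ΣC φ [] = sym ΣC-0
  ΣL-ΣC φ (x ∷ xs) = trans (cong (ΣC (φ x) +ᶻ_) (ΣL-ΣC φ xs)) (sym (ΣC-+ (φ x) (λ c → ΣL (λ i → φ i c) xs)))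

  -- These sums interpolate between Specht sums (`R` empty) and numbers of blocks through given
  -- points (`P` empty). The function of the weight is arbitrary, so that factors in |c| can be
  -- absorbed and several weights combined.
  H : (ℕ → ℤ) → Pairs n → List (Fin n) → ℤ
  H f P R = ΣC (λ c → f ∣ c ∣ *ᶻ (specht P c *ᶻ inc R c))

  H-point : ∀ (f : ℕ → ℤ) (P : Pairs n) i R c
    → f ∣ c ∣ *ᶻ (specht P c *ᶻ inc (i ∷ R) c) ≡ ⟦ lookup c i ⟧ *ᶻ (f ∣ c ∣ *ᶻ (specht P c *ᶻ inc R c))
  H-point f P i R c = l (f ∣ c ∣) (specht P c) ⟦ lookup c i ⟧ (inc R c)
    where
    l : ∀ f d b i → f *ᶻ (d *ᶻ (b *ᶻ i)) ≡ b *ᶻ (f *ᶻ (d *ᶻ i))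
    l = solve-∀

  ΣFin-*ʳ : ∀ {k} (φ : Fin k → ℤ) x → ΣFin (λ i → φ i *ᶻ x) ≡ ΣFin φ *ᶻ x
  ΣFin-*ʳ {zero} φ x = sym (ℤ.*-zeroˡ x)
  ΣFin-*ʳ {suc k} φ x = trans (cong (φ zero *ᶻ x +ᶻ_) (ΣFin-*ʳ (φ ∘ suc) x)) (sym (ℤ.*-distribʳ-+ x (φ zero) (ΣFin (φ ∘ suc))))

  ΣL-*ʳ : ∀ {A : Set} (φ : A → ℤ) x xs → ΣL (λ i → φ i *ᶻ x) xs ≡ ΣL φ xs *ᶻ x
  ΣL-*ʳ φ x [] = sym (ℤ.*-zeroˡ x)
  ΣL-*ʳ φ x (i ∷ xs) = trans (cong (φ i *ᶻ x +ᶻ_) (ΣL-*ʳ φ x xs)) (sym (ℤ.*-distribʳ-+ x (φ i) (ΣL φ xs)))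

  H-all : ∀ f P R → ΣFin (λ i → H f P (i ∷ R)) ≡ H (λ w → + w *ᶻ f w) P R
  H-all f P R = trans (ΣFin-ΣC {n} (λ i c → f ∣ c ∣ *ᶻ (specht P c *ᶻ inc (i ∷ R) c)))
    (ΣC-cong λ c _ → trans (ΣFin-cong (λ i → H-point f P i R c))
      (trans (ΣFin-*ʳ (λ i → ⟦ lookup c i ⟧) (f ∣ c ∣ *ᶻ (specht P c *ᶻ inc R c)))
      (trans (cong (_*ᶻ (f ∣ c ∣ *ᶻ (specht P c *ᶻ inc R c))) (∣∣-ΣFin c)) (sym (ℤ.*-assoc (+ ∣ c ∣) (f ∣ c ∣) _)))))

  -- A codeword that contributes contains all points of `R` and exactly one point of each pair.
  H-own : ∀ f P R → ΣL (λ i → H f P (i ∷ R)) (points P ++ R) ≡ (+ length P +ᶻ + length R) *ᶻ H f P R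
  H-own f P R = trans (ΣL-ΣC (λ i c → f ∣ c ∣ *ᶻ (specht P c *ᶻ inc (i ∷ R) c)) (points P ++ R))
    (trans (ΣC-cong pt) (ΣC-*ˡ (+ length P +ᶻ + length R) (λ c → f ∣ c ∣ *ᶻ (specht P c *ᶻ inc R c))))
    where
    b : Subset n → Fin n → ℤ
    b c i = ⟦ lookup c i ⟧
    pt : ∀ c → c ∈C C → ΣL (λ i → f ∣ c ∣ *ᶻ (specht P c *ᶻ inc (i ∷ R) c)) (points P ++ R) ≡
      (+ length P +ᶻ + length R) *ᶻ (f ∣ c ∣ *ᶻ (specht P c *ᶻ inc R c))
    pt c _ = trans (ΣL-cong (All.universal (λ i → H-point f P i R c) (points P ++ R)))
      (trans (ΣL-*ʳ (b c) (f ∣ c ∣ *ᶻ (specht P c *ᶻ inc R c)) (points P ++ R))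
      (trans (cong (_*ᶻ (f ∣ c ∣ *ᶻ (specht P c *ᶻ inc R c))) (ΣL-++ (b c) (points P) R))
      (trans (l (ΣL (b c) (points P)) (ΣL (b c) R) (f ∣ c ∣) (specht P c) (inc R c))
      (trans (cong₂ (λ s t → f ∣ c ∣ *ᶻ (s *ᶻ inc R c +ᶻ specht P c *ᶻ t)) (specht-sum P c) (inc-sum R c))
        (l2 (+ length P) (+ length R) (f ∣ c ∣) (specht P c) (inc R c))))))
      where
      l : ∀ p r f d i → (p +ᶻ r) *ᶻ (f *ᶻ (d *ᶻ i)) ≡ f *ᶻ (p *ᶻ d *ᶻ i +ᶻ d *ᶻ (r *ᶻ i))
      l = solve-∀
      l2 : ∀ p r f d i → f *ᶻ (p *ᶻ d *ᶻ i +ᶻ d *ᶻ (r *ᶻ i)) ≡ (p +ᶻ r) *ᶻ (f *ᶻ (d *ᶻ i))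
      l2 = solve-∀

  -- Summing over an extra point i inserts the factor |c|. The points of `P` and `R` account for k +
  -- |R| of it, where k is the number of pairs; the remaining n - 2k - |R| points contribute x each.
  H-partition : ∀ f P R x → Unique (points P ++ R) → (∀ i → All (i ≢_) (points P ++ R) → H f P (i ∷ R) ≡ x) →
    (+ n -ᶻ (+ 2 *ᶻ + length P +ᶻ + length R)) *ᶻ x ≡ H (λ w → f w *ᶻ (+ w -ᶻ (+ length P +ᶻ + length R))) P R
  H-partition f P R x u const = trans (l (+ n) (+ length P) (+ length R) x h)
    (trans (cong (_-ᶻ (+ length P +ᶻ + length R) *ᶻ h) (sym total))
    (trans (cong (λ t → H (λ w → + w *ᶻ f w) P R +ᶻ t)
      (trans (ℤ.neg-distribˡ-* (+ length P +ᶻ + length R) h) (sym (ΣC-*ˡ (-ᶻ (+ length P +ᶻ + length R)) _))))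
    (trans (sym (ΣC-+ _ _)) (ΣC-cong (λ c _ → l2 (+ ∣ c ∣) (f ∣ c ∣) (+ length P +ᶻ + length R) (specht P c *ᶻ inc R c))))))
    where
    h = H f P R
    ϕ : Fin n → ℤ
    ϕ i = H f P (i ∷ R)
    total : H (λ w → + w *ᶻ f w) P R ≡ (+ length P +ᶻ + length R) *ᶻ h -ᶻ (+ 2 *ᶻ + length P +ᶻ + length R) *ᶻ x +ᶻ + n *ᶻ x
    total = trans (sym (H-all f P R)) (trans (ΣFin-shift ϕ x) (cong (_+ᶻ + n *ᶻ x)
      (trans (ΣFin-support (λ i → ϕ i -ᶻ x) (points P ++ R) u (λ i ne → trans (cong (_-ᶻ x) (const i ne)) (ℤ.+-inverseʳ x)))
      (trans (ΣL-shift ϕ x (points P ++ R)) (cong₂ (λ s t → s -ᶻ t *ᶻ x) (H-own f P R)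
        (trans (cong +_ (length-++ (points P))) (trans (ℤ.pos-+ (length (points P)) (length R))
          (cong (_+ᶻ + length R) (length-points P)))))))))
    l : ∀ n k r x h → (n -ᶻ (+ 2 *ᶻ k +ᶻ r)) *ᶻ x ≡ ((k +ᶻ r) *ᶻ h -ᶻ (+ 2 *ᶻ k +ᶻ r) *ᶻ x +ᶻ n *ᶻ x) -ᶻ (k +ᶻ r) *ᶻ h
    l = solve-∀
    l2 : ∀ w f s D → w *ᶻ f *ᶻ D +ᶻ -ᶻ s *ᶻ (f *ᶻ D) ≡ f *ᶻ (w -ᶻ s) *ᶻ D
    l2 = solve-∀

  H-swap : ∀ f P R r s → H f ((r , s) ∷ P) R ≡ H f P (r ∷ R) -ᶻ H f P (s ∷ R)
  H-swap f P R r s = trans (ΣC-cong (λ c _ → l (f ∣ c ∣) (specht P c) ⟦ lookup c r ⟧ ⟦ lookup c s ⟧ (inc R c)))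
    (trans (ΣC-+ _ _) (cong (H f P (r ∷ R) +ᶻ_) (trans (ΣC-*ˡ -1ℤ _) (ℤ.-1*i≡-i (H f P (s ∷ R))))))
    where
    l : ∀ f d a b i → f *ᶻ ((a -ᶻ b) *ᶻ d *ᶻ i) ≡ f *ᶻ (d *ᶻ (a *ᶻ i)) +ᶻ -1ℤ *ᶻ (f *ᶻ (d *ᶻ (b *ᶻ i)))
    l = solve-∀

  -- Replacing the extra point r by s changes the sum by the one with the additional pair (r , s).
  -- If all of these vanish, the choice of the extra point does not matter and `H-partition`
  -- applies.
  H-step : ∀ f P r R → Unique (points P ++ r ∷ R) →
    (∀ s → Unique (points ((r , s) ∷ P) ++ R) → H f ((r , s) ∷ P) R ≡ 0ℤ) →
    (+ n -ᶻ (+ 2 *ᶻ + length P +ᶻ + length R)) *ᶻ H f P (r ∷ R) ≡ H (λ w → f w *ᶻ (+ w -ᶻ (+ length P +ᶻ + length R))) P R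
  H-step f P r R u kill = H-partition f P R (H f P (r ∷ R)) (proj₂ split) same
    where
    split = unique-mid (points P) r R u
    same : ∀ i → All (i ≢_) (points P ++ R) → H f P (i ∷ R) ≡ H f P (r ∷ R)
    same i ne with i Fin.≟ r
    ... | yes refl = refl
    ... | no i≢r = sym (ℤ.i-j≡0⇒i≡j _ _ (trans (sym (H-swap f P R r i)) (kill i ((i≢r ∘ sym ∷ proj₁ split) ∷ ne ∷ proj₂ split))))

  Killed : (ℕ → ℤ) → ℕ → Set
  Killed f k = ∀ (P : Pairs n) → Unique (points P) → length P ≡ k → ΣC (λ c → f ∣ c ∣ *ᶻ specht P c) ≡ 0ℤ

  Killed-cong : ∀ {f g k} → (∀ w → f w ≡ g w) → Killed f k → Killed g k
  Killed-cong p K P u e = trans (ΣC-cong (λ c _ → cong (_*ᶻ specht P c) (sym (p ∣ c ∣)))) (K P u e)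

  -- The weight function after all l points of `R` have been removed by `H-partition`: the factors
  -- collected are w - k - i for i < l.
  ff-shift : (ℕ → ℤ) → ℕ → ℕ → ℕ → ℤ
  ff-shift f k l w = f w *ᶻ ff (+ w -ᶻ + k) l

  nonzero : ∀ k l → 2 * (k + suc l) ≤ n → + n -ᶻ (+ 2 *ᶻ + k +ᶻ + l) ≢ 0ℤ
  nonzero k l le e = ℕ.<⇒≢ lt (sym (ℤ.+-injective
    (trans (ℤ.i-j≡0⇒i≡j (+ n) _ e) (sym (trans (ℤ.pos-+ (2 * k) l) (cong (_+ᶻ + l) (ℤ.pos-* 2 k)))))))
    where
    lt : 2 * k + l < n
    lt = ℕ.<-≤-trans (ℕ.≤-<-trans (ℕ.+-monoʳ-≤ (2 * k) (ℕ.m≤n*m l 2))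
      (subst (_< 2 * (k + suc l)) (ℕ.*-distribˡ-+ 2 k l) (ℕ.*-monoʳ-< 2 (ℕ.+-monoʳ-< k (ℕ.n<1+n l))))) le

  ff-absorb : ∀ (f : ℕ → ℤ) k l i → i ≤ l → ∀ w →
    ff-shift f (k + i) (suc l ∸ i) w ≡ ff-shift (λ w → f w *ᶻ (+ w -ᶻ (+ k +ᶻ + l))) (k + i) (l ∸ i) w
  ff-absorb f k l i i≤l w rewrite ℕ.+-∸-assoc 1 i≤l | ff-snoc (+ w -ᶻ + (k + i)) (l ∸ i) =
    trans (cong (λ t → f w *ᶻ (ff (+ w -ᶻ + (k + i)) (l ∸ i) *ᶻ t)) arg) (l₁ (f w) _ _)
    where
    l₁ : ∀ a b c → a *ᶻ (b *ᶻ c) ≡ a *ᶻ c *ᶻ b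
    l₁ = solve-∀
    l₂ : ∀ w k i j → w -ᶻ (k +ᶻ i) -ᶻ j ≡ w -ᶻ (k +ᶻ (i +ᶻ j))
    l₂ = solve-∀
    arg : + w -ᶻ + (k + i) -ᶻ + (l ∸ i) ≡ + w -ᶻ (+ k +ᶻ + l)
    arg = trans (cong (λ t → + w -ᶻ t -ᶻ + (l ∸ i)) (ℤ.pos-+ k i)) (trans (l₂ (+ w) (+ k) (+ i) (+ (l ∸ i)))
      (cong (λ t → + w -ᶻ (+ k +ᶻ t)) (trans (sym (ℤ.pos-+ i (l ∸ i))) (cong +_ (ℕ.m+[n∸m]≡n i≤l)))))

  -- Removal of a point either turns it into a further pair (degree k + 1) or multiplies the weight
  -- function by a factor (same degree, one point fewer). The recursion ends in pure Specht sums of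
  -- the degrees k to k + l.
  H-zero : ∀ l k f → 2 * (k + l) ≤ n → (∀ i → i ≤ l → Killed (ff-shift f (k + i) (l ∸ i)) (k + i)) →
    ∀ P R → length P ≡ k → length R ≡ l → Unique (points P ++ R) → H f P R ≡ 0ℤ
  H-zero zero k f le K P [] refl _ u = trans (ΣC-cong (λ c _ → l (f ∣ c ∣) (specht P c)))
    (Killed-cong {ff-shift f (length P + 0) 0} {λ w → f w *ᶻ 1ℤ} (λ w → refl)
      (λ P′ u′ e → K 0 z≤n P′ u′ (trans e (sym (ℕ.+-identityʳ (length P))))) P (proj₂ (unique-nil (points P) u)) refl)
    where
    l : ∀ f d → f *ᶻ (d *ᶻ 1ℤ) ≡ f *ᶻ 1ℤ *ᶻ d
    l = solve-∀
    unique-nil : ∀ (xs : List (Fin n)) → Unique (xs ++ []) → Σ (xs ++ [] ≡ xs) λ _ → Unique xs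
    unique-nil xs u = e , subst Unique e u
      where
      e = ++-identityʳ xs
  H-zero (suc l) k f le K P (r ∷ R) refl eR u = cancelˡ _ (nonzero k l le)
    (trans (subst (λ s → (+ n -ᶻ (+ 2 *ᶻ + k +ᶻ + s)) *ᶻ H f P (r ∷ R) ≡ H (λ w → f w *ᶻ (+ w -ᶻ (+ k +ᶻ + s))) P R) lR
        (H-step f P r R u (λ s us → H-zero l (suc k) f (subst (λ t → 2 * t ≤ n) (ℕ.+-suc k l) le)
          (λ i i≤l → subst (λ t → Killed (ff-shift f t (l ∸ i)) t) (ℕ.+-suc k i) (K (suc i) (s≤s i≤l)))
          ((r , s) ∷ P) R refl lR us)))
      (H-zero l k (λ w → f w *ᶻ (+ w -ᶻ (+ k +ᶻ + l))) (ℕ.≤-trans (ℕ.*-monoʳ-≤ 2 (ℕ.+-monoʳ-≤ k (ℕ.n≤1+n l))) le)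
        (λ i i≤l → Killed-cong (ff-absorb f k l i i≤l) (K i (ℕ.m≤n⇒m≤1+n i≤l))) P R refl lR
          (proj₂ (unique-mid (points P) r R u))))
    where
    lR = ℕ.suc-injective eR

  -- For f = `δ` this is the usual λ = b (w)_l / (n)_l with the denominator cleared; integrality of
  -- `H` is what the later contradictions exploit.
  H-value : ∀ l f → 2 * l ≤ n → (∀ i → 1 ≤ i → i ≤ l → Killed (ff-shift f i (l ∸ i)) i) →
    ∀ R → length R ≡ l → Unique R → ff (+ n) l *ᶻ H f [] R ≡ ΣC (λ c → f ∣ c ∣ *ᶻ ff (+ ∣ c ∣) l)
  H-value zero f le K [] _ _ = trans (ℤ.*-identityˡ _) (ΣC-cong (λ c _ → refl))
  H-value (suc l) f le K (r ∷ R) eR u = begin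
    ff (+ n) (suc l) *ᶻ H f [] (r ∷ R)                         ≡⟨ cong (_*ᶻ H f [] (r ∷ R)) (ff-snoc (+ n) l) ⟩
    ff (+ n) l *ᶻ (+ n -ᶻ + l) *ᶻ H f [] (r ∷ R)               ≡⟨ ℤ.*-assoc (ff (+ n) l) _ _ ⟩
    ff (+ n) l *ᶻ ((+ n -ᶻ + l) *ᶻ H f [] (r ∷ R))             ≡⟨ cong (ff (+ n) l *ᶻ_) step ⟩
    ff (+ n) l *ᶻ H f′ [] R                                    ≡⟨ H-value l f′
      (ℕ.≤-trans (ℕ.*-monoʳ-≤ 2 (ℕ.n≤1+n l)) le) K′ R lR (proj₂ (unique-mid [] r R u)) ⟩
    ΣC (λ c → f′ ∣ c ∣ *ᶻ ff (+ ∣ c ∣) l)                      ≡⟨ ΣC-cong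
      (λ c _ → trans (l₁ (f ∣ c ∣) (+ ∣ c ∣) (+ l) (ff (+ ∣ c ∣) l)) (cong (f ∣ c ∣ *ᶻ_) (sym (ff-snoc (+ ∣ c ∣) l)))) ⟩
    ΣC (λ c → f ∣ c ∣ *ᶻ ff (+ ∣ c ∣) (suc l))                 ∎
    where
    open ≡-Reasoning
    lR = ℕ.suc-injective eR
    f′ : ℕ → ℤ
    f′ w = f w *ᶻ (+ w -ᶻ (0ℤ +ᶻ + l))
    l₁ : ∀ f w l x → f *ᶻ (w -ᶻ (0ℤ +ᶻ l)) *ᶻ x ≡ f *ᶻ (x *ᶻ (w -ᶻ l))
    l₁ = solve-∀
    K′ : ∀ i → 1 ≤ i → i ≤ l → Killed (ff-shift f′ i (l ∸ i)) i
    K′ i i≥1 i≤l = Killed-cong (ff-absorb f 0 l i i≤l) (K i i≥1 (ℕ.m≤n⇒m≤1+n i≤l))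
    step : (+ n -ᶻ + l) *ᶻ H f [] (r ∷ R) ≡ H f′ [] R
    step = subst (λ s → (+ n -ᶻ + s) *ᶻ H f [] (r ∷ R) ≡ H (λ w → f w *ᶻ (+ w -ᶻ (0ℤ +ᶻ + s))) [] R) lR
      (trans (cong (λ t → (+ n -ᶻ t) *ᶻ H f [] (r ∷ R)) (sym (ℤ.+-identityˡ (+ length R))))
        (H-step f [] r R u (λ s us → H-zero l 1 f le (λ i i≤l → K (suc i) (s≤s z≤n) (s≤s i≤l)) ((r , s) ∷ []) R refl lR us)))

-- Block numbers as sums over words

length-filterᵇ-++ : ∀ {A : Set} (p : A → Bool) xs ys
  → length (filterᵇ p (xs ++ ys)) ≡ length (filterᵇ p xs) + length (filterᵇ p ys)
length-filterᵇ-++ p [] ys = refl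
length-filterᵇ-++ p (x ∷ xs) ys with p x
... | true = cong suc (length-filterᵇ-++ p xs ys)
... | false = length-filterᵇ-++ p xs ys

length-filterᵇ-map : ∀ {A B : Set} (p : B → Bool) (f : A → B) xs → length (filterᵇ p (map f xs)) ≡ length (filterᵇ (p ∘ f) xs)
length-filterᵇ-map p f [] = refl
length-filterᵇ-map p f (x ∷ xs) with p (f x)
... | true = cong suc (length-filterᵇ-map p f xs)
... | false = length-filterᵇ-map p f xs

count-words : ∀ n (p : Subset n → Bool) → + length (filterᵇ p (allWords n)) ≡ ΣW (λ c → ⟦ p c ⟧)
count-words zero p with p []
... | true = refl
... | false = refl
count-words (suc n) p = trans (cong +_ (length-filterᵇ-++ p (map (true ∷_) (allWords n)) _))
  (trans (ℤ.pos-+ (length (filterᵇ p (map (true ∷_) (allWords n)))) _)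
  (cong₂ _+ᶻ_ (trans (cong +_ (length-filterᵇ-map p (true ∷_) (allWords n))) (count-words n (p ∘ (true ∷_))))
              (trans (cong +_ (length-filterᵇ-map p (false ∷_) (allWords n))) (count-words n (p ∘ (false ∷_))))))

fromList : ∀ {n} → List (Fin n) → Subset n
fromList [] = ⊥
fromList (i ∷ R) = fromList R [ i ]≔ true

elems : ∀ {n} → Subset n → List (Fin n)
elems [] = []
elems (true ∷ T) = zero ∷ map suc (elems T)
elems (false ∷ T) = map suc (elems T)

fromList-map-suc : ∀ {n} (R : List (Fin n)) → fromList (map suc R) ≡ false ∷ fromList R
fromList-map-suc [] = refl
fromList-map-suc (i ∷ R) = cong (_[ suc i ]≔ true) (fromList-map-suc R)

fromList-elems : ∀ {n} (T : Subset n) → fromList (elems T) ≡ T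
fromList-elems [] = refl
fromList-elems (true ∷ T) = trans (cong (_[ zero ]≔ true) (fromList-map-suc (elems T))) (cong (true ∷_) (fromList-elems T))
fromList-elems (false ∷ T) = trans (fromList-map-suc (elems T)) (cong (false ∷_) (fromList-elems T))

unique-map-suc : ∀ {n} {R : List (Fin n)} → Unique R → Unique (map Fin.suc R)
unique-map-suc = Unique.map⁺ Fin.suc-injective

zero≢map-suc : ∀ {n} (R : List (Fin n)) → All (Fin.zero ≢_) (map Fin.suc R)
zero≢map-suc [] = []
zero≢map-suc (i ∷ R) = (λ ()) ∷ zero≢map-suc R

elems-unique : ∀ {n} (T : Subset n) → Unique (elems T)
elems-unique [] = []
elems-unique (true ∷ T) = zero≢map-suc (elems T) ∷ unique-map-suc (elems-unique T)
elems-unique (false ∷ T) = unique-map-suc (elems-unique T)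

elems-length : ∀ {n} (T : Subset n) → length (elems T) ≡ ∣ T ∣
elems-length [] = refl
elems-length (true ∷ T) = cong suc (trans (length-map suc (elems T)) (elems-length T))
elems-length (false ∷ T) = trans (length-map suc (elems T)) (elems-length T)

lookup-fromList : ∀ {n} (R : List (Fin n)) i → All (i ≢_) R → lookup (fromList R) i ≡ false
lookup-fromList [] i _ = lookup-replicate i false
lookup-fromList (r ∷ R) i (ne ∷ p) = trans (lookup∘update′ ne (fromList R) true) (lookup-fromList R i p)

∣insert∣ : ∀ {n} (T : Subset n) i → lookup T i ≡ false → ∣ T [ i ]≔ true ∣ ≡ suc ∣ T ∣
∣insert∣ (false ∷ T) zero e = refl
∣insert∣ (true ∷ T) (suc i) e = cong suc (∣insert∣ T i e)
∣insert∣ (false ∷ T) (suc i) e = ∣insert∣ T i e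

∣⊥∣ : ∀ n → ∣ ⊥ {n} ∣ ≡ 0
∣⊥∣ zero = refl
∣⊥∣ (suc n) = ∣⊥∣ n

fromList-size : ∀ {n} (R : List (Fin n)) → Unique R → ∣ fromList R ∣ ≡ length R
fromList-size {n} [] _ = ∣⊥∣ n
fromList-size (i ∷ R) (i≢ ∷ u) = trans (∣insert∣ (fromList R) i (lookup-fromList R i i≢)) (cong suc (fromList-size R u))

⊆ᵇ-insert : ∀ {n} (T c : Subset n) i → ⟦ (T [ i ]≔ true) ⊆ᵇ c ⟧ ≡ ⟦ lookup c i ⟧ *ᶻ ⟦ T ⊆ᵇ c ⟧
⊆ᵇ-insert (true ∷ T) (true ∷ c) zero = sym (ℤ.*-identityˡ _)
⊆ᵇ-insert (true ∷ T) (false ∷ c) zero = refl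
⊆ᵇ-insert (false ∷ T) (true ∷ c) zero = sym (ℤ.*-identityˡ _)
⊆ᵇ-insert (false ∷ T) (false ∷ c) zero = sym (ℤ.*-zeroˡ ⟦ T ⊆ᵇ c ⟧)
⊆ᵇ-insert (true ∷ T) (true ∷ c) (suc i) = ⊆ᵇ-insert T c i
⊆ᵇ-insert (true ∷ T) (false ∷ c) (suc i) = sym (ℤ.*-zeroʳ ⟦ lookup c i ⟧)
⊆ᵇ-insert (false ∷ T) (b ∷ c) (suc i) = ⊆ᵇ-insert T c i

⊥⊆ᵇ : ∀ {n} (c : Subset n) → ⊥ ⊆ᵇ c ≡ true
⊥⊆ᵇ [] = refl
⊥⊆ᵇ (b ∷ c) = ⊥⊆ᵇ c

⊆ᵇ-inc : ∀ {n} (R : List (Fin n)) c → ⟦ fromList R ⊆ᵇ c ⟧ ≡ inc R c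
⊆ᵇ-inc [] c = cong ⟦_⟧ (⊥⊆ᵇ c)
⊆ᵇ-inc (i ∷ R) c = trans (⊆ᵇ-insert (fromList R) c i) (cong (⟦ lookup c i ⟧ *ᶻ_) (⊆ᵇ-inc R c))

firstPoints : ∀ {n} t → t ≤ n → Σ (List (Fin n)) λ R → length R ≡ t × Unique R
firstPoints zero _ = [] , refl , []
firstPoints (suc t) (s≤s le) with firstPoints t le
... | R , e , u = Fin.zero ∷ map Fin.suc R , cong suc (trans (length-map suc R) e) , zero≢map-suc R ∷ unique-map-suc u

⟦∧⟧ : ∀ a b c → ⟦ a ∧ (b ∧ c) ⟧ ≡ ⟦ a ⟧ *ᶻ (⟦ b ⟧ *ᶻ (1ℤ *ᶻ ⟦ c ⟧))
⟦∧⟧ true true true = refl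
⟦∧⟧ true true false = refl
⟦∧⟧ true false c = refl
⟦∧⟧ false b c = sym (ℤ.*-zeroˡ (⟦ b ⟧ *ᶻ (1ℤ *ᶻ ⟦ c ⟧)))

unique-insert : ∀ {A : Set} (xs : List A) r ys → All (r ≢_) (xs ++ ys) → Unique (xs ++ ys) → Unique (xs ++ r ∷ ys)
unique-insert [] r ys r≢ u = r≢ ∷ u
unique-insert (x ∷ xs) r ys (r≢x ∷ r≢) (x≢ ∷ u) =
  ++⁺ (++⁻ˡ xs x≢) ((λ e → r≢x (sym e)) ∷ ++⁻ʳ xs x≢) ∷ unique-insert xs r ys r≢ u

δ-subst : ∀ x w (g : ℕ → ℤ) → δ x w *ᶻ g x ≡ δ x w *ᶻ g w
δ-subst x w g with x ℕ.≟ w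
... | yes refl = refl
... | no ne rewrite δ-≢ x w ne = trans (ℤ.*-zeroˡ (g x)) (sym (ℤ.*-zeroˡ (g w)))

*ᶻ-distribˡ-- : ∀ a b c → a *ᶻ (b -ᶻ c) ≡ a *ᶻ b -ᶻ a *ᶻ c
*ᶻ-distribˡ-- = solve-∀

module Designs {n} (C : Code n) (lin : IsLinear C) (sd : IsSelfDual C) where
  open SelfDual C lin sd
  open Incidence C lin sd

  blocks-H : ∀ w R → + blocksThrough C w (fromList R) ≡ H (λ x → δ x w) [] R
  blocks-H w R = trans (count-words n _) (ΣW-cong (λ c → trans (⟦∧⟧ (C c) (∣ c ∣ ==ℕ w) (fromList R ⊆ᵇ c))
    (cong (λ t → ⟦ C c ⟧ *ᶻ (δ ∣ c ∣ w *ᶻ (1ℤ *ᶻ t))) (⊆ᵇ-inc R c))))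

  size : ℕ → ℤ
  size w = ΣC (λ c → δ ∣ c ∣ w)

  size≡ : ∀ w → size w ≡ + blocksThrough C w ⊥
  size≡ w = trans (ΣC-cong (λ c _ → l (δ ∣ c ∣ w))) (sym (blocks-H w []))
    where
    l : ∀ a → a ≡ a *ᶻ (1ℤ *ᶻ 1ℤ)
    l = solve-∀

  Const : ℕ → ℕ → Set
  Const w t = ∀ R R′ → length R ≡ t → length R′ ≡ t → Unique R → Unique R′ →
    H (λ x → δ x w) [] R ≡ H (λ x → δ x w) [] R′

  design⇒Const : ∀ {w t} → IsDesignD C w t → Const w t
  design⇒Const {w} (_ , lam , h) R R′ e e′ u u′ = trans (sym (blocks-H w R)) (trans (cong +_ (trans
    (h (fromList R) (trans (fromList-size R u) e)) (sym (h (fromList R′) (trans (fromList-size R′ u′) e′))))) (blocks-H w R′))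

  Const⇒design : ∀ {w t} → t ≤ w → t ≤ n → Const w t → IsDesignD C w t
  Const⇒design {w} {t} t≤w t≤n h with firstPoints {n} t t≤n
  ... | R₀ , e₀ , u₀ = t≤w , blocksThrough C w (fromList R₀) , λ T e → ℤ.+-injective
    (trans (cong (λ S → + blocksThrough C w S) (sym (fromList-elems T))) (trans (blocks-H w (elems T))
      (trans (h (elems T) R₀ (trans (elems-length T) e) e₀ (elems-unique T) u₀) (sym (blocks-H w R₀)))))

  H-δ : ∀ w (g : ℕ → ℤ) P R → H (λ x → δ x w *ᶻ g x) P R ≡ g w *ᶻ H (λ x → δ x w) P R
  H-δ w g P R = trans (ΣC-cong (λ c _ → trans (cong (_*ᶻ (specht P c *ᶻ inc R c)) (δ-subst ∣ c ∣ w g)) (l (δ ∣ c ∣ w) (g w) _)))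
    (ΣC-*ˡ (g w) (λ c → δ ∣ c ∣ w *ᶻ (specht P c *ᶻ inc R c)))
    where
    l : ∀ a b c → a *ᶻ b *ᶻ c ≡ b *ᶻ (a *ᶻ c)
    l = solve-∀

  -- The classical relation λ_t (w-t) = λ_(t+1) (n-t), where w - t can be cancelled.
  Const-down : ∀ {w t} → t < w → t < n → Const w (suc t) → Const w t
  Const-down {w} {t} t<w t<n h R R′ e e′ u u′ = ℤ.i-j≡0⇒i≡j _ _ (cancelˡ (+ w -ᶻ + t) w≢t
    (trans (*ᶻ-distribˡ-- (+ w -ᶻ + t) (H (λ x → δ x w) [] R) (H (λ x → δ x w) [] R′))
    (trans (cong₂ _-ᶻ_ (sym (val R e u)) (sym (val R′ e′ u′))) (ℤ.+-inverseʳ ((+ n -ᶻ (0ℤ +ᶻ + t)) *ᶻ x)))))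
    where
    w≢t : + w -ᶻ + t ≢ 0ℤ
    w≢t e = ℕ.<⇒≢ t<w (sym (ℤ.+-injective (ℤ.i-j≡0⇒i≡j (+ w) (+ t) e)))
    S = firstPoints {n} (suc t) t<n
    x = H (λ y → δ y w) [] (proj₁ S)
    l : ∀ w t → w -ᶻ (0ℤ +ᶻ t) ≡ w -ᶻ t
    l = solve-∀
    val : ∀ R → length R ≡ t → Unique R → (+ n -ᶻ (0ℤ +ᶻ + t)) *ᶻ x ≡ (+ w -ᶻ + t) *ᶻ H (λ y → δ y w) [] R
    val R refl u = trans (H-partition (λ y → δ y w) [] R x u
      (λ i ne → h (i ∷ R) (proj₁ S) refl (proj₁ (proj₂ S)) (ne ∷ u) (proj₂ (proj₂ S))))
      (trans (H-δ w (λ y → + y -ᶻ (0ℤ +ᶻ + length R)) [] R) (cong (_*ᶻ H (λ y → δ y w) [] R) (l (+ w) (+ length R))))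

  Const-below : ∀ {w} d {t} → d + t ≤ w → d + t ≤ n → Const w (d + t) → Const w t
  Const-below zero _ _ h = h
  Const-below (suc d) le le′ h = Const-below d (ℕ.<⇒≤ le) (ℕ.<⇒≤ le′) (Const-down le le′ h)

  -- Each pair is split into the difference of its two points until one pair is left; this last
  -- difference is between two equal block numbers.
  Const⇒H : ∀ {w t} → Const w t → ∀ (P : Pairs n) R → 1 ≤ length P → length P + length R ≡ t → Unique (points P ++ R) →
    H (λ x → δ x w) P R ≡ 0ℤ
  Const⇒H {w} h ((a , b) ∷ []) R _ e ((a≢b ∷ a≢) ∷ b≢ ∷ u) = trans (H-swap (λ x → δ x w) [] R a b)
    (trans (cong (_-ᶻ H (λ x → δ x w) [] (b ∷ R)) (h (a ∷ R) (b ∷ R) e e (a≢ ∷ u) (b≢ ∷ u)))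
      (ℤ.+-inverseʳ (H (λ x → δ x w) [] (b ∷ R))))
  Const⇒H {w} h ((a , b) ∷ p ∷ P) R _ e ((a≢b ∷ a≢) ∷ b≢ ∷ u) = trans (H-swap (λ x → δ x w) (p ∷ P) R a b)
    (cong₂ _-ᶻ_ (Const⇒H h (p ∷ P) (a ∷ R) (s≤s z≤n) (trans (ℕ.+-suc (length (p ∷ P)) (length R)) e)
      (unique-insert (points (p ∷ P)) a R a≢ u))
      (Const⇒H h (p ∷ P) (b ∷ R) (s≤s z≤n) (trans (ℕ.+-suc (length (p ∷ P)) (length R)) e)
        (unique-insert (points (p ∷ P)) b R b≢ u)))

  Const⇒Killed : ∀ {w t} → 1 ≤ t → Const w t → Killed (λ x → δ x w) t
  Const⇒Killed {w} {t} t≥1 h P u e = trans (ΣC-cong (λ c _ → cong (δ ∣ c ∣ w *ᶻ_) (sym (ℤ.*-identityʳ (specht P c)))))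
    (Const⇒H h P [] (subst (1 ≤_) (sym e) t≥1) (trans (ℕ.+-identityʳ (length P)) e)
      (subst Unique (sym (++-identityʳ (points P))) u))

  Killed-scale : ∀ {w k} (g : ℕ → ℤ) → Killed (λ x → δ x w) k → Killed (λ x → δ x w *ᶻ g x) k
  Killed-scale {w} g K P u e = trans (ΣC-cong
    (λ c _ → trans (cong (_*ᶻ specht P c) (δ-subst ∣ c ∣ w g)) (l (δ ∣ c ∣ w) (g w) (specht P c))))
    (trans (ΣC-*ˡ (g w) (λ c → δ ∣ c ∣ w *ᶻ specht P c)) (trans (cong (g w *ᶻ_) (K P u e)) (ℤ.*-zeroʳ (g w))))
    where
    l : ∀ a b c → a *ᶻ b *ᶻ c ≡ b *ᶻ (a *ᶻ c)
    l = solve-∀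

  Killed⇒value : ∀ {w} t → 2 * t ≤ n → (∀ i → 1 ≤ i → i ≤ t → Killed (λ x → δ x w) i) →
    ∀ R → length R ≡ t → Unique R → ff (+ n) t *ᶻ H (λ x → δ x w) [] R ≡ size w *ᶻ ff (+ w) t
  Killed⇒value {w} t le K R e u = trans (H-value t (λ x → δ x w) le
    (λ i i≥1 i≤t → Killed-scale (λ x → ff (+ x -ᶻ + i) (t ∸ i)) (K i i≥1 i≤t)) R e u)
    (trans (ΣC-cong (λ c _ → trans (δ-subst ∣ c ∣ w (λ x → ff (+ x) t)) (ℤ.*-comm (δ ∣ c ∣ w) (ff (+ w) t))))
      (trans (ΣC-*ˡ (ff (+ w) t) _) (ℤ.*-comm (ff (+ w) t) (size w))))

  ff-nonzero : ∀ k t → t ≤ k → ff (+ k) t ≢ 0ℤ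
  ff-nonzero k zero _ ()
  ff-nonzero (suc k) (suc t) (s≤s le) e = ff-nonzero k t le
    (cancelˡ (+ suc k) (λ ()) (trans (cong (λ s → + suc k *ᶻ ff s t) (sym (l k))) e))
    where
    l : ∀ k → + suc k -ᶻ 1ℤ ≡ + k
    l k = refl

  Killed⇒Const : ∀ {w} t → 2 * t ≤ n → (∀ i → 1 ≤ i → i ≤ t → Killed (λ x → δ x w) i) → Const w t
  Killed⇒Const {w} t le K R R′ e e′ u u′ = ℤ.i-j≡0⇒i≡j _ _ (cancelˡ (ff (+ n) t) (ff-nonzero n t (ℕ.≤-trans (ℕ.m≤n*m t 2) le))
    (trans (*ᶻ-distribˡ-- (ff (+ n) t) (H (λ x → δ x w) [] R) (H (λ x → δ x w) [] R′))
      (trans (cong₂ _-ᶻ_ (Killed⇒value t le K R e u) (Killed⇒value t le K R′ e′ u′))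
      (ℤ.+-inverseʳ (size w *ᶻ ff (+ w) t)))))

-- Residues

θ : Ser → Ser
θ f k = + k *ᶻ f k

θ-cong : ∀ {f g} → f ≈ g → θ f ≈ θ g
θ-cong p k = cong (+ k *ᶻ_) (p k)

θ-* : ∀ f g → θ (f *ˢ g) ≈ θ f *ˢ g +ˢ f *ˢ θ g
θ-* f g zero = l (f 0) (g 0)
  where
  l : ∀ a b → 0ℤ *ᶻ (a *ᶻ b) ≡ 0ℤ *ᶻ a *ᶻ b +ᶻ a *ᶻ (0ℤ *ᶻ b)
  l = solve-∀
θ-* f g (suc k) = begin
  + suc k *ᶻ (f 0 *ᶻ g (suc k) +ᶻ (tail f *ˢ g) k)
    ≡⟨ cong (_*ᶻ (f 0 *ᶻ g (suc k) +ᶻ (tail f *ˢ g) k)) (ℤ.pos-+ 1 k) ⟩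
  (1ℤ +ᶻ + k) *ᶻ (f 0 *ᶻ g (suc k) +ᶻ (tail f *ˢ g) k)
    ≡⟨ l₁ (+ k) (f 0) (g (suc k)) ((tail f *ˢ g) k) ⟩
  f 0 *ᶻ ((1ℤ +ᶻ + k) *ᶻ g (suc k)) +ᶻ ((tail f *ˢ g) k +ᶻ θ (tail f *ˢ g) k)
    ≡⟨ cong₂ (λ s t → f 0 *ᶻ (s *ᶻ g (suc k)) +ᶻ ((tail f *ˢ g) k +ᶻ t)) (sym (ℤ.pos-+ 1 k)) (θ-* (tail f) g k) ⟩
  f 0 *ᶻ θ g (suc k) +ᶻ ((tail f *ˢ g) k +ᶻ ((θ (tail f) *ˢ g) k +ᶻ (tail f *ˢ θ g) k))
    ≡⟨ l₂ (f 0 *ᶻ θ g (suc k)) ((tail f *ˢ g) k) ((θ (tail f) *ˢ g) k) ((tail f *ˢ θ g) k) (f 0) (g (suc k)) ⟩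
  (0ℤ *ᶻ f 0 *ᶻ g (suc k) +ᶻ ((tail f *ˢ g) k +ᶻ (θ (tail f) *ˢ g) k)) +ᶻ (f 0 *ᶻ θ g (suc k) +ᶻ (tail f *ˢ θ g) k)
    ≡⟨ cong (λ t → (0ℤ *ᶻ f 0 *ᶻ g (suc k) +ᶻ t) +ᶻ (f 0 *ᶻ θ g (suc k) +ᶻ (tail f *ˢ θ g) k))
         (trans (sym (*ˢ-distribʳ g (tail f) (θ (tail f)) k)) (*ˢ-cong {g = g} (symˢ tail-θ) reflˢ k)) ⟩
  (θ f *ˢ g +ˢ f *ˢ θ g) (suc k) ∎
  where
  open ≡-Reasoning
  tail-θ : tail (θ f) ≈ tail f +ˢ θ (tail f)
  tail-θ j = trans (cong (_*ᶻ f (suc j)) (ℤ.pos-+ 1 j)) (l (+ j) (f (suc j)))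
    where
    l : ∀ a b → (1ℤ +ᶻ a) *ᶻ b ≡ b +ᶻ a *ᶻ b
    l = solve-∀
  l₁ : ∀ k a b x → (1ℤ +ᶻ k) *ᶻ (a *ᶻ b +ᶻ x) ≡ a *ᶻ ((1ℤ +ᶻ k) *ᶻ b) +ᶻ (x +ᶻ k *ᶻ x)
  l₁ = solve-∀
  l₂ : ∀ a b c d p q → a +ᶻ (b +ᶻ (c +ᶻ d)) ≡ (0ℤ *ᶻ p *ᶻ q +ᶻ (b +ᶻ c)) +ᶻ (a +ᶻ d)
  l₂ = solve-∀

θ1ˢ : θ 1ˢ ≈ 0ˢ
θ1ˢ zero = refl
θ1ˢ (suc k) = ℤ.*-zeroʳ (+ suc k)

θ-^ : ∀ f k → θ (f ^ˢ suc k) ≈ κ (+ suc k) *ˢ (f ^ˢ k *ˢ θ f)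
θ-^ f zero = θ-* f 1ˢ ⟫ ≈.+-cong {θ f *ˢ 1ˢ} reflˢ (*ˢ-cong {f} reflˢ θ1ˢ ⟫ ≈.zeroʳ f) ⟫ ≈.+-identityʳ _
  ⟫ solve 1 (λ t → t :* con 1ℤ := con 1ℤ :* (con 1ℤ :* t)) reflˢ (θ f)
θ-^ f (suc k) = θ-* f (f ^ˢ suc k) ⟫ ≈.+-cong {θ f *ˢ f ^ˢ suc k} reflˢ (*ˢ-cong {f} reflˢ (θ-^ f k))
  ⟫ solve 4 (λ t f p c → t :* (f :* p) :+ f :* (c :* (p :* t)) := (con 1ℤ :+ c) :* (f :* p :* t)) reflˢ (θ f) f
    (f ^ˢ k) (κ (+ suc k))
  ⟫ *ˢ-cong {κ 1ℤ +ˢ κ (+ suc k)} {κ (+ suc (suc k))} {f *ˢ f ^ˢ k *ˢ θ f}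
    (λ { zero → sym (ℤ.pos-+ 1 (suc k)) ; (suc _) → refl }) reflˢ

-- Pˢ = (1+X)(1-34X+X²) is the numerator of the logarithmic derivative of Δ/F³, see θu.
N N⁴ F³ Δ Pˢ : Ser
N _ = 1ℤ
N⁴ = N *ˢ N *ˢ N *ˢ N
F³ = F *ˢ F *ˢ F
Δ = X *ˢ (1-X *ˢ 1-X *ˢ 1-X *ˢ 1-X)
Pˢ = 1ˢ +ˢ κ -[1+ 32 ] *ˢ X +ˢ κ -[1+ 32 ] *ˢ (X *ˢ X) +ˢ X *ˢ (X *ˢ X)

N-inverse : 1-X *ˢ N ≈ 1ˢ
N-inverse k = trans (solve 2 (λ x n → (con 1ℤ :+ :- x) :* n := n :+ :- (x :* n)) reflˢ X N k) (lem k)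
  where
  lem : ∀ k → (N +ˢ -ˢ (X *ˢ N)) k ≡ 1ˢ k
  lem zero = cong (λ t → 1ℤ +ᶻ -ᶻ t) (X*-zero N)
  lem (suc k) = cong (λ t → 1ℤ +ᶻ -ᶻ t) (X*-suc N k)

θ1-X : θ 1-X ≈ -ˢ X
θ1-X zero = refl
θ1-X (suc zero) = refl
θ1-X (suc (suc k)) = ℤ.*-zeroʳ (+ suc (suc k))

θF : θ F ≈ κ (+ 14) *ˢ X +ˢ κ (+ 2) *ˢ (X *ˢ X)
θF zero = refl
θF (suc zero) = refl
θF (suc (suc zero)) = refl
θF (suc (suc (suc k))) = trans (cong (+ (3 + k) *ᶻ_) (trans (F-simple (3 + k)) (v k))) (trans (ℤ.*-zeroʳ (+ (3 + k))) (sym (w k)))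
  where
  F-simple : F ≈ 1ˢ +ˢ X *ˢ (κ (+ 14) +ˢ X)
  F-simple = solve 1 (λ x → con 1ℤ :+ con (+ 14) :* x :+ x :* x := con 1ℤ :+ x :* (con (+ 14) :+ x)) reflˢ X
  v : ∀ k → (1ˢ +ˢ X *ˢ (κ (+ 14) +ˢ X)) (3 + k) ≡ 0ℤ
  v k = trans (cong (0ℤ +ᶻ_) (X*-suc (κ (+ 14) +ˢ X) (2 + k))) refl
  w : ∀ k → (κ (+ 14) *ˢ X +ˢ κ (+ 2) *ˢ (X *ˢ X)) (3 + k) ≡ 0ℤ
  w k = cong₂ _+ᶻ_ (trans (κ-*ˢ (+ 14) X (3 + k)) refl) (trans (κ-*ˢ (+ 2) (X *ˢ X) (3 + k)) (cong (+ 2 *ᶻ_) (X*-suc X (2 + k))))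

θN : θ N ≈ X *ˢ (N *ˢ N)
θN = symˢ (step ⟫ *ˢ-identityˡ (θ N))
  where
  rel : -ˢ X *ˢ N +ˢ 1-X *ˢ θ N ≈ 0ˢ
  rel = ≈.+-cong {y = θ 1-X *ˢ N} {v = 1-X *ˢ θ N} (*ˢ-cong {g = N} (symˢ θ1-X) reflˢ) reflˢ ⟫ symˢ (θ-* 1-X N) ⟫
    θ-cong N-inverse ⟫ θ1ˢ
  step : X *ˢ (N *ˢ N) ≈ 1ˢ *ˢ θ N
  step = solve 4 (λ x n q t → x :* (n :* n) := q :* n :* t :+ :- (n :* (:- x :* n :+ q :* t))) reflˢ X N 1-X (θ N)
    ⟫ ≈.+-cong (*ˢ-cong {g = θ N} N-inverse reflˢ) (≈.-‿cong (*ˢ-cong {N} reflˢ rel ⟫ ≈.zeroʳ N)) ⟫ ≈.+-identityʳ (1ˢ *ˢ θ N)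

-- X F³/Δ: the Laurent series F³/Δ times X, so that residues of its powers become ordinary
-- coefficients.
u : Ser
u = F³ *ˢ N⁴

N⁵ : Ser
N⁵ = N *ˢ N⁴

θu : θ u +ˢ -ˢ u ≈ -ˢ (F *ˢ F *ˢ (Pˢ *ˢ N⁵))
θu = ≈.+-cong {v = -ˢ u} (θ-* F³ N⁴ ⟫ ≈.+-cong (*ˢ-cong {g = N⁴} dF reflˢ) (*ˢ-cong {F³} reflˢ dN)) reflˢ
  ⟫ solve 4 (λ F N t s → con (+ 3) :* (F :* F :* t) :* (N :* N :* N :* N) :+ F :* F :* F :*
    (con (+ 4) :* (N :* N :* N :* s)) :+ :- (F :* F :* F :* (N :* N :* N :* N))
      := F :* F :* (N :* N :* N) :* ((con (+ 3) :* t :+ :- F) :* N :+ con (+ 4) :* (F :* s))) reflˢ F N (θ F) (θ N)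
  ⟫ *ˢ-cong {F *ˢ F *ˢ (N *ˢ N *ˢ N)} reflˢ inner
  ⟫ solve 3 (λ F N P → F :* F :* (N :* N :* N) :* :- (P :* (N :* N)) := :-
    (F :* F :* (P :* (N :* (N :* N :* N :* N))))) reflˢ F N Pˢ
  where
  dF : θ F³ ≈ κ (+ 3) *ˢ (F *ˢ F *ˢ θ F)
  dF = θ-* (F *ˢ F) F ⟫ ≈.+-cong {v = F *ˢ F *ˢ θ F} (*ˢ-cong {g = F} (θ-* F F) reflˢ) reflˢ
    ⟫ solve 2 (λ F t → (t :* F :+ F :* t) :* F :+ F :* F :* t := con (+ 3) :* (F :* F :* t)) reflˢ F (θ F)
  dN : θ N⁴ ≈ κ (+ 4) *ˢ (N *ˢ N *ˢ N *ˢ θ N)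
  dN = θ-* (N *ˢ N *ˢ N) N ⟫ ≈.+-cong {v = N *ˢ N *ˢ N *ˢ θ N}
    (*ˢ-cong {g = N} (θ-* (N *ˢ N) N ⟫ ≈.+-cong {v = N *ˢ N *ˢ θ N} (*ˢ-cong {g = N} (θ-* N N) reflˢ) reflˢ) reflˢ)
    reflˢ
    ⟫ solve 2 (λ F t → ((t :* F :+ F :* t) :* F :+ F :* F :* t) :* F :+ F :* F :* F :* t := con (+ 4) :*
      (F :* F :* F :* t)) reflˢ N (θ N)
  inner : (κ (+ 3) *ˢ θ F +ˢ -ˢ F) *ˢ N +ˢ κ (+ 4) *ˢ (F *ˢ θ N) ≈ -ˢ (Pˢ *ˢ (N *ˢ N))
  inner = ≈.+-cong (*ˢ-cong {f′ = κ (+ 3) *ˢ (κ (+ 14) *ˢ X +ˢ κ (+ 2) *ˢ (X *ˢ X)) +ˢ -ˢ F} {g′ = N *ˢ (1-X *ˢ N)}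
        (≈.+-cong (*ˢ-cong {κ (+ 3)} reflˢ θF) (reflˢ { -ˢ F})) (symˢ (*ˢ-cong {N} reflˢ N-inverse ⟫ ≈.*-identityʳ N)))
      (*ˢ-cong {κ (+ 4)} reflˢ (*ˢ-cong {F} reflˢ θN))
    ⟫ solve 2 (λ x n → let F = con 1ℤ :+ con (+ 14) :* x :+ x :* x in
        (con (+ 3) :* (con (+ 14) :* x :+ con (+ 2) :* (x :* x)) :+ :- F) :* (n :* ((con 1ℤ :+ :- x) :* n)) :+ con
          (+ 4) :* (F :* (x :* (n :* n)))
        := :- ((con 1ℤ :+ con -[1+ 32 ] :* x :+ con -[1+ 32 ] :* (x :* x) :+ x :* (x :* x)) :* (n :* n))) reflˢ X N

-- The coefficient is the residue of d(u/X)^(k+1), up to the factor k+1.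
residue : ∀ k → (u ^ˢ k *ˢ (F *ˢ F *ˢ (Pˢ *ˢ N⁵))) (suc k) ≡ 0ℤ
residue k = suc-cancel k _ eq
  where
  R = F *ˢ F *ˢ (Pˢ *ˢ N⁵)
  rel : θ (u ^ˢ suc k) +ˢ -ˢ (κ (+ suc k) *ˢ u ^ˢ suc k) ≈ -ˢ (κ (+ suc k) *ˢ (u ^ˢ k *ˢ R))
  rel = ≈.+-cong {v = -ˢ (κ (+ suc k) *ˢ u ^ˢ suc k)} (θ-^ u k) reflˢ
    ⟫ solve 4 (λ c p t u → c :* (p :* t) :+ :- (c :* (u :* p)) := c :* (p :* (t :+ :- u))) reflˢ (κ (+ suc k)) (u ^ˢ k) (θ u) u
    ⟫ *ˢ-cong {κ (+ suc k)} reflˢ (*ˢ-cong {u ^ˢ k} reflˢ θu)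
    ⟫ solve 3 (λ c p r → c :* (p :* :- r) := :- (c :* (p :* r))) reflˢ (κ (+ suc k)) (u ^ˢ k) R
  eq : + suc k *ᶻ (u ^ˢ k *ˢ R) (suc k) ≡ 0ℤ
  eq = trans (sym (κ-*ˢ (+ suc k) (u ^ˢ k *ˢ R) (suc k))) (ℤ.neg-injective (trans (sym (rel (suc k)))
    (trans (cong (λ t → + suc k *ᶻ (u ^ˢ suc k) (suc k) +ᶻ -ᶻ t) (κ-*ˢ (+ suc k) (u ^ˢ suc k) (suc k)))
      (ℤ.+-inverseʳ (+ suc k *ᶻ (u ^ˢ suc k) (suc k))))))

-- Gleason's basis: the products Δ^j F^(3k+r) are invariants for length 24(j+k) + 8r.
basis : ℕ → ℕ → ℕ → Ser
basis j k r = Δ ^ˢ j *ˢ (F³ ^ˢ k *ˢ F ^ˢ r)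

-- Chosen so that, for r + r′ = 2 and j + k = m, the product with `basis j k r` is X^j u^k F² Pˢ N⁵.
-- Its coefficient at m + 1 is a residue of an exact differential, so one linear functional
-- annihilates the whole basis.
kernel : ℕ → ℕ → Ser
kernel r′ m = F ^ˢ r′ *ˢ (Pˢ *ˢ N⁵) *ˢ N⁴ ^ˢ m

ΔN⁴ : Δ *ˢ N⁴ ≈ X
ΔN⁴ = solve 3 (λ x q n → x :* (q :* q :* q :* q) :* (n :* n :* n :* n) := x :*
  ((q :* n) :* (q :* n) :* (q :* n) :* (q :* n))) reflˢ X 1-X N
  ⟫ *ˢ-cong {X} reflˢ (*ˢ-cong {g′ = 1ˢ} (*ˢ-cong {g′ = 1ˢ} (*ˢ-cong N-inverse N-inverse) N-inverse) N-inverse)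
  ⟫ solve 1 (λ x → x :* (con 1ℤ :* con 1ℤ :* con 1ℤ :* con 1ℤ) := x) reflˢ X

basis-kernel : ∀ j k r r′ → r + r′ ≡ 2 → basis j k r *ˢ kernel r′ (j + k) ≈ X ^ˢ j *ˢ (u ^ˢ k *ˢ (F *ˢ F *ˢ (Pˢ *ˢ N⁵)))
basis-kernel j k r r′ e = *ˢ-cong {basis j k r} reflˢ (*ˢ-cong {F ^ˢ r′ *ˢ (Pˢ *ˢ N⁵)} reflˢ (^ˢ-+ N⁴ j k))
  ⟫ solve 7 (λ d f a b p nj nk → d :* (f :* a) :* (b :* p :* (nj :* nk)) := d :* nj :* (f :* nk :* (a :* b :* p)))
      reflˢ (Δ ^ˢ j) (F³ ^ˢ k) (F ^ˢ r) (F ^ˢ r′) (Pˢ *ˢ N⁵) (N⁴ ^ˢ j) (N⁴ ^ˢ k)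
  ⟫ *ˢ-cong (symˢ (^ˢ-distrib Δ N⁴ j) ⟫ ^ˢ-cong ΔN⁴ j) (*ˢ-cong (symˢ (^ˢ-distrib F³ N⁴ k))
      (*ˢ-cong {g = Pˢ *ˢ N⁵} (symˢ (^ˢ-+ F r r′) ⟫ (λ i → cong (λ s → (F ^ˢ s) i) e) ⟫ *ˢ-cong {F} reflˢ
        (≈.*-identityʳ F)) reflˢ))

basis-kernel-suc : ∀ j k r r′ → r + r′ ≡ 2
  → basis j k r *ˢ (F³ *ˢ kernel r′ (suc (j + k))) ≈ X ^ˢ j *ˢ (u ^ˢ suc k *ˢ (F *ˢ F *ˢ (Pˢ *ˢ N⁵)))
basis-kernel-suc j k r r′ e = solve 5 (λ b f a c n → b :* (f :* (a :* (n :* c))) := f :* n :* (b :* (a :* c))) reflˢ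
  (basis j k r) F³ (F ^ˢ r′ *ˢ (Pˢ *ˢ N⁵)) (N⁴ ^ˢ (j + k)) N⁴
  ⟫ *ˢ-cong {u} reflˢ (basis-kernel j k r r′ e)
  ⟫ solve 4 (λ u x p r → u :* (x :* (p :* r)) := x :* (u :* p :* r)) reflˢ u (X ^ˢ j) (u ^ˢ k) (F *ˢ F *ˢ (Pˢ *ˢ N⁵))

basis-residue : ∀ j k r r′ → r + r′ ≡ 2 → (basis j k r *ˢ kernel r′ (j + k)) (suc (j + k)) ≡ 0ℤ
basis-residue j k r r′ e = trans (basis-kernel j k r r′ e (suc (j + k)))
  (trans (cong (X ^ˢ j *ˢ (u ^ˢ k *ˢ (F *ˢ F *ˢ (Pˢ *ˢ N⁵)))) (sym (ℕ.+-suc j k))) (trans (X^-+ j _ (suc k)) (residue k)))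

-- With a further factor F³ the exponent of u rises by one and the vanishing coefficient moves to m
-- + 2; this second functional determines A_(d+4) once A_d is known.
basis-residue-suc : ∀ j k r r′ → r + r′ ≡ 2 → (basis j k r *ˢ (F³ *ˢ kernel r′ (suc (j + k)))) (suc (suc (j + k))) ≡ 0ℤ
basis-residue-suc j k r r′ e = trans (basis-kernel-suc j k r r′ e (suc (suc (j + k))))
  (trans (cong (X ^ˢ j *ˢ (u ^ˢ suc k *ˢ (F *ˢ F *ˢ (Pˢ *ˢ N⁵)))) (sym (trans (ℕ.+-suc j (suc k)) (cong suc (ℕ.+-suc j k)))))
    (trans (X^-+ j _ (suc (suc k))) (residue (suc k))))

-- The substitution of X⁴ for X, and invariants of MacWilliams' transform

ψ : Ser → Ser
ψ f 0 = f 0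
ψ f 1 = 0ℤ
ψ f 2 = 0ℤ
ψ f 3 = 0ℤ
ψ f (suc (suc (suc (suc k)))) = ψ (tail f) k

ψ-cong : ∀ {f g} → f ≈ g → ψ f ≈ ψ g
ψ-cong p 0 = p 0
ψ-cong p 1 = refl
ψ-cong p 2 = refl
ψ-cong p 3 = refl
ψ-cong p (suc (suc (suc (suc k)))) = ψ-cong (p ∘ suc) k

ψ-+ : ∀ f g → ψ (f +ˢ g) ≈ ψ f +ˢ ψ g
ψ-+ f g 0 = refl
ψ-+ f g 1 = refl
ψ-+ f g 2 = refl
ψ-+ f g 3 = refl
ψ-+ f g (suc (suc (suc (suc k)))) = ψ-+ (tail f) (tail g) k

ψ-scale : ∀ a f → ψ (λ i → a *ᶻ f i) ≈ κ a *ˢ ψ f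
ψ-scale a f k = trans (go f k) (sym (κ-*ˢ a (ψ f) k))
  where
  go : ∀ f k → ψ (λ i → a *ᶻ f i) k ≡ a *ᶻ ψ f k
  go f 0 = refl
  go f 1 = sym (ℤ.*-zeroʳ a)
  go f 2 = sym (ℤ.*-zeroʳ a)
  go f 3 = sym (ℤ.*-zeroʳ a)
  go f (suc (suc (suc (suc k)))) = go (tail f) k

ψ-κ* : ∀ a f → ψ (κ a *ˢ f) ≈ κ a *ˢ ψ f
ψ-κ* a f = ψ-cong (κ-*ˢ a f) ⟫ ψ-scale a f

ψ-tail : ∀ f → ψ f ≈ κ (f 0) +ˢ X⁴ *ˢ ψ (tail f)
ψ-tail f 0 = sym (trans (cong (f 0 +ᶻ_) (X⁴*-low (ψ (tail f)) 0 (s≤s z≤n))) (ℤ.+-identityʳ (f 0)))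
ψ-tail f 1 = sym (trans (ℤ.+-identityˡ _) (X⁴*-low (ψ (tail f)) 1 (s≤s (s≤s z≤n))))
ψ-tail f 2 = sym (trans (ℤ.+-identityˡ _) (X⁴*-low (ψ (tail f)) 2 (s≤s (s≤s (s≤s z≤n)))))
ψ-tail f 3 = sym (trans (ℤ.+-identityˡ _) (X⁴*-low (ψ (tail f)) 3 (s≤s (s≤s (s≤s (s≤s z≤n))))))
ψ-tail f (suc (suc (suc (suc k)))) = sym (trans (ℤ.+-identityˡ _) (X⁴*-+4 (ψ (tail f)) k))

κ0 : κ 0ℤ ≈ 0ˢ
κ0 zero = refl
κ0 (suc k) = refl

ψ-X : ∀ f → ψ (X *ˢ f) ≈ X⁴ *ˢ ψ f
ψ-X f = ψ-tail (X *ˢ f) ⟫ ≈.+-cong ((λ k → cong (λ a → κ a k) (X*-zero f)) ⟫ κ0) (*ˢ-cong {X⁴} reflˢ (ψ-cong (X*-suc f)))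
  ⟫ ≈.+-identityˡ _

ψ-1-X : ∀ f → ψ (1-X *ˢ f) ≈ 1-X⁴ *ˢ ψ f
ψ-1-X f = ψ-cong (solve 2 (λ x f → (con 1ℤ :+ :- x) :* f := f :+ con -1ℤ :* (x :* f)) reflˢ X f)
  ⟫ ψ-+ f (κ -1ℤ *ˢ (X *ˢ f)) ⟫ ≈.+-cong {ψ f} reflˢ (ψ-κ* -1ℤ (X *ˢ f) ⟫ *ˢ-cong {κ -1ℤ} reflˢ (ψ-X f))
  ⟫ solve 2 (λ w f → f :+ con -1ℤ :* (w :* f) := (con 1ℤ :+ :- w) :* f) reflˢ X⁴ (ψ f)

F-expand : ∀ f → F *ˢ f ≈ f +ˢ κ (+ 14) *ˢ (X *ˢ f) +ˢ X *ˢ (X *ˢ f)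
F-expand = solve 2 (λ x f → (con 1ℤ :+ con (+ 14) :* x :+ x :* x) :* f := f :+ con (+ 14) :* (x :* f) :+ x :* (x :* f)) reflˢ X

-- F(X⁴), not the fourth power of F.
F⁴ : Ser
F⁴ = 1ˢ +ˢ κ (+ 14) *ˢ X⁴ +ˢ X⁴ *ˢ X⁴

ψ-F : ∀ f → ψ (F *ˢ f) ≈ F⁴ *ˢ ψ f
ψ-F f = ψ-cong (F-expand f) ⟫ ψ-+ (f +ˢ κ (+ 14) *ˢ (X *ˢ f)) (X *ˢ (X *ˢ f))
  ⟫ ≈.+-cong (ψ-+ f (κ (+ 14) *ˢ (X *ˢ f)) ⟫ ≈.+-cong {ψ f} reflˢ (ψ-κ* (+ 14) (X *ˢ f) ⟫ *ˢ-cong {κ (+ 14)} reflˢ (ψ-X f)))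
      (ψ-X (X *ˢ f) ⟫ *ˢ-cong {X⁴} reflˢ (ψ-X f))
  ⟫ solve 2 (λ w f → f :+ con (+ 14) :* (w :* f) :+ w :* (w :* f) := (con 1ℤ :+ con (+ 14) :* w :+ w :* w) :* f) reflˢ X⁴ (ψ f)

ψ-Vanish : ∀ k f → (∀ i → i < k → f i ≡ 0ℤ) → Vanish (k * 4) (ψ f)
ψ-Vanish (suc k) f z 0 _ = z 0 (s≤s z≤n)
ψ-Vanish (suc k) f z 1 _ = refl
ψ-Vanish (suc k) f z 2 _ = refl
ψ-Vanish (suc k) f z 3 _ = refl
ψ-Vanish (suc k) f z (suc (suc (suc (suc j)))) (s≤s (s≤s (s≤s (s≤s lt))))
  = ψ-Vanish k (tail f) (λ i i<k → z (suc i) (s≤s i<k)) j lt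

Above : ℕ → Ser → Set
Above M V = ∀ i → M < i → V i ≡ 0ℤ

hform-κ* : ∀ M a V → hform M (κ a *ˢ V) ≈ κ a *ˢ hform M V
hform-κ* zero a V = (λ { zero → refl ; (suc k) → refl }) ⟫ κ-homo a (V 0)
hform-κ* (suc M) a V = ≈.+-cong (*ˢ-cong {g = A ^ˢ suc M} (κ-homo a (V 0)) reflˢ)
    (*ˢ-cong {B} reflˢ (form-cong A B M (λ i _ → trans (κ-*ˢ a V (suc i)) (sym (κ-*ˢ a (tail V) i))) ⟫ hform-κ* M a (tail V)))
  ⟫ solve 5 (λ a v p b h → a :* v :* p :+ b :* (a :* h) := a :* (v :* p :+ b :* h)) reflˢ (κ a) (κ (V 0)) (A ^ˢ suc M)
    B (hform M (tail V))

hform-≈ : ∀ M {V W} → V ≈ W → hform M V ≈ hform M W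
hform-≈ M p = form-cong A B M (λ i _ → p i)

hform-X : ∀ M V → hform (suc M) (X *ˢ V) ≈ B *ˢ hform M V
hform-X M V = ≈.+-cong (*ˢ-cong {κ ((X *ˢ V) 0)} {0ˢ} {A ^ˢ suc M} ((λ k → cong (λ a → κ a k) (X*-zero V)) ⟫ κ0) reflˢ
  ⟫ ≈.zeroˡ (A ^ˢ suc M))
  (*ˢ-cong {B} reflˢ (hform-≈ M (X*-suc V))) ⟫ ≈.+-identityˡ _

hform-A : ∀ M V → Above M V → hform (suc M) V ≈ A *ˢ hform M V
hform-A M V z = (λ k → cong (λ s → hform s V k) (ℕ.+-comm 1 M)) ⟫ hform-top 1 M V z
  ⟫ solve 2 (λ a h → a :* con 1ℤ :* h := a :* h) reflˢ A (hform M V)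

Above-suc : ∀ {M V} → Above M V → Above (suc M) V
Above-suc z i lt = z i (ℕ.<-trans (ℕ.n<1+n _) lt)

Above-X : ∀ {M V} → Above M V → Above (suc M) (X *ˢ V)
Above-X {V = V} z (suc i) (s≤s lt) = trans (X*-suc V i) (z i lt)

Above-≈ : ∀ {M V W} → V ≈ W → Above M V → Above M W
Above-≈ p z i lt = trans (sym (p i)) (z i lt)

Above-+ : ∀ {M V W} → Above M V → Above M W → Above M (V +ˢ W)
Above-+ z z′ i lt = cong₂ _+ᶻ_ (z i lt) (z′ i lt)

Above-κ : ∀ {M V} a → Above M V → Above M (κ a *ˢ V)
Above-κ {V = V} a z i lt = trans (κ-*ˢ a V i) (trans (cong (a *ᶻ_) (z i lt)) (ℤ.*-zeroʳ a))

1-X-expand : ∀ f → 1-X *ˢ f ≈ f +ˢ κ -1ℤ *ˢ (X *ˢ f)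
1-X-expand = solve 2 (λ x f → (con 1ℤ :+ :- x) :* f := f :+ con -1ℤ :* (x :* f)) reflˢ X

Above-1-X : ∀ {M V} → Above M V → Above (suc M) (1-X *ˢ V)
Above-1-X {M} {V} z = Above-≈ (symˢ (1-X-expand V)) (Above-+ (Above-suc {M} {V} z) (Above-κ -1ℤ (Above-X z)))

hform-1-X : ∀ M V → Above M V → hform (suc M) (1-X *ˢ V) ≈ X *ˢ U *ˢ hform M V
hform-1-X M V z = hform-≈ (suc M) (1-X-expand V) ⟫ hform-+ (suc M) V (κ -1ℤ *ˢ (X *ˢ V))
  ⟫ ≈.+-cong (hform-A M V z) (hform-κ* (suc M) -1ℤ (X *ˢ V) ⟫ *ˢ-cong {κ -1ℤ} reflˢ (hform-X M V))
  ⟫ solve 3 (λ a b h → a :* h :+ con -1ℤ :* (b :* h) := (a :+ :- b) :* h) reflˢ A B (hform M V)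
  ⟫ *ˢ-cong {g = hform M V} A-B reflˢ

Above-F : ∀ {M V} → Above M V → Above (suc (suc M)) (F *ˢ V)
Above-F {M} {V} z = Above-≈ (symˢ (F-expand V))
  (Above-+ (Above-+ (Above-suc {suc M} {V} (Above-suc {M} {V} z))
  (Above-κ (+ 14) (Above-suc {suc M} {X *ˢ V} (Above-X z)))) (Above-X (Above-X z)))

hform-F : ∀ M V → Above M V → hform (suc (suc M)) (F *ˢ V) ≈ κ (+ 16) *ˢ F⁴ *ˢ hform M V
hform-F M V z = hform-≈ (2 + M) (F-expand V) ⟫ hform-+ (2 + M) (V +ˢ κ (+ 14) *ˢ (X *ˢ V)) (X *ˢ (X *ˢ V))
  ⟫ ≈.+-cong (hform-+ (2 + M) V (κ (+ 14) *ˢ (X *ˢ V)) ⟫ ≈.+-cong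
    (hform-A (suc M) V (Above-suc {M} {V} z) ⟫ *ˢ-cong {A} reflˢ (hform-A M V z))
      (hform-κ* (2 + M) (+ 14) (X *ˢ V) ⟫ *ˢ-cong {κ (+ 14)} reflˢ
        (hform-A (suc M) (X *ˢ V) (Above-X z) ⟫ *ˢ-cong {A} reflˢ (hform-X M V))))
    (hform-X (suc M) (X *ˢ V) ⟫ *ˢ-cong {B} reflˢ (hform-X M V))
  ⟫ solve 2 (λ x h → let p = con (+ 1) :+ x ; q = con (+ 1) :+ :- x ; A = p :* p :* p :* p ; B = q :* q :* q :* q ; w
                           = x :* (x :* (x :* x)) in
      A :* (A :* h) :+ con (+ 14) :* (A :* (B :* h)) :+ B :* (B :* h) := con (+ 16) :*
        (con 1ℤ :+ con (+ 14) :* w :+ w :* w) :* h) reflˢ X (hform M V)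

Palindrome : ℕ → Ser → Set
Palindrome M V = ∀ i j → i + j ≡ M → V i ≡ V j

pal-XX : ∀ {M V} → Above M V → Palindrome M V → ∀ i j → i + j ≡ 2 + M → (X *ˢ (X *ˢ V)) i ≡ V j
pal-XX {M} {V} z p 0 j e = trans (X*-zero (X *ˢ V)) (sym (z j (subst (M <_) (sym e) (ℕ.m<n+m M (s≤s z≤n)))))
pal-XX {M} {V} z p 1 j e = trans (X*-suc (X *ˢ V) 0)
  (trans (X*-zero V) (sym (z j (subst (M <_) (sym (ℕ.suc-injective e)) (ℕ.n<1+n M)))))
pal-XX {M} {V} z p (suc (suc i)) j e = trans (X*-suc (X *ˢ V) (suc i))
  (trans (X*-suc V i) (p i j (ℕ.suc-injective (ℕ.suc-injective e))))

pal-X : ∀ {M V} → Above M V → Palindrome M V → Palindrome (2 + M) (X *ˢ V)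
pal-X {M} {V} z p zero zero ()
pal-X {M} {V} z p zero (suc j) e = trans (X*-zero V)
  (sym (trans (X*-suc V j) (z j (subst (M <_) (sym (ℕ.suc-injective e)) (ℕ.n<1+n M)))))
pal-X {M} {V} z p (suc i) zero e = trans (X*-suc V i)
  (trans (z i (subst (M <_) (sym (ℕ.suc-injective (trans (sym (ℕ.+-identityʳ (suc i))) e))) (ℕ.n<1+n M)))
  (sym (X*-zero V)))
pal-X {M} {V} z p (suc i) (suc j) e = trans (X*-suc V i)
  (trans (p i j (ℕ.suc-injective (ℕ.suc-injective (trans (sym (cong suc (ℕ.+-suc i j))) e)))) (sym (X*-suc V j)))

-- Used with β = 14 for F and with β = -2 for (1-X)².
pal-quadratic : ∀ {M V W} β → W ≈ V +ˢ κ β *ˢ (X *ˢ V) +ˢ X *ˢ (X *ˢ V) → Above M V → Palindrome M V → Palindrome (2 + M) W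
pal-quadratic {M} {V} {W} β eq z p i j e = trans (eq i)
  (trans (cong₂ _+ᶻ_ (cong₂ _+ᶻ_ (sym (pal-XX z p j i (trans (ℕ.+-comm j i) e)))
    (trans (κ-*ˢ β (X *ˢ V) i) (trans (cong (β *ᶻ_) (pal-X z p i j e)) (sym (κ-*ˢ β (X *ˢ V) j))))) (pal-XX z p i j e))
  (trans (l ((X *ˢ (X *ˢ V)) j) ((κ β *ˢ (X *ˢ V)) j) (V j)) (sym (eq j))))
  where
  l : ∀ a b c → a +ᶻ b +ᶻ c ≡ c +ᶻ b +ᶻ a
  l = solve-∀

four : ℕ → ℤ
four zero = 1ℤ
four (suc M) = + 4 *ᶻ four M

-- The symmetries of the weight enumerator of a doubly even self-dual code of length n = 4M; the
-- factor 4^M = 2^(n/2) is the number of its codewords.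
record Invariant (M : ℕ) (V : Ser) : Set where
  field
    above : Above M V
    pal : Palindrome M V
    transform : hform M V ≈ κ (four M) *ˢ ψ V

Invariant-≈ : ∀ {M V W} → V ≈ W → Invariant M V → Invariant M W
Invariant-≈ {M} p I = record { above = Above-≈ p above ; pal = λ i j e → trans (sym (p i)) (trans (pal i j e) (p j))
  ; transform = hform-≈ M (symˢ p) ⟫ transform ⟫ *ˢ-cong {κ (four M)} reflˢ (ψ-cong p) }
  where open Invariant I

Invariant-1 : Invariant 0 1ˢ
Invariant-1 = record { above = λ { (suc i) _ → refl } ; pal = λ { zero zero _ → refl }
  ; transform = symˢ (*ˢ-identityˡ (ψ 1ˢ) ⟫ ψ-tail 1ˢ ⟫ ≈.+-cong {κ 1ℤ} reflˢ
    (*ˢ-cong {X⁴} reflˢ (λ k → ψ-Vanish (suc k) 0ˢ (λ _ _ → refl) k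
    (ℕ.m≤n⇒m≤1+n (ℕ.m≤n⇒m≤1+n (ℕ.m≤n⇒m≤1+n (s≤s (ℕ.m≤m*n k 4)))))) ⟫ ≈.zeroʳ X⁴) ⟫ ≈.+-identityʳ (κ 1ℤ)) }

Invariant-F : ∀ {M V} → Invariant M V → Invariant (2 + M) (F *ˢ V)
Invariant-F {M} {V} I = record { above = Above-F above ; pal = pal-quadratic (+ 14) (F-expand V) above pal
  ; transform = hform-F M V above ⟫ *ˢ-cong {κ (+ 16) *ˢ F⁴} reflˢ transform
      ⟫ solve 3 (λ f c p → con (+ 16) :* f :* (c :* p) := con (+ 16) :* c :* (f :* p)) reflˢ F⁴ (κ (four M)) (ψ V)
      ⟫ *ˢ-cong (symˢ (κ-homo (+ 16) (four M)) ⟫ (λ k → cong (λ a → κ a k) (l (four M)))) (symˢ (ψ-F V)) }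
  where
  open Invariant I
  l : ∀ a → + 16 *ᶻ a ≡ + 4 *ᶻ (+ 4 *ᶻ a)
  l = solve-∀

Invariant-Δ : ∀ {M V} → Invariant M V → Invariant (6 + M) (Δ *ˢ V)
Invariant-Δ {M} {V} I = record
  { above = Above-≈ eq (Above-suc {5 + M} {X *ˢ V₄} (Above-X a₄))
  ; pal = λ i j e → trans (sym (eq i)) (trans
    (pal-X {4 + M} {V₄} a₄ (pal-quadratic -[1+ 1 ] (sq V₂) a₂ (pal-quadratic -[1+ 1 ] (sq V) above pal)) i j e) (eq j))
  ; transform = hform-≈ (6 + M) (symˢ eq) ⟫ hform-A (5 + M) (X *ˢ V₄) (Above-X a₄) ⟫ *ˢ-cong {A} reflˢ
    (hform-X (4 + M) V₄ ⟫ *ˢ-cong {B} reflˢ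
        (hform-1-X (3 + M) V₃ a₃ ⟫ *ˢ-cong {X *ˢ U} reflˢ (hform-1-X (2 + M) V₂ a₂ ⟫ *ˢ-cong {X *ˢ U} reflˢ
        (hform-1-X (1 + M) V₁ a₁ ⟫ *ˢ-cong {X *ˢ U} reflˢ (hform-1-X M V above ⟫ *ˢ-cong {X *ˢ U} reflˢ transform)))))
      ⟫ regroup ⟫ *ˢ-cong (symˢ (κ-homo (+ 4096) (four M)) ⟫ (λ k → cong (λ a → κ a k) (l (four M)))) (symˢ ψΔ) }
  where
  open Invariant I
  V₁ = 1-X *ˢ V
  V₂ = 1-X *ˢ V₁
  V₃ = 1-X *ˢ V₂
  V₄ = 1-X *ˢ V₃
  a₁ : Above (1 + M) V₁
  a₁ = Above-1-X above
  a₂ : Above (2 + M) V₂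
  a₂ = Above-1-X a₁
  a₃ : Above (3 + M) V₃
  a₃ = Above-1-X a₂
  a₄ : Above (4 + M) V₄
  a₄ = Above-1-X a₃
  eq : X *ˢ V₄ ≈ Δ *ˢ V
  eq = solve 3 (λ x q v → x :* (q :* (q :* (q :* (q :* v)))) := x :* (q :* q :* q :* q) :* v) reflˢ X 1-X V
  sq : ∀ f → 1-X *ˢ (1-X *ˢ f) ≈ f +ˢ κ -[1+ 1 ] *ˢ (X *ˢ f) +ˢ X *ˢ (X *ˢ f)
  sq = solve 2 (λ x f → (con 1ℤ :+ :- x) :* ((con 1ℤ :+ :- x) :* f) := f :+ con -[1+ 1 ] :* (x :* f) :+ x :* (x :* f)) reflˢ X
  l : ∀ a → + 4096 *ᶻ a ≡ + 4 *ᶻ (+ 4 *ᶻ (+ 4 *ᶻ (+ 4 *ᶻ (+ 4 *ᶻ (+ 4 *ᶻ a)))))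
  l = solve-∀
  ψΔ : ψ (Δ *ˢ V) ≈ X⁴ *ˢ (1-X⁴ *ˢ (1-X⁴ *ˢ (1-X⁴ *ˢ (1-X⁴ *ˢ ψ V))))
  ψΔ = ψ-cong (symˢ eq) ⟫ ψ-X V₄ ⟫ *ˢ-cong {X⁴} reflˢ (ψ-1-X V₃ ⟫ *ˢ-cong {1-X⁴} reflˢ (ψ-1-X V₂ ⟫ *ˢ-cong {1-X⁴} reflˢ
    (ψ-1-X V₁ ⟫ *ˢ-cong {1-X⁴} reflˢ (ψ-1-X V))))
  regroup : A *ˢ (B *ˢ (X *ˢ U *ˢ (X *ˢ U *ˢ (X *ˢ U *ˢ (X *ˢ U *ˢ (κ (four M) *ˢ ψ V)))))) ≈
    κ (+ 4096) *ˢ κ (four M) *ˢ (X⁴ *ˢ (1-X⁴ *ˢ (1-X⁴ *ˢ (1-X⁴ *ˢ (1-X⁴ *ˢ ψ V)))))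
  regroup = solve 6 (λ x p q s c h → (p :* p :* p :* p) :*
    ((q :* q :* q :* q) :* (x :* (con (+ 8) :* s) :*
    (x :* (con (+ 8) :* s) :* (x :* (con (+ 8) :* s) :* (x :* (con (+ 8) :* s) :* (c :* h))))))
        := con (+ 4096) :* c :* (x :* (x :* (x :* x)) :*
          ((p :* q :* s) :* ((p :* q :* s) :* ((p :* q :* s) :* ((p :* q :* s) :* h)))))) reflˢ X 1+X 1-X
          (1ˢ +ˢ X *ˢ X) (κ (four M)) (ψ V)
    ⟫ *ˢ-cong {κ (+ 4096) *ˢ κ (four M)} reflˢ
      (*ˢ-cong {X⁴} reflˢ (*ˢ-cong w (*ˢ-cong w (*ˢ-cong w (*ˢ-cong {g = ψ V} w reflˢ)))))
    where
    w : 1+X *ˢ 1-X *ˢ (1ˢ +ˢ X *ˢ X) ≈ 1-X⁴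
    w = solve 1 (λ x → (con 1ℤ :+ x) :* (con 1ℤ :+ :- x) :* (con 1ℤ :+ x :* x) := con 1ℤ :+ :- (x :* (x :* (x :* x)))) reflˢ X

Invariant-basis : ∀ j k r → Invariant (j * 6 + (k * 6 + r * 2)) (basis j k r)
Invariant-basis zero zero zero = Invariant-≈ (symˢ (*ˢ-identityˡ (1ˢ *ˢ 1ˢ) ⟫ *ˢ-identityˡ 1ˢ)) Invariant-1
Invariant-basis zero zero (suc r) = Invariant-≈
  (solve 2 (λ f g → f :* (con 1ℤ :* (con 1ℤ :* g)) := con 1ℤ :* (con 1ℤ :* (f :* g))) reflˢ F (F ^ˢ r))
  (Invariant-F (Invariant-basis zero zero r))
Invariant-basis zero (suc k) r = Invariant-≈
  (solve 3 (λ f g h → f :* (f :* (f :* (con 1ℤ :* (g :* h)))) := con 1ℤ :* (f :* f :* f :* g :* h)) reflˢ F (F³ ^ˢ k)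
  (F ^ˢ r))
  (Invariant-F (Invariant-F (Invariant-F (Invariant-basis zero k r))))
Invariant-basis (suc j) k r = Invariant-≈ (symˢ (*ˢ-assoc Δ (Δ ^ˢ j) (F³ ^ˢ k *ˢ F ^ˢ r))) (Invariant-Δ (Invariant-basis j k r))

X^-low : ∀ j f i → i < j → (X ^ˢ j *ˢ f) i ≡ 0ℤ
X^-low (suc j) f zero _ = trans (*ˢ-assoc X (X ^ˢ j) f 0) (X*-zero (X ^ˢ j *ˢ f))
X^-low (suc j) f (suc i) (s≤s lt) = trans (*ˢ-assoc X (X ^ˢ j) f (suc i)) (trans (X*-suc (X ^ˢ j *ˢ f) i) (X^-low j f i lt))

module Basis (j k r : ℕ) where
  unit : Ser
  unit = (1-X *ˢ 1-X *ˢ 1-X *ˢ 1-X) ^ˢ j *ˢ (F³ ^ˢ k *ˢ F ^ˢ r)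
  basis≈ : basis j k r ≈ X ^ˢ j *ˢ unit
  basis≈ = *ˢ-cong {g = F³ ^ˢ k *ˢ F ^ˢ r} (^ˢ-distrib X (1-X *ˢ 1-X *ˢ 1-X *ˢ 1-X) j) reflˢ ⟫ *ˢ-assoc (X ^ˢ j) _ _
  unit₀ : unit 0 ≡ 1ℤ
  unit₀ = cong₂ _*ᶻ_ (^ˢ-zero (1-X *ˢ 1-X *ˢ 1-X *ˢ 1-X) refl j) (cong₂ _*ᶻ_ (^ˢ-zero F³ refl k) (^ˢ-zero F refl r))
  low : ∀ i → i < j → basis j k r i ≡ 0ℤ
  low i lt = trans (basis≈ i) (X^-low j unit i lt)
  lead : basis j k r j ≡ 1ℤ
  lead = trans (cong (basis j k r) (sym (ℕ.+-identityʳ j))) (trans (basis≈ (j + 0)) (trans (X^-+ j unit 0) unit₀))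

-- Weight enumerators

two : ℕ → ℤ
two zero = 1ℤ
two (suc n) = + 2 *ᶻ two n

two-*4 : ∀ M → two (M * 4) ≡ four M *ᶻ four M
two-*4 zero = refl
two-*4 (suc M) = trans (cong (λ t → + 2 *ᶻ (+ 2 *ᶻ (+ 2 *ᶻ (+ 2 *ᶻ t)))) (two-*4 M)) (l (four M))
  where
  l : ∀ a → + 2 *ᶻ (+ 2 *ᶻ (+ 2 *ᶻ (+ 2 *ᶻ (a *ᶻ a)))) ≡ + 4 *ᶻ a *ᶻ (+ 4 *ᶻ a)
  l = solve-∀

ΣW-χ : ∀ {n} (u : Subset n) → ΣW (χ u) ≡ two n *ᶻ δ ∣ u ∣ 0
ΣW-χ [] = refl
ΣW-χ {suc n} (true ∷ u) = trans (cong₂ _+ᶻ_ (ΣW-*ˡ -1ℤ (χ u)) (ΣW-*ˡ 1ℤ (χ u)))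
  (trans (l (ΣW (χ u))) (sym (ℤ.*-zeroʳ (two (suc n)))))
  where
  l : ∀ a → -1ℤ *ᶻ a +ᶻ 1ℤ *ᶻ a ≡ 0ℤ
  l = solve-∀
ΣW-χ {suc n} (false ∷ u) = trans (cong₂ _+ᶻ_ (ΣW-χ u) (ΣW-χ u)) (l (two n) (δ ∣ u ∣ 0))
  where
  l : ∀ a d → a *ᶻ d +ᶻ a *ᶻ d ≡ + 2 *ᶻ a *ᶻ d
  l = solve-∀

ΣW-δ0 : ∀ {n} (g : Subset n → ℤ) → ΣW (λ c → g c *ᶻ δ ∣ c ∣ 0) ≡ g ⊥
ΣW-δ0 {zero} g = ℤ.*-identityʳ (g [])
ΣW-δ0 {suc n} g = trans (cong₂ _+ᶻ_ (trans (ΣW-cong (λ c → ℤ.*-zeroʳ (g (true ∷ c)))) (ΣW-0 {n}))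
  (ΣW-δ0 (g ∘ (false ∷_)))) (ℤ.+-identityˡ _)

four-pos : ∀ M → Σ ℕ λ k → four M ≡ + suc k
four-pos zero = 0 , refl
four-pos (suc M) with four-pos M
... | k , e = k + 3 * suc k , trans (cong (+ 4 *ᶻ_) e) (sym (ℤ.pos-* 4 (suc k)))

module WeightEnumerator {n} (C : Code n) (lin : IsLinear C) (sd : IsSelfDual C) (de : IsDoublyEven C)
  (m L r r′ : ℕ) (r+r′ : r + r′ ≡ 2) (n≡ : n ≡ (suc m + (L + suc m)) * 4) (M≡ : suc m + (L + suc m) ≡ m * 6 + r * 2)
  (L< : L < suc m * 4)
  (minw : ∀ x → x ∈C C → 0 < ∣ x ∣ → suc m * 4 ≤ ∣ x ∣) where

  open Extremal C lin sd de m L n≡ minw public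
  open Designs C lin sd public

  #C : ℤ
  #C = ΣC (λ _ → 1ℤ)

  -- The sum of (-1)^⟨c,x⟩ over c in C and all words x, evaluated in both orders: for fixed x by
  -- self-duality, for fixed c by orthogonality of characters.
  #C² : #C *ᶻ #C ≡ two n
  #C² = trans (cong (#C *ᶻ_) (ΣW-cong (λ x → ℤ.*-identityʳ ⟦ C x ⟧))) (trans (sym (ΣW-*ˡ #C (λ x → ⟦ C x ⟧)))
    (trans (ΣW-cong (λ x → sym (inner x))) (trans (ΣW-swap (λ x c → ⟦ C c ⟧ *ᶻ χ c x))
    (trans (ΣC-χ-sum) (trans (ΣW-δ0 (λ c → two n *ᶻ ⟦ C c ⟧))
      (trans (cong (λ b → two n *ᶻ ⟦ b ⟧) (proj₁ lin)) (ℤ.*-identityʳ (two n))))))))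
    where
    inner : ∀ x → ΣC (λ c → χ c x) ≡ #C *ᶻ ⟦ C x ⟧
    inner x with C x in e
    ... | true = trans (ΣC-cong (λ c _ → χ-sym c x)) (trans (ΣC-χ∈ x e) (sym (ℤ.*-identityʳ #C)))
    ... | false = trans (ΣC-cong (λ c _ → χ-sym c x))
      (trans (ΣC-χ x (λ x∈ → contradiction (trans (sym e) x∈) (λ ()))) (sym (ℤ.*-zeroʳ #C)))
    ΣC-χ-sum : ΣW (λ c → ΣW (λ x → ⟦ C c ⟧ *ᶻ χ c x)) ≡ ΣW (λ c → two n *ᶻ ⟦ C c ⟧ *ᶻ δ ∣ c ∣ 0)
    ΣC-χ-sum = ΣW-cong (λ c → trans (ΣW-*ˡ ⟦ C c ⟧ (χ c)) (trans (cong (⟦ C c ⟧ *ᶻ_) (ΣW-χ c)) (l ⟦ C c ⟧ (two n) (δ ∣ c ∣ 0))))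
      where
      l : ∀ a b c → a *ᶻ (b *ᶻ c) ≡ b *ᶻ a *ᶻ c
      l = solve-∀

  #C≡ : #C ≡ four M
  #C≡ with four-pos M | count-words n C | ℤ.i*j≡0⇒i≡0∨j≡0 (#C -ᶻ four M) {#C +ᶻ four M} factored
    where
    l : ∀ a b → (a -ᶻ b) *ᶻ (a +ᶻ b) ≡ a *ᶻ a -ᶻ b *ᶻ b
    l = solve-∀
    factored : (#C -ᶻ four M) *ᶻ (#C +ᶻ four M) ≡ 0ℤ
    factored = trans (l #C (four M)) (trans (cong (_-ᶻ four M *ᶻ four M) (trans #C² (trans (cong two n≡) (two-*4 M))))
      (ℤ.+-inverseʳ (four M *ᶻ four M)))
  ... | _ | _ | inj₁ z = ℤ.i-j≡0⇒i≡j #C (four M) z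
  ... | k , e | cnt | inj₂ z = contradiction
    (trans (sym z) (cong₂ _+ᶻ_ (trans (ΣW-cong (λ c → ℤ.*-identityʳ ⟦ C c ⟧)) (sym cnt)) e)) absurd
    where
    absurd : ∀ {a} → 0ℤ ≢ + a +ᶻ + suc k
    absurd {a} e = contradiction (ℤ.+-injective (trans e (sym (ℤ.pos-+ a (suc k)))))
      (λ e′ → contradiction (trans e′ (ℕ.+-suc a k)) (λ ()))

  W : Ser
  W = enum (specht [])

  W-size : ∀ a → W a ≡ size (a * 4)
  W-size a = ΣC-cong (λ c _ → ℤ.*-identityʳ (δ ∣ c ∣ (a * 4)))

  W-zero : W 0 ≡ 1ℤ
  W-zero = trans (ΣW-cong (λ c → cong (⟦ C c ⟧ *ᶻ_) (ℤ.*-identityʳ (δ ∣ c ∣ 0))))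
    (trans (ΣW-δ0 (λ c → ⟦ C c ⟧)) (cong ⟦_⟧ (proj₁ lin)))

  W-low : ∀ a → 1 ≤ a → a < suc m → W a ≡ 0ℤ
  W-low a a≥1 lt = ΣC-zero λ c c∈ → trans (ℤ.*-identityʳ (δ ∣ c ∣ (a * 4))) (δ-≢ ∣ c ∣ (a * 4) λ e →
    ℕ.<⇒≱ (ℕ.*-monoˡ-< 4 lt) (subst (suc m * 4 ≤_) e (minw c c∈ (subst (0 <_) (sym e) (ℕ.<-≤-trans a≥1 (ℕ.m≤m*n a 4))))))

  W-above : Above M W
  W-above a lt = ΣC-zero λ c c∈ → trans (ℤ.*-identityʳ (δ ∣ c ∣ (a * 4))) (δ-≢ ∣ c ∣ (a * 4) λ e →
    ℕ.<⇒≱ (ℕ.*-monoˡ-< 4 lt) (subst₂ _≤_ e n≡ (∣c∣≤n c)))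

  δ-comp : ∀ i j → i + j ≡ M → ∀ c → δ (∣ ones ⊕ c ∣) (i * 4) ≡ δ (∣ c ∣) (j * 4)
  δ-comp i j e c with ∣ c ∣ ℕ.≟ j * 4
  ... | yes p = trans (cong (λ w → δ w (i * 4))
    (ℕ.+-cancelʳ-≡ (j * 4) ∣ ones ⊕ c ∣ (i * 4)
    (trans (cong (λ t → ∣ ones ⊕ c ∣ + t) (sym p)) (trans (∣ones⊕∣ c) n≡′))))
      (trans (δ-refl (i * 4)) (sym (trans (cong (λ w → δ w (j * 4)) p) (δ-refl (j * 4)))))
    where
    n≡′ : n ≡ i * 4 + j * 4
    n≡′ = trans n≡ (trans (cong (_* 4) (sym e)) (ℕ.*-distribʳ-+ 4 i j))
  ... | no ne = trans (δ-≢ _ _ λ p → ne (ℕ.+-cancelˡ-≡ (i * 4) ∣ c ∣ (j * 4)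
    (trans (cong (λ t → t + ∣ c ∣) (sym p)) (trans (∣ones⊕∣ c)
    (trans n≡ (trans (cong (_* 4) (sym e)) (ℕ.*-distribʳ-+ 4 i j)))))))
      (sym (δ-≢ _ _ ne))

  W-pal : Palindrome M W
  W-pal i j e = trans (ΣC-⊕ ones∈ (λ c → δ ∣ c ∣ (i * 4) *ᶻ 1ℤ)) (ΣC-cong (λ c _ → cong (_*ᶻ 1ℤ) (δ-comp i j e c)))

  -- invariance up to terms of order 4(m+1), all that the minimum weight provides directly
  record Weak (V : Ser) : Set where
    field
      above : Above M V
      pal : Palindrome M V
      transform : Vanish (suc m * 4) (hform M V +ˢ -ˢ (κ (four M) *ˢ ψ V))

  -- Below degree d the transform of W consists of sums of characters of weights without codewords,
  -- except for the constant |C| = 4^M; and W(X⁴) has no terms there besides 1.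
  Weak-W : Weak W
  Weak-W = record { above = W-above ; pal = W-pal ; transform = λ j lt
    → trans (cong₂ (λ s t → s +ᶻ -ᶻ t) (left j lt) (right j lt)) (ℤ.+-inverseʳ (κ (four M) j)) }
    where
    left : ∀ j → j < suc m * 4 → hform M W j ≡ κ (four M) j
    left j lt = trans (sym (enum-form M n≡ [] [] j)) (trans (*ˢ-identityˡ (spechtSeries []) j) (go j lt))
      where
      free₀ : ∀ c → gen (free {n}) c 0 ≡ 1ℤ
      free₀ c with gen-free c
      ... | z , _ , p = trans (p 0) (cong₂ _*ᶻ_ (^ˢ-zero 1+X refl z) (^ˢ-zero 1-X refl ∣ c ∣))
      go : ∀ j → j < suc m * 4 → spechtSeries [] j ≡ κ (four M) j
      go zero _ = trans (ΣC-cong (λ c _ → trans (ℤ.*-identityˡ (gen free c 0)) (free₀ c))) #C≡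
      go (suc j) lt = spechtSeries-zero [] [] (suc j)
        (λ x x∈ e → ℕ.<⇒≱ lt (subst (suc m * 4 ≤_) e (minw x x∈ (subst (0 <_) (sym e) (s≤s z≤n)))))
    right : ∀ j → j < suc m * 4 → (κ (four M) *ˢ ψ W) j ≡ κ (four M) j
    right j lt = trans (κ-*ˢ (four M) (ψ W) j) (trans (cong (four M *ᶻ_) (ψW j lt)) (k1 j))
      where
      k1 : ∀ j → four M *ᶻ κ 1ℤ j ≡ κ (four M) j
      k1 zero = ℤ.*-identityʳ (four M)
      k1 (suc j) = ℤ.*-zeroʳ (four M)
      ψW : ∀ j → j < suc m * 4 → ψ W j ≡ κ 1ℤ j
      ψW 0 _ = W-zero
      ψW 1 _ = refl
      ψW 2 _ = refl
      ψW 3 _ = refl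
      ψW (suc (suc (suc (suc j)))) (s≤s (s≤s (s≤s (s≤s lt))))
        = ψ-Vanish m (tail W) (λ i i<m → W-low (suc i) (s≤s z≤n) (s≤s i<m)) j lt

  Weak-sub : ∀ {V Z} a → Weak V → Invariant M Z → Weak (V +ˢ κ a *ˢ Z)
  Weak-sub {V} {Z} a v z = record
    { above = Above-+ (Weak.above v) (Above-κ a (Invariant.above z))
    ; pal = λ i j e → cong₂ _+ᶻ_ (Weak.pal v i j e)
      (trans (κ-*ˢ a Z i) (trans (cong (a *ᶻ_) (Invariant.pal z i j e)) (sym (κ-*ˢ a Z j))))
    ; transform = Vanish-cong eq (Weak.transform v) }
    where
    eq : hform M V +ˢ -ˢ (κ (four M) *ˢ ψ V) ≈ hform M (V +ˢ κ a *ˢ Z) +ˢ -ˢ (κ (four M) *ˢ ψ (V +ˢ κ a *ˢ Z))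
    eq = solve 5 (λ h c p a q → h :+ :- (c :* p) := h :+ a :* (c :* q) :+ :- (c :* (p :+ a :* q))) reflˢ (hform M V)
      (κ (four M)) (ψ V) (κ a) (ψ Z)
      ⟫ symˢ (≈.+-cong (hform-+ M V (κ a *ˢ Z) ⟫ ≈.+-cong {hform M V} reflˢ
        (hform-κ* M a Z ⟫ *ˢ-cong {κ a} reflˢ (Invariant.transform z)))
          (≈.-‿cong (*ˢ-cong {κ (four M)} reflˢ (ψ-+ V (κ a *ˢ Z) ⟫ ≈.+-cong {ψ V} reflˢ (ψ-κ* a Z)))))

  Weak-high : ∀ {V} → Weak V → (∀ i → i < suc m → V i ≡ 0ℤ) → ∀ a → suc m + L < a → V a ≡ 0ℤ
  Weak-high v low a gt with M ℕ.<? a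
  ... | yes M<a = Weak.above v a M<a
  ... | no M≮a = trans (Weak.pal v a (M ∸ a) (ℕ.m+[n∸m]≡n (ℕ.≮⇒≥ M≮a))) (low (M ∸ a)
    (ℕ.+-cancelˡ-< a _ _ (subst₂ _<_ (sym (ℕ.m+[n∸m]≡n (ℕ.≮⇒≥ M≮a))) (ℕ.+-comm (suc m) a)
      (ℕ.+-monoʳ-< (suc m) (subst (_< a) (ℕ.+-comm (suc m) L) gt)))))

  -- By symmetry the upper m+1 places are empty as well, so a form of degree L is left. It vanishes
  -- to order d > L and hence is 0.
  Weak-unique : ∀ {V} → Weak V → (∀ i → i < suc m → V i ≡ 0ℤ) → V ≈ 0ˢ
  Weak-unique {V} v low a with a ℕ.<? suc m
  ... | yes lt = low a lt
  ... | no ge = trans (cong V (sym (ℕ.m+[n∸m]≡n (ℕ.≮⇒≥ ge)))) (inner (a ∸ suc m))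
    where
    e′ : Ser
    e′ i = V (suc m + i)
    high : ∀ a → suc m + L < a → V a ≡ 0ℤ
    high = Weak-high v low
    trim : hform M V ≈ pq ^ˢ (suc m * 4) *ˢ hform L e′
    trim = hform-trim V low high
    hV : Vanish (suc m * 4) (hform M V)
    hV j lt = trans (sym (l (hform M V j) ((κ (four M) *ˢ ψ V) j))) (cong₂ _+ᶻ_ (Weak.transform v j lt)
      (trans (κ-*ˢ (four M) (ψ V) j) (trans (cong (four M *ᶻ_) (ψ-Vanish (suc m) V low j lt)) (ℤ.*-zeroʳ (four M)))))
      where
      l : ∀ a b → a +ᶻ -ᶻ b +ᶻ b ≡ a
      l = solve-∀
    inner : e′ ≈ 0ˢ
    inner = shape-zero L e′ (λ i lt → high (suc m + i) (ℕ.+-monoʳ-< (suc m) lt))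
      (λ j j≤L → unit-cancel (pq ^ˢ (suc m * 4)) (hform L e′) (^ˢ-zero pq refl (suc m * 4)) (suc m * 4)
        (Vanish-cong trim hV) j (ℕ.<-≤-trans j≤L L<))

  -- Gleason's theorem in dual form. Subtracting V j times Δ^j F^(3(m-j)+r) clears the coefficient
  -- at j, respects the symmetries and does not change a functional that annihilates the basis.
  -- After m+1 steps `Weak-unique` leaves 0.
  gleason : ∀ G k → (∀ j i → j + i ≡ m → (basis j i r *ˢ G) k ≡ 0ℤ) → (W *ˢ G) k ≡ 0ℤ
  gleason G k kills = go (suc m) 0 (ℕ.+-identityʳ (suc m)) W Weak-W (λ i ())
    where
    go : ∀ s j → s + j ≡ suc m → ∀ V → Weak V → (∀ i → i < j → V i ≡ 0ℤ) → (V *ˢ G) k ≡ 0ℤ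
    go zero j refl V v low = trans (*ˢ-cong {g = G} (Weak-unique v low) reflˢ k) (≈.zeroˡ G k)
    go (suc s) j e V v low = trans (sym eq) (go s (suc j) (trans (ℕ.+-suc s j) e) V′ (Weak-sub (-ᶻ V j) v inv) low′)
      where
      Z = basis j s r
      s+j : j + s ≡ m
      s+j = trans (ℕ.+-comm j s) (ℕ.suc-injective e)
      inv : Invariant M Z
      inv = subst (λ N → Invariant N Z) (sym (trans M≡
        (trans (cong (λ t → t * 6 + r * 2) (sym s+j))
        (trans (cong (_+ r * 2) (ℕ.*-distribʳ-+ 6 j s)) (ℕ.+-assoc (j * 6) (s * 6) (r * 2)))))) (Invariant-basis j s r)
      V′ : Ser
      V′ = V +ˢ κ (-ᶻ V j) *ˢ Z
      low′ : ∀ i → i < suc j → V′ i ≡ 0ℤ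
      low′ i (s≤s i≤j) with ℕ.m≤n⇒m<n∨m≡n i≤j
      ... | inj₁ i<j = cong₂ _+ᶻ_ (low i i<j) (trans (κ-*ˢ (-ᶻ V j) Z i)
        (trans (cong (-ᶻ V j *ᶻ_) (Basis.low j s r i i<j)) (ℤ.*-zeroʳ (-ᶻ V j))))
      ... | inj₂ refl = trans (cong (V j +ᶻ_) (trans (κ-*ˢ (-ᶻ V j) Z j)
        (trans (cong (-ᶻ V j *ᶻ_) (Basis.lead j s r)) (ℤ.*-identityʳ (-ᶻ V j))))) (ℤ.+-inverseʳ (V j))
      eq : (V′ *ˢ G) k ≡ (V *ˢ G) k
      eq = trans (solve 4 (λ v a z g → (v :+ a :* z) :* g := v :* g :+ a :* (z :* g)) reflˢ V (κ (-ᶻ V j)) Z G k)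
        (trans (cong ((V *ˢ G) k +ᶻ_) (trans (κ-*ˢ (-ᶻ V j) (Z *ˢ G) k)
          (trans (cong (-ᶻ V j *ᶻ_) (kills j s s+j)) (ℤ.*-zeroʳ (-ᶻ V j))))) (ℤ.+-identityʳ _))

  W′ : Ser
  W′ i = W (suc m + i)

  W-split : W ≈ 1ˢ +ˢ X ^ˢ suc m *ˢ W′
  W-split zero = trans W-zero (sym (trans (cong (1ℤ +ᶻ_) (X^-low (suc m) W′ 0 (s≤s z≤n))) refl))
  W-split (suc a) with suc a ℕ.<? suc m
  ... | yes lt = trans (W-low (suc a) (s≤s z≤n) lt) (sym (trans (ℤ.+-identityˡ _) (X^-low (suc m) W′ (suc a) lt)))
  ... | no ge = sym (trans (ℤ.+-identityˡ _)
    (trans (cong (X ^ˢ suc m *ˢ W′) (sym e)) (trans (X^-+ (suc m) W′ (a ∸ m)) (cong W e))))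
    where
    e : suc m + (a ∸ m) ≡ suc a
    e = cong suc (ℕ.m+[n∸m]≡n (ℕ.≤-pred (ℕ.≮⇒≥ ge)))

  W-conv : ∀ G i → (W *ˢ G) (suc m + i) ≡ G (suc m + i) +ᶻ (W′ *ˢ G) i
  W-conv G i = trans (*ˢ-cong {g = G} W-split reflˢ (suc m + i))
    (trans (solve 3 (λ x w g → (con 1ℤ :+ x :* w) :* g := g :+ x :* (w :* g)) reflˢ (X ^ˢ suc m) W′ G (suc m + i))
    (cong (G (suc m + i) +ᶻ_) (X^-+ (suc m) (W′ *ˢ G) i)))

  G₁ G₂ : Ser
  G₁ = kernel r′ m
  G₂ = F³ *ˢ kernel r′ (suc m)

  kernel₀ : ∀ m → kernel r′ m 0 ≡ 1ℤ
  kernel₀ m = cong₂ _*ᶻ_ (cong (_*ᶻ 1ℤ) (^ˢ-zero F refl r′)) (^ˢ-zero N⁴ refl m)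

  -- W has no terms between 1 and X^(m+1), and `G₁` has constant term 1, so the vanishing
  -- coefficient of the product is just G₁ (m+1) + W (m+1).
  W-first : W (suc m) ≡ -ᶻ G₁ (suc m)
  W-first = l (G₁ (suc m)) (W (suc m)) (trans (cong₂ _+ᶻ_ (cong G₁ (sym (ℕ.+-identityʳ (suc m)))) (sym lead))
    (trans (sym (W-conv G₁ 0)) (trans (cong (W *ˢ G₁) (ℕ.+-identityʳ (suc m)))
      (gleason G₁ (suc m) λ { j i refl → basis-residue j i r r′ r+r′ }))))
    where
    lead : (W′ *ˢ G₁) 0 ≡ W (suc m)
    lead = trans (cong (W (suc m + 0) *ᶻ_) (kernel₀ m)) (trans (ℤ.*-identityʳ _) (cong W (ℕ.+-identityʳ (suc m))))
    l : ∀ a b → a +ᶻ b ≡ 0ℤ → b ≡ -ᶻ a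
    l a b e = trans (sym (l2 a b)) (trans (cong (-ᶻ a +ᶻ_) e) (ℤ.+-identityʳ (-ᶻ a)))
      where
      l2 : ∀ a b → -ᶻ a +ᶻ (a +ᶻ b) ≡ b
      l2 = solve-∀

  W-second : W (suc (suc m)) ≡ -ᶻ (G₂ (suc (suc m)) +ᶻ W (suc m) *ᶻ G₂ 1)
  W-second = l (G₂ (suc (suc m))) (W (suc m) *ᶻ G₂ 1) (W (suc (suc m)))
    (trans (cong₂ _+ᶻ_ (cong G₂ (sym i+1)) (sym lead)) (trans (sym (W-conv G₂ 1)) (trans (cong (W *ˢ G₂) i+1)
      (gleason G₂ (suc (suc m)) λ { j i refl → basis-residue-suc j i r r′ r+r′ }))))
    where
    i+1 : suc m + 1 ≡ suc (suc m)
    i+1 = ℕ.+-comm (suc m) 1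
    G₂₀ : G₂ 0 ≡ 1ℤ
    G₂₀ = trans (ℤ.*-identityˡ _) (kernel₀ (suc m))
    lead : (W′ *ˢ G₂) 1 ≡ W (suc m) *ᶻ G₂ 1 +ᶻ W (suc (suc m))
    lead = cong₂ _+ᶻ_ (cong (λ s → W s *ᶻ G₂ 1) (ℕ.+-identityʳ (suc m)))
      (trans (cong (W (suc m + 1) *ᶻ_) G₂₀) (trans (ℤ.*-identityʳ _) (cong W i+1)))
    l : ∀ a b c → a +ᶻ (b +ᶻ c) ≡ 0ℤ → c ≡ -ᶻ (a +ᶻ b)
    l a b c e = trans (sym (l2 a b c)) (trans (cong (-ᶻ (a +ᶻ b) +ᶻ_) e) (ℤ.+-identityʳ (-ᶻ (a +ᶻ b))))
      where
      l2 : ∀ a b c → -ᶻ (a +ᶻ b) +ᶻ (a +ᶻ (b +ᶻ c)) ≡ c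
      l2 = solve-∀

-- Evaluation of coefficients

poly : List ℤ → Ser
poly [] = 0ˢ
poly (c ∷ cs) = κ c +ˢ X *ˢ poly cs

conv : List ℤ → Ser → ℕ → ℤ
conv [] s k = 0ℤ
conv (c ∷ cs) s zero = c *ᶻ s 0
conv (c ∷ cs) s (suc k) = c *ᶻ s (suc k) +ᶻ conv cs s k

poly-* : ∀ cs s k → (poly cs *ˢ s) k ≡ conv cs s k
poly-* [] s k = ≈.zeroˡ s k
poly-* (c ∷ cs) s k = trans (solve 4 (λ c x p s → (c :+ x :* p) :* s := c :* s :+ x :* (p :* s)) reflˢ (κ c) X (poly cs) s k)
  (trans (cong (_+ᶻ (X *ˢ (poly cs *ˢ s)) k) (κ-*ˢ c s k)) (shift k))
  where
  shift : ∀ k → c *ᶻ s k +ᶻ (X *ˢ (poly cs *ˢ s)) k ≡ conv (c ∷ cs) s k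
  shift zero = trans (cong (c *ᶻ s 0 +ᶻ_) (X*-zero (poly cs *ˢ s))) (ℤ.+-identityʳ _)
  shift (suc k) = cong (c *ᶻ s (suc k) +ᶻ_) (trans (X*-suc (poly cs *ˢ s) k) (poly-* cs s k))

-- The recurrence for the coefficients of (1-X)^(-e); integral e covers the powers of N as well as
-- those of 1-X.
Hyper : ℤ → Ser → Set
Hyper e s = ∀ k → + suc k *ᶻ s (suc k) ≡ (e +ᶻ + k) *ᶻ s k

hyper-θ : ∀ e s → 1-X *ˢ θ s ≈ κ e *ˢ (X *ˢ s) → Hyper e s
hyper-θ e s p k = l (+ suc k *ᶻ s (suc k)) (+ k) (s k) e (trans (sym (cong (λ t → + suc k *ᶻ s (suc k) +ᶻ -ᶻ t) (X*-suc (θ s) k)))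
  (trans (solve 2 (λ x t → t :+ :- (x :* t) := (con 1ℤ :+ :- x) :* t) reflˢ X (θ s) (suc k))
  (trans (p (suc k)) (trans (κ-*ˢ e (X *ˢ s) (suc k)) (cong (e *ᶻ_) (X*-suc s k))))))
  where
  l : ∀ a k s e → a +ᶻ -ᶻ (k *ᶻ s) ≡ e *ᶻ s → a ≡ (e +ᶻ k) *ᶻ s
  l a k s e q = trans (l₁ a (k *ᶻ s)) (trans (cong (_+ᶻ k *ᶻ s) q) (sym (ℤ.*-distribʳ-+ s e k)))
    where
    l₁ : ∀ a b → a ≡ a +ᶻ -ᶻ b +ᶻ b
    l₁ = solve-∀

hyper-N : ∀ e → Hyper (+ e) (N ^ˢ e)
hyper-N zero = hyper-θ 0ℤ 1ˢ (*ˢ-cong {1-X} reflˢ θ1ˢ ⟫ ≈.zeroʳ 1-X ⟫ symˢ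
  (λ k → trans (κ-*ˢ 0ℤ (X *ˢ 1ˢ) k) (ℤ.*-zeroˡ ((X *ˢ 1ˢ) k))))
hyper-N (suc e) = hyper-θ (+ suc e) (N ^ˢ suc e)
  (*ˢ-cong {1-X} reflˢ (θ-^ N e ⟫ *ˢ-cong {κ (+ suc e)} reflˢ (*ˢ-cong {N ^ˢ e} reflˢ θN))
  ⟫ solve 5 (λ q c p x n → q :* (c :* (p :* (x :* (n :* n)))) := (q :* n) :* (c :* (x :* (n :* p)))) reflˢ 1-X
    (κ (+ suc e)) (N ^ˢ e) X N
  ⟫ *ˢ-cong {g = κ (+ suc e) *ˢ (X *ˢ N ^ˢ suc e)} N-inverse reflˢ ⟫ *ˢ-identityˡ _)

hyper-1-X : ∀ v → Hyper (-ᶻ + v) (1-X ^ˢ v)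
hyper-1-X zero = hyper-θ 0ℤ 1ˢ (*ˢ-cong {1-X} reflˢ θ1ˢ ⟫ ≈.zeroʳ 1-X ⟫ symˢ
  (λ k → trans (κ-*ˢ 0ℤ (X *ˢ 1ˢ) k) (ℤ.*-zeroˡ ((X *ˢ 1ˢ) k))))
hyper-1-X (suc v) = hyper-θ (-ᶻ + suc v) (1-X ^ˢ suc v)
  (*ˢ-cong {1-X} reflˢ (θ-^ 1-X v ⟫ *ˢ-cong {κ (+ suc v)} reflˢ (*ˢ-cong {1-X ^ˢ v} reflˢ θ1-X))
  ⟫ solve 4 (λ q c p x → q :* (c :* (p :* :- x)) := :- c :* (x :* (q :* p))) reflˢ 1-X (κ (+ suc v)) (1-X ^ˢ v) X
  ⟫ *ˢ-cong { -ˢ κ (+ suc v)} {κ (-ᶻ + suc v)} {X *ˢ 1-X ^ˢ suc v} (λ { zero → refl ; (suc k) → refl }) reflˢ)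

-- numerator of a convolution of cs with a hypergeometric sequence, relative to the sequence's value at k
numer : List ℤ → ℤ → ℤ → ℤ
numer [] e k = 0ℤ
numer (c ∷ cs) e k = c *ᶻ ff (e +ᶻ k -ᶻ 1ℤ) (length cs) +ᶻ k *ᶻ numer cs e (k -ᶻ 1ℤ)

-- By the recurrence s(k-i) is s(k) times (k)_i / (e+k-1)_i, and the falling factorial on the left
-- is a common denominator of these ratios.
conv-numer : ∀ e s → Hyper e s → ∀ c cs k →
  ff (e +ᶻ + k -ᶻ 1ℤ) (length cs) *ᶻ conv (c ∷ cs) s k ≡ s k *ᶻ numer (c ∷ cs) e (+ k)
conv-numer e s h c cs zero = l (ff (e +ᶻ 0ℤ -ᶻ 1ℤ) (length cs)) c (s 0) (numer cs e (0ℤ -ᶻ 1ℤ))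
  where
  l : ∀ f c s t → f *ᶻ (c *ᶻ s) ≡ s *ᶻ (c *ᶻ f +ᶻ 0ℤ *ᶻ t)
  l = solve-∀
conv-numer e s h c [] (suc k) = l c (s (suc k)) (+ suc k)
  where
  l : ∀ c s k → 1ℤ *ᶻ (c *ᶻ s +ᶻ 0ℤ) ≡ s *ᶻ (c *ᶻ 1ℤ +ᶻ k *ᶻ 0ℤ)
  l = solve-∀
conv-numer e s h c (c′ ∷ cs) (suc k) = begin
  x *ᶻ g *ᶻ (c *ᶻ s (suc k) +ᶻ conv (c′ ∷ cs) s k)
    ≡⟨ l₁ x g (c *ᶻ s (suc k)) (conv (c′ ∷ cs) s k) ⟩
  x *ᶻ g *ᶻ (c *ᶻ s (suc k)) +ᶻ x *ᶻ (g *ᶻ conv (c′ ∷ cs) s k)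
    ≡⟨ cong (λ t → x *ᶻ g *ᶻ (c *ᶻ s (suc k)) +ᶻ x *ᶻ t)
      (trans (cong (λ a → ff a (length cs) *ᶻ conv (c′ ∷ cs) s k) (arg e)) (conv-numer e s h c′ cs k)) ⟩
  x *ᶻ g *ᶻ (c *ᶻ s (suc k)) +ᶻ x *ᶻ (s k *ᶻ t)
    ≡⟨ l₂ x g c (s (suc k)) (s k) t ⟩
  s (suc k) *ᶻ (c *ᶻ (x *ᶻ g)) +ᶻ x *ᶻ s k *ᶻ t
    ≡⟨ cong (λ a → s (suc k) *ᶻ (c *ᶻ (x *ᶻ g)) +ᶻ a *ᶻ t) (trans (cong (_*ᶻ s k) (x≡ e)) (sym (h k))) ⟩
  s (suc k) *ᶻ (c *ᶻ (x *ᶻ g)) +ᶻ + suc k *ᶻ s (suc k) *ᶻ t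
    ≡⟨ l₃ (s (suc k)) (c *ᶻ (x *ᶻ g)) (+ suc k) t ⟩
  s (suc k) *ᶻ (c *ᶻ (x *ᶻ g) +ᶻ + suc k *ᶻ t) ∎
  where
  open ≡-Reasoning
  x = e +ᶻ + suc k -ᶻ 1ℤ
  g = ff (x -ᶻ 1ℤ) (length cs)
  t = numer (c′ ∷ cs) e (+ k)
  x≡ : ∀ e → e +ᶻ + suc k -ᶻ 1ℤ ≡ e +ᶻ + k
  x≡ e = trans (cong (λ j → e +ᶻ j -ᶻ 1ℤ) (ℤ.pos-+ 1 k)) (l e (+ k))
    where
    l : ∀ e k → e +ᶻ (1ℤ +ᶻ k) -ᶻ 1ℤ ≡ e +ᶻ k
    l = solve-∀
  arg : ∀ e → e +ᶻ + suc k -ᶻ 1ℤ -ᶻ 1ℤ ≡ e +ᶻ + k -ᶻ 1ℤ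
  arg e = cong (_-ᶻ 1ℤ) (x≡ e)
  l₁ : ∀ x g a b → x *ᶻ g *ᶻ (a +ᶻ b) ≡ x *ᶻ g *ᶻ a +ᶻ x *ᶻ (g *ᶻ b)
  l₁ = solve-∀
  l₂ : ∀ x g c s r t → x *ᶻ g *ᶻ (c *ᶻ s) +ᶻ x *ᶻ (r *ᶻ t) ≡ s *ᶻ (c *ᶻ (x *ᶻ g)) +ᶻ x *ᶻ r *ᶻ t
  l₂ = solve-∀
  l₃ : ∀ s a k t → s *ᶻ a +ᶻ k *ᶻ s *ᶻ t ≡ s *ᶻ (a +ᶻ k *ᶻ t)
  l₃ = solve-∀

-- The binomial coefficient of e+k-1 over k, by one division per step, which makes it cheap to
-- evaluate; `N^-binom` shows that the divisions are exact.
binom : ℕ → ℕ → ℕ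
binom e zero = 1
binom e (suc k) = binom e k * (e + k) / suc k

N^-binom : ∀ e k → (N ^ˢ e) k ≡ + binom e k
N^-binom e zero = ^ˢ-zero N refl e
N^-binom e (suc k) = go ((N ^ˢ e) (suc k)) refl
  where
  eq : + suc k *ᶻ (N ^ˢ e) (suc k) ≡ + (binom e k * (e + k))
  eq = trans (hyper-N e k) (trans (cong ((+ e +ᶻ + k) *ᶻ_) (N^-binom e k)) (trans (cong (_*ᶻ + binom e k) (sym (ℤ.pos-+ e k)))
    (trans (sym (ℤ.pos-* (e + k) (binom e k))) (cong +_ (ℕ.*-comm (e + k) (binom e k))))))
  go : ∀ a → (N ^ˢ e) (suc k) ≡ a → a ≡ + binom e (suc k)
  go (+ a) p = cong +_ (sym (trans (cong (_/ suc k)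
    (trans (sym (ℤ.+-injective (trans (trans (ℤ.pos-* (suc k) a) (cong (+ suc k *ᶻ_) (sym p))) eq)))
    (ℕ.*-comm (suc k) a))) (m*n/n≡m a (suc k))))
  go (-[1+ a ]) p = contradiction (trans (sym (cong (+ suc k *ᶻ_) p)) eq) (λ ())

binom-pos : ∀ e k → Σ ℕ λ b → (N ^ˢ suc e) k ≡ + suc b
binom-pos e zero = 0 , ^ˢ-zero N refl (suc e)
binom-pos e (suc k) with binom-pos e k | N^-binom (suc e) (suc k)
... | b , p | q with binom (suc e) (suc k)
...   | suc a = a , q
...   | zero = contradiction (trans (sym (trans (cong (+ suc k *ᶻ_) q) (ℤ.*-zeroʳ (+ suc k))))
  (trans (hyper-N (suc e) k) (trans (cong ((+ suc e +ᶻ + k) *ᶻ_) p) (sym (ℤ.pos-* (suc (e + k)) (suc b))))))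
        (λ ())

-- coefficient lists start with the constant term
eval : List ℤ → ℤ → ℤ
eval [] x = 0ℤ
eval (a ∷ p) x = a +ᶻ x *ᶻ eval p x

infixl 6 _+ᵖ_
infixl 7 _*ᵖ_ _·ᵖ_
_+ᵖ_ : List ℤ → List ℤ → List ℤ
[] +ᵖ q = q
(a ∷ p) +ᵖ [] = a ∷ p
(a ∷ p) +ᵖ (b ∷ q) = a +ᶻ b ∷ p +ᵖ q

_·ᵖ_ : ℤ → List ℤ → List ℤ
a ·ᵖ q = map (a *ᶻ_) q

_*ᵖ_ : List ℤ → List ℤ → List ℤ
[] *ᵖ q = []
(a ∷ p) *ᵖ q = a ·ᵖ q +ᵖ (0ℤ ∷ p *ᵖ q)

eval-+ : ∀ p q x → eval (p +ᵖ q) x ≡ eval p x +ᶻ eval q x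
eval-+ [] q x = sym (ℤ.+-identityˡ _)
eval-+ (a ∷ p) [] x = sym (ℤ.+-identityʳ _)
eval-+ (a ∷ p) (b ∷ q) x = trans (cong (λ t → a +ᶻ b +ᶻ x *ᶻ t) (eval-+ p q x)) (l a b x (eval p x) (eval q x))
  where
  l : ∀ a b x p q → a +ᶻ b +ᶻ x *ᶻ (p +ᶻ q) ≡ (a +ᶻ x *ᶻ p) +ᶻ (b +ᶻ x *ᶻ q)
  l = solve-∀

eval-· : ∀ a q x → eval (a ·ᵖ q) x ≡ a *ᶻ eval q x
eval-· a [] x = sym (ℤ.*-zeroʳ a)
eval-· a (b ∷ q) x = trans (cong (λ t → a *ᶻ b +ᶻ x *ᶻ t) (eval-· a q x)) (l a b x (eval q x))
  where
  l : ∀ a b x q → a *ᶻ b +ᶻ x *ᶻ (a *ᶻ q) ≡ a *ᶻ (b +ᶻ x *ᶻ q)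
  l = solve-∀

eval-* : ∀ p q x → eval (p *ᵖ q) x ≡ eval p x *ᶻ eval q x
eval-* [] q x = refl
eval-* (a ∷ p) q x = trans (eval-+ (a ·ᵖ q) (0ℤ ∷ p *ᵖ q) x)
  (trans (cong₂ (λ s t → s +ᶻ (0ℤ +ᶻ x *ᶻ t)) (eval-· a q x) (eval-* p q x)) (l a x (eval p x) (eval q x)))
  where
  l : ∀ a x p q → a *ᶻ q +ᶻ (0ℤ +ᶻ x *ᶻ (p *ᶻ q)) ≡ (a +ᶻ x *ᶻ p) *ᶻ q
  l = solve-∀

ffᵖ : List ℤ → ℕ → List ℤ
ffᵖ p zero = 1ℤ ∷ []
ffᵖ p (suc k) = p *ᵖ ffᵖ (p +ᵖ (-1ℤ ∷ [])) k

eval-ff : ∀ p k x → eval (ffᵖ p k) x ≡ ff (eval p x) k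
eval-ff p zero x = trans (cong (1ℤ +ᶻ_) (ℤ.*-zeroʳ x)) refl
eval-ff p (suc k) x = trans (eval-* p (ffᵖ (p +ᵖ (-1ℤ ∷ [])) k) x) (cong (eval p x *ᶻ_) (trans (eval-ff (p +ᵖ (-1ℤ ∷ [])) k x)
  (cong (λ y → ff y k) (trans (eval-+ p (-1ℤ ∷ []) x) (cong (eval p x +ᶻ_) (trans (cong (-1ℤ +ᶻ_) (ℤ.*-zeroʳ x)) refl))))))

-- `numer` with polynomial arguments, so that a single computation settles the sign for infinitely
-- many m.
numerᵖ : List (List ℤ) → List ℤ → List ℤ → List ℤ
numerᵖ [] e k = []
numerᵖ (c ∷ cs) e k = c *ᵖ ffᵖ (e +ᵖ k +ᵖ (-1ℤ ∷ [])) (length cs) +ᵖ k *ᵖ numerᵖ cs e (k +ᵖ (-1ℤ ∷ []))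

eval-pred : ∀ p x → eval (p +ᵖ (-1ℤ ∷ [])) x ≡ eval p x -ᶻ 1ℤ
eval-pred p x = trans (eval-+ p (-1ℤ ∷ []) x) (cong (eval p x +ᶻ_) (trans (cong (-1ℤ +ᶻ_) (ℤ.*-zeroʳ x)) refl))

eval-numer : ∀ cs e k x → eval (numerᵖ cs e k) x ≡ numer (map (λ c → eval c x) cs) (eval e x) (eval k x)
eval-numer [] e k x = refl
eval-numer (c ∷ cs) e k x = trans (eval-+ (c *ᵖ ffᵖ (e +ᵖ k +ᵖ (-1ℤ ∷ [])) (length cs)) _ x) (cong₂ _+ᶻ_
  (trans (eval-* c _ x) (cong (eval c x *ᶻ_) (trans (eval-ff (e +ᵖ k +ᵖ (-1ℤ ∷ [])) (length cs) x)
    (cong₂ ff (trans (eval-pred (e +ᵖ k) x) (cong (_-ᶻ 1ℤ) (eval-+ e k x))) (sym (length-map (λ c → eval c x) cs))))))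
  (trans (eval-* k _ x) (cong (eval k x *ᶻ_)
    (trans (eval-numer cs e (k +ᵖ (-1ℤ ∷ [])) x) (cong (numer (map (λ c → eval c x) cs) (eval e x)) (eval-pred k x))))))

nonpositive : ℤ → Bool
nonpositive (+ zero) = true
nonpositive (+ suc _) = false
nonpositive (-[1+ _ ]) = true

negative : ℤ → Bool
negative (+ _) = false
negative (-[1+ _ ]) = true

allNonpositive allNegative : List ℤ → Bool
allNonpositive [] = true
allNonpositive (a ∷ p) = nonpositive a ∧ allNonpositive p
allNegative [] = false
allNegative (a ∷ p) = negative a ∧ allNonpositive p

nonpositive-≤ : ∀ a → nonpositive a ≡ true → a ℤ.≤ 0ℤ
nonpositive-≤ (+ zero) _ = ℤ.≤-refl
nonpositive-≤ (-[1+ _ ]) _ = ℤ.-≤+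

negative-< : ∀ a → negative a ≡ true → a ℤ.< 0ℤ
negative-< (-[1+ _ ]) _ = ℤ.-<+

∧-true : ∀ {a b} → a ∧ b ≡ true → a ≡ true × b ≡ true
∧-true {true} {true} _ = refl , refl

eval-nonpositive : ∀ p → allNonpositive p ≡ true → ∀ x → eval p (+ x) ℤ.≤ 0ℤ
eval-nonpositive [] _ x = ℤ.≤-refl
eval-nonpositive (a ∷ p) h x with ∧-true {nonpositive a} h
... | ha , hp = ℤ.+-mono-≤ (nonpositive-≤ a ha)
  (subst (+ x *ᶻ eval p (+ x) ℤ.≤_) (ℤ.*-zeroʳ (+ x)) (ℤ.*-monoˡ-≤-nonNeg (+ x) (eval-nonpositive p hp x)))

eval-negative : ∀ p → allNegative p ≡ true → ∀ x → eval p (+ x) ℤ.< 0ℤ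
eval-negative (a ∷ p) h x with ∧-true {negative a} h
... | ha , hp = ℤ.+-mono-<-≤ (negative-< a ha)
  (subst (+ x *ᶻ eval p (+ x) ℤ.≤_) (ℤ.*-zeroʳ (+ x)) (ℤ.*-monoˡ-≤-nonNeg (+ x) (eval-nonpositive p hp x)))

polyᵖ : ∀ p q → poly (p +ᵖ q) ≈ poly p +ˢ poly q
polyᵖ [] q = symˢ (≈.+-identityˡ (poly q))
polyᵖ (a ∷ p) [] = symˢ (≈.+-identityʳ (poly (a ∷ p)))
polyᵖ (a ∷ p) (b ∷ q) = ≈.+-cong {κ (a +ᶻ b)} {κ a +ˢ κ b} (λ { zero → refl ; (suc k) → refl }) (*ˢ-cong {X} reflˢ (polyᵖ p q))
  ⟫ solve 5 (λ a b x p q → a :+ b :+ x :* (p :+ q) := a :+ x :* p :+ (b :+ x :* q)) reflˢ (κ a) (κ b) X (poly p) (poly q)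

poly-· : ∀ a q → poly (a ·ᵖ q) ≈ κ a *ˢ poly q
poly-· a [] = symˢ (≈.zeroʳ (κ a))
poly-· a (b ∷ q) = ≈.+-cong (κ-homo a b) (*ˢ-cong {X} reflˢ (poly-· a q))
  ⟫ solve 4 (λ a b x q → a :* b :+ x :* (a :* q) := a :* (b :+ x :* q)) reflˢ (κ a) (κ b) X (poly q)

poly-*ᵖ : ∀ p q → poly (p *ᵖ q) ≈ poly p *ˢ poly q
poly-*ᵖ [] q = symˢ (≈.zeroˡ (poly q))
poly-*ᵖ (a ∷ p) q = polyᵖ (a ·ᵖ q) (0ℤ ∷ p *ᵖ q) ⟫ ≈.+-cong (poly-· a q)
  (≈.+-cong κ0 (*ˢ-cong {X} reflˢ (poly-*ᵖ p q)) ⟫ ≈.+-identityˡ _)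
  ⟫ solve 4 (λ a x p q → a :* q :+ x :* (p :* q) := (a :+ x :* p) :* q) reflˢ (κ a) X (poly p) (poly q)

-- The residue kernels as finite convolutions, and the sign of A_(d+4)

Fᵖ Pᵖ 1-Xᵖ : List ℤ
Fᵖ = 1ℤ ∷ + 14 ∷ 1ℤ ∷ []
Pᵖ = 1ℤ ∷ -[1+ 32 ] ∷ -[1+ 32 ] ∷ 1ℤ ∷ []
1-Xᵖ = 1ℤ ∷ -1ℤ ∷ []

infixr 8 _^ᵖ_
_^ᵖ_ : List ℤ → ℕ → List ℤ
p ^ᵖ zero = 1ℤ ∷ []
p ^ᵖ suc k = p *ᵖ p ^ᵖ k

poly-^ᵖ : ∀ p k → poly (p ^ᵖ k) ≈ poly p ^ˢ k
poly-^ᵖ p zero = ≈.+-cong (reflˢ {1ˢ}) (≈.zeroʳ X) ⟫ ≈.+-identityʳ 1ˢ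
poly-^ᵖ p (suc k) = poly-*ᵖ p (p ^ᵖ k) ⟫ *ˢ-cong {poly p} reflˢ (poly-^ᵖ p k)

poly-single : ∀ a → poly (a ∷ []) ≈ κ a
poly-single a = ≈.+-cong (reflˢ {κ a}) (≈.zeroʳ X) ⟫ ≈.+-identityʳ (κ a)

poly-snoc : ∀ a p f → poly p ≈ f → poly (a ∷ p) ≈ κ a +ˢ X *ˢ f
poly-snoc a p f e = ≈.+-cong (reflˢ {κ a}) (*ˢ-cong {X} reflˢ e)

poly-F : poly Fᵖ ≈ F
poly-F = poly-snoc 1ℤ (+ 14 ∷ 1ℤ ∷ []) _ (poly-snoc (+ 14) (1ℤ ∷ []) _ (poly-single 1ℤ))
  ⟫ solve 1 (λ x → con 1ℤ :+ x :* (con (+ 14) :+ x :* con 1ℤ) := con 1ℤ :+ con (+ 14) :* x :+ x :* x) reflˢ X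

poly-P : poly Pᵖ ≈ Pˢ
poly-P = poly-snoc 1ℤ (-[1+ 32 ] ∷ -[1+ 32 ] ∷ 1ℤ ∷ []) _
  (poly-snoc -[1+ 32 ] (-[1+ 32 ] ∷ 1ℤ ∷ []) _ (poly-snoc -[1+ 32 ] (1ℤ ∷ []) _ (poly-single 1ℤ)))
  ⟫ solve 1 (λ x → con 1ℤ :+ x :* (con -[1+ 32 ] :+ x :* (con -[1+ 32 ] :+ x :* con 1ℤ))
      := con 1ℤ :+ con -[1+ 32 ] :* x :+ con -[1+ 32 ] :* (x :* x) :+ x :* (x :* x)) reflˢ X

poly-1-X : poly 1-Xᵖ ≈ 1-X
poly-1-X = poly-snoc 1ℤ (-1ℤ ∷ []) _ (poly-single -1ℤ) ⟫ solve 1 (λ x → con 1ℤ :+ x :* con -1ℤ := con 1ℤ :+ :- x) reflˢ X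

N⁴^ : ∀ m → N⁴ ^ˢ m ≈ N ^ˢ (m * 4)
N⁴^ m = symˢ (^ˢ-*4 N m)

kernelᵖ : ℕ → List ℤ
kernelᵖ r = Fᵖ ^ᵖ r *ᵖ Pᵖ

poly-kernel : ∀ r → poly (kernelᵖ r) ≈ F ^ˢ r *ˢ Pˢ
poly-kernel r = poly-*ᵖ (Fᵖ ^ᵖ r) Pᵖ ⟫ *ˢ-cong (poly-^ᵖ Fᵖ r ⟫ ^ˢ-cong poly-F r) poly-P

kernel-conv : ∀ r m k → kernel r m k ≡ conv (kernelᵖ r) (N ^ˢ (5 + m * 4)) k
kernel-conv r m k = trans (eq k) (poly-* (kernelᵖ r) (N ^ˢ (5 + m * 4)) k)
  where
  eq : kernel r m ≈ poly (kernelᵖ r) *ˢ N ^ˢ (5 + m * 4)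
  eq = *ˢ-cong {F ^ˢ r *ˢ (Pˢ *ˢ N⁵)} reflˢ (N⁴^ m)
    ⟫ solve 4 (λ f p n g → f :* (p :* (n :* (n :* n :* n :* n))) :* g := f :* p :*
      (n :* (n :* (n :* (n :* (n :* g)))))) reflˢ (F ^ˢ r) Pˢ N (N ^ˢ (m * 4))
    ⟫ *ˢ-cong {g = N ^ˢ (5 + m * 4)} (symˢ (poly-kernel r)) reflˢ

kernel₃-conv : ∀ r m k → (F³ *ˢ kernel r (suc m)) k ≡ conv (kernelᵖ (3 + r)) (N ^ˢ (9 + m * 4)) k
kernel₃-conv r m k = trans (solve 3 (λ f g h → f :* f :* f :* (g :* h) := f :* (f :* (f :* g)) :* h) reflˢ F
  (F ^ˢ r *ˢ (Pˢ *ˢ N⁵)) (N⁴ ^ˢ suc m) k)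
  (trans (*ˢ-cong {g = N⁴ ^ˢ suc m} (solve 3 (λ f g h → f :* (f :* (f :* (g :* h))) := f :* (f :* (f :* g)) :* h) reflˢ
    F (F ^ˢ r) (Pˢ *ˢ N⁵)) reflˢ k) (kernel-conv (3 + r) (suc m) k))

-- Multiplication by X (1-X)⁴ N⁴ = X brings this kernel to the power of N and the index that occur
-- in `kernel₃-conv`; the two terms of `second` can then be merged into one convolution.
kernel-shift : ∀ r m k → kernel r m k ≡ conv (0ℤ ∷ 1-Xᵖ ^ᵖ 4 *ᵖ kernelᵖ r) (N ^ˢ (9 + m * 4)) (suc k)
kernel-shift r m k = trans (sym (X*-suc (kernel r m) k))
  (trans (eq (suc k)) (poly-* (0ℤ ∷ 1-Xᵖ ^ᵖ 4 *ᵖ kernelᵖ r) (N ^ˢ (9 + m * 4)) (suc k)))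
  where
  h = N ^ˢ (m * 4)
  p = F ^ˢ r *ˢ Pˢ
  eq : X *ˢ kernel r m ≈ poly (0ℤ ∷ 1-Xᵖ ^ᵖ 4 *ᵖ kernelᵖ r) *ˢ N ^ˢ (9 + m * 4)
  eq = *ˢ-cong {X} reflˢ (*ˢ-cong {F ^ˢ r *ˢ (Pˢ *ˢ N⁵)} reflˢ (N⁴^ m)
       ⟫ solve 4 (λ f p n g → f :* (p :* (n :* (n :* n :* n :* n))) :* g := con 1ℤ :*
         (f :* p :* (n :* (n :* (n :* (n :* (n :* g))))))) reflˢ (F ^ˢ r) Pˢ N h
       ⟫ *ˢ-cong {g = p *ˢ N ^ˢ (5 + m * 4)} (symˢ four-inverse) reflˢ)
    ⟫ solve 5 (λ x q n p g → x :* ((q :* n) :* (q :* n) :* (q :* n) :* (q :* n) :* (p :* g)) := x :*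
      (q :* (q :* (q :* (q :* con 1ℤ))) :* p) :* (n :* (n :* (n :* (n :* g))))) reflˢ X 1-X N p (N ^ˢ (5 + m * 4))
    ⟫ *ˢ-cong {g = N ^ˢ (9 + m * 4)} (symˢ (≈.+-cong κ0
      (*ˢ-cong {X} reflˢ (poly-*ᵖ (1-Xᵖ ^ᵖ 4) (kernelᵖ r) ⟫ *ˢ-cong (poly-^ᵖ 1-Xᵖ 4 ⟫ ^ˢ-cong poly-1-X 4)
      (poly-kernel r))) ⟫ ≈.+-identityˡ _)) reflˢ
    where
    four-inverse : 1-X *ˢ N *ˢ (1-X *ˢ N) *ˢ (1-X *ˢ N) *ˢ (1-X *ˢ N) ≈ 1ˢ
    four-inverse = *ˢ-cong (*ˢ-cong (*ˢ-cong N-inverse N-inverse) N-inverse) N-inverse ⟫ solve 0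
      (con 1ℤ :* con 1ℤ :* con 1ℤ :* con 1ℤ := con 1ℤ) reflˢ

-- coefficientwise, b·c - a as a polynomial in the variable of c
mix : List ℤ → List ℤ → List ℤ → List (List ℤ)
mix c [] [] = []
mix c (a ∷ as) [] = (-ᶻ a ∷ []) ∷ mix c as []
mix c [] (b ∷ bs) = b ·ᵖ c ∷ mix c [] bs
mix c (a ∷ as) (b ∷ bs) = (-ᶻ a ∷ []) +ᵖ b ·ᵖ c ∷ mix c as bs

conv-mix : ∀ c x as bs s k → conv (map (λ p → eval p x) (mix c as bs)) s k ≡ eval c x *ᶻ conv bs s k -ᶻ conv as s k
conv-mix c x [] [] s k = sym (trans (cong (_-ᶻ 0ℤ) (ℤ.*-zeroʳ (eval c x))) refl)
conv-mix c x (a ∷ as) [] s zero = l (a) x (s 0) (eval c x)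
  where
  l : ∀ a x s c → (-ᶻ a +ᶻ x *ᶻ 0ℤ) *ᶻ s ≡ c *ᶻ 0ℤ -ᶻ a *ᶻ s
  l = solve-∀
conv-mix c x (a ∷ as) [] s (suc k) = trans (cong ((-ᶻ a +ᶻ x *ᶻ 0ℤ) *ᶻ s (suc k) +ᶻ_) (conv-mix c x as [] s k))
  (l a x (s (suc k)) (eval c x) (conv as s k))
  where
  l : ∀ a x s c t → (-ᶻ a +ᶻ x *ᶻ 0ℤ) *ᶻ s +ᶻ (c *ᶻ 0ℤ -ᶻ t) ≡ c *ᶻ 0ℤ -ᶻ (a *ᶻ s +ᶻ t)
  l = solve-∀
conv-mix c x [] (b ∷ bs) s zero = trans (cong (_*ᶻ s 0) (eval-· b c x)) (l b (eval c x) (s 0))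
  where
  l : ∀ b c s → b *ᶻ c *ᶻ s ≡ c *ᶻ (b *ᶻ s) -ᶻ 0ℤ
  l = solve-∀
conv-mix c x [] (b ∷ bs) s (suc k) = trans (cong₂ _+ᶻ_ (cong (_*ᶻ s (suc k)) (eval-· b c x)) (conv-mix c x [] bs s k))
  (l b (eval c x) (s (suc k)) (conv bs s k))
  where
  l : ∀ b c s t → b *ᶻ c *ᶻ s +ᶻ (c *ᶻ t -ᶻ 0ℤ) ≡ c *ᶻ (b *ᶻ s +ᶻ t) -ᶻ 0ℤ
  l = solve-∀
conv-mix c x (a ∷ as) (b ∷ bs) s zero = trans
  (cong (_*ᶻ s 0) (trans (eval-+ (-ᶻ a ∷ []) (b ·ᵖ c) x) (cong ((-ᶻ a +ᶻ x *ᶻ 0ℤ) +ᶻ_) (eval-· b c x))))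
  (l a x b (eval c x) (s 0))
  where
  l : ∀ a x b c s → (-ᶻ a +ᶻ x *ᶻ 0ℤ +ᶻ b *ᶻ c) *ᶻ s ≡ c *ᶻ (b *ᶻ s) -ᶻ a *ᶻ s
  l = solve-∀
conv-mix c x (a ∷ as) (b ∷ bs) s (suc k) = trans
  (cong₂ _+ᶻ_ (cong (_*ᶻ s (suc k)) (trans (eval-+ (-ᶻ a ∷ []) (b ·ᵖ c) x)
  (cong ((-ᶻ a +ᶻ x *ᶻ 0ℤ) +ᶻ_) (eval-· b c x)))) (conv-mix c x as bs s k))
  (l a x b (eval c x) (s (suc k)) (conv as s k) (conv bs s k))
  where
  l : ∀ a x b c s p q → (-ᶻ a +ᶻ x *ᶻ 0ℤ +ᶻ b *ᶻ c) *ᶻ s +ᶻ (c *ᶻ q -ᶻ p) ≡ c *ᶻ (b *ᶻ s +ᶻ q) -ᶻ (a *ᶻ s +ᶻ p)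
  l = solve-∀

ff-pos : ∀ k n → k ≤ n → Σ ℕ λ b → ff (+ n) k ≡ + suc b
ff-pos zero n _ = 0 , refl
ff-pos (suc k) (suc n) (s≤s le) with ff-pos k n le
... | b , e = b + n * suc b , trans (cong (+ suc n *ᶻ_) e) (sym (ℤ.pos-* (suc n) (suc b)))

linear : ∀ a b c x → + (a + (b + x) * c) ≡ eval (+ (a + b * c) ∷ + c ∷ []) (+ x)
linear a b c x = trans (cong +_ e) (trans (ℤ.pos-+ (a + b * c) (x * c))
  (cong (+ (a + b * c) +ᶻ_) (trans (ℤ.pos-* x c)
  (cong (+ x *ᶻ_) (sym (trans (cong (+ c +ᶻ_) (ℤ.*-zeroʳ (+ x))) (ℤ.+-identityʳ (+ c))))))))
  where
  e : a + (b + x) * c ≡ a + b * c + x * c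
  e = trans (cong (λ t → a + t) (ℕ.*-distribʳ-+ c b x)) (sym (ℕ.+-assoc a (b * c) (x * c)))

opaque
  second : ℕ → ℕ → ℤ
  second r m = -ᶻ ((F³ *ˢ kernel r (suc m)) (suc (suc m)) +ᶻ -ᶻ kernel r m (suc m) *ᶻ (F³ *ˢ kernel r (suc m)) 1)

  second-≡ : ∀ r m → second r m ≡ -ᶻ ((F³ *ˢ kernel r (suc m)) (suc (suc m)) +ᶻ -ᶻ kernel r m (suc m) *ᶻ
    (F³ *ˢ kernel r (suc m)) 1)
  second-≡ r m = refl

G₂-one : ∀ r m c₁ cs → kernelᵖ (3 + r) ≡ 1ℤ ∷ c₁ ∷ cs → (F³ *ˢ kernel r (suc m)) 1 ≡ + (9 + m * 4) +ᶻ c₁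
G₂-one r m c₁ cs e = trans (kernel₃-conv r m 1)
  (trans (cong (λ p → conv p s 1) e) (trans (cong₂ (λ a b → 1ℤ *ᶻ a +ᶻ c₁ *ᶻ b) s₁ s₀) (l (+ (9 + m * 4)) c₁)))
  where
  s = N ^ˢ (9 + m * 4)
  s₀ : s 0 ≡ 1ℤ
  s₀ = ^ˢ-zero N refl (9 + m * 4)
  s₁ : s 1 ≡ + (9 + m * 4)
  s₁ = trans (sym (ℤ.*-identityˡ (s 1))) (trans (hyper-N (9 + m * 4) 0)
    (trans (cong ((+ (9 + m * 4) +ᶻ 0ℤ) *ᶻ_) s₀) (trans (ℤ.*-identityʳ _) (ℤ.+-identityʳ _))))
  l : ∀ a c → 1ℤ *ᶻ a +ᶻ c *ᶻ 1ℤ ≡ a +ᶻ c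
  l = solve-∀

-- With m = m₀ + x the value is, up to positive factors, a polynomial in x whose constant term is
-- negative and whose other coefficients are at most 0. The bound on `length ds` keeps the falling
-- factorial of `conv-numer` positive.
second-negative : ∀ r m₀ c₁ cs d ds → kernelᵖ (3 + r) ≡ 1ℤ ∷ c₁ ∷ cs →
  let c = + (9 + m₀ * 4) +ᶻ c₁ ∷ + 4 ∷ [] in
  mix c (kernelᵖ (3 + r)) (0ℤ ∷ 1-Xᵖ ^ᵖ 4 *ᵖ kernelᵖ r) ≡ d ∷ ds →
  allNegative (numerᵖ (d ∷ ds) (+ (9 + m₀ * 4) ∷ + 4 ∷ []) (+ (2 + m₀ * 1) ∷ + 1 ∷ [])) ≡ true →
  length ds ≤ m₀ →
  ∀ x → second r (m₀ + x) ℤ.< 0ℤ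
second-negative r m₀ c₁ cs d ds e₁ e₂ neg len x = subst (ℤ._< 0ℤ) (sym second≡) conv-neg
  where
  m = m₀ + x
  s = N ^ˢ (9 + m * 4)
  c = + (9 + m₀ * 4) +ᶻ c₁ ∷ + 4 ∷ []
  as = kernelᵖ (3 + r)
  bs = 0ℤ ∷ 1-Xᵖ ^ᵖ 4 *ᵖ kernelᵖ r
  k = suc (suc m)
  ev : List ℤ → ℤ
  ev p = eval p (+ x)
  e≡ : + (9 + m * 4) ≡ ev (+ (9 + m₀ * 4) ∷ + 4 ∷ [])
  e≡ = linear 9 m₀ 4 x
  k≡ : + k ≡ ev (+ (2 + m₀ * 1) ∷ + 1 ∷ [])
  k≡ = trans (cong (λ t → + (2 + t)) (sym (ℕ.*-identityʳ m))) (linear 2 m₀ 1 x)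
  c≡ : + (9 + m * 4) +ᶻ c₁ ≡ ev c
  c≡ = trans (cong (_+ᶻ c₁) e≡) (l (+ (9 + m₀ * 4)) c₁ (+ x *ᶻ (+ 4 +ᶻ + x *ᶻ 0ℤ)))
    where
    l : ∀ a c t → a +ᶻ t +ᶻ c ≡ a +ᶻ c +ᶻ t
    l = solve-∀
  second≡ : second r m ≡ conv (map ev (d ∷ ds)) s k
  second≡ = trans (trans (second-≡ r m) (trans
    (cong (λ t → -ᶻ (t +ᶻ -ᶻ kernel r m (suc m) *ᶻ (F³ *ˢ kernel r (suc m)) 1)) (kernel₃-conv r m k))
      (cong₂ (λ a b → -ᶻ (conv as s k +ᶻ -ᶻ a *ᶻ b)) (kernel-shift r m (suc m)) (trans (G₂-one r m c₁ cs e₁) c≡))))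
    (trans (l (conv as s k) (conv bs s k) (ev c))
      (trans (sym (conv-mix c (+ x) as bs s k)) (cong (λ q → conv (map ev q) s k) e₂)))
    where
    l : ∀ a b c → -ᶻ (a +ᶻ -ᶻ b *ᶻ c) ≡ c *ᶻ b -ᶻ a
    l = solve-∀
  numer-neg : numer (map ev (d ∷ ds)) (+ (9 + m * 4)) (+ k) ℤ.< 0ℤ
  numer-neg = subst (ℤ._< 0ℤ) (trans (eval-numer (d ∷ ds) (+ (9 + m₀ * 4) ∷ + 4 ∷ []) (+ (2 + m₀ * 1) ∷ + 1 ∷ [])
    (+ x)) (cong₂ (numer (map ev (d ∷ ds))) (sym e≡) (sym k≡)))
    (eval-negative (numerᵖ (d ∷ ds) (+ (9 + m₀ * 4) ∷ + 4 ∷ []) (+ (2 + m₀ * 1) ∷ + 1 ∷ [])) neg x)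
  top : + (9 + m * 4) +ᶻ + k -ᶻ 1ℤ ≡ + (8 + m * 4 + k)
  top = trans (cong (_-ᶻ 1ℤ) (sym (ℤ.pos-+ (9 + m * 4) k))) refl
  len′ : length (map ev ds) ≤ 8 + m * 4 + k
  len′ = subst (_≤ 8 + m * 4 + k) (sym (length-map ev ds))
    (ℕ.≤-trans len (ℕ.≤-trans (ℕ.m≤m+n m₀ x) (ℕ.≤-trans (ℕ.m≤n+m m (8 + m * 4 + 2))
    (ℕ.≤-reflexive (ℕ.+-assoc (8 + m * 4) 2 m)))))
  main : ff (+ (9 + m * 4) +ᶻ + k -ᶻ 1ℤ) (length (map ev ds)) *ᶻ conv (map ev (d ∷ ds)) s k ≡ s k *ᶻ numer
    (map ev (d ∷ ds)) (+ (9 + m * 4)) (+ k)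
  main = conv-numer (+ (9 + m * 4)) s (hyper-N (9 + m * 4)) (ev d) (map ev ds) k
  conv-neg : conv (map ev (d ∷ ds)) s k ℤ.< 0ℤ
  conv-neg with ff-pos (length (map ev ds)) (8 + m * 4 + k) len′ | binom-pos (8 + m * 4) k
  ... | f , f≡ | b , b≡ = ℤ.*-cancelˡ-<-nonNeg {conv (map ev (d ∷ ds)) s k} {0ℤ} (+ suc f) (subst₂ ℤ._<_
      (trans (cong (_*ᶻ numer (map ev (d ∷ ds)) (+ (9 + m * 4)) (+ k)) (sym b≡))
        (trans (sym main) (cong (_*ᶻ conv (map ev (d ∷ ds)) s k)
        (trans (cong (λ t → ff t (length (map ev ds))) top) f≡))))
      (trans (ℤ.*-zeroʳ (+ suc b)) (sym (ℤ.*-zeroʳ (+ suc f)))) (ℤ.*-monoˡ-<-pos (+ suc b) numer-neg))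

-- 154, 159 and 164 are the least m for which A_(d+4) < 0 in the three residue classes.

second-negative₀ : ∀ x → second 2 (154 + x) ℤ.< 0ℤ
second-negative₀ = second-negative 2 154 _ _ _ _ refl refl refl (ℕ.m≤m+n 13 141)

second-negative₁ : ∀ x → second 1 (159 + x) ℤ.< 0ℤ
second-negative₁ = second-negative 1 159 _ _ _ _ refl refl refl (ℕ.m≤m+n 11 148)

second-negative₂ : ∀ x → second 0 (164 + x) ℤ.< 0ℤ
second-negative₂ = second-negative 0 164 _ _ _ _ refl refl refl (ℕ.m≤m+n 9 155)

-- The finite checks

binomSer : ℕ → ℕ → ℤ
binomSer e k = + binom e k

-- The values of `W-first` and `W-second`, through `binom` so that they can be computed.
first# second# : ℕ → ℕ → ℤ
first# r′ m = -ᶻ conv (kernelᵖ r′) (binomSer (5 + m * 4)) (suc m)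
second# r′ m = -ᶻ (conv (kernelᵖ (3 + r′)) s (suc (suc m)) +ᶻ first# r′ m *ᶻ conv (kernelᵖ (3 + r′)) s 1)
  where s = binomSer (9 + m * 4)

nondivisor : ℤ → ℤ → Bool
nondivisor b a = not (does (ℤ.∣ b ∣ ∣? ℤ.∣ a ∣))

below : (ℕ → Bool) → ℕ → Bool
below p zero = true
below p (suc k) = p k ∧ below p k

nonzero? : ℤ → Bool
nonzero? (+ zero) = false
nonzero? _ = true

positive? : ℤ → Bool
positive? (+ suc _) = true
positive? _ = false

opaque
  -- The product of I - 2i over s ≤ i < s + j, times (I)_k, expanded into falling factorials of I by
  -- I (I)_k = (I)_(k+1) + k (I)_k; `μ` gives the value of each falling factorial.
  evenProduct : ℕ → ℕ → ℕ → (ℕ → ℤ) → ℤ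
  evenProduct zero s k μ = μ k
  evenProduct (suc j) s k μ = evenProduct j (suc s) (suc k) μ +ᶻ (+ k -ᶻ + (2 * s)) *ᶻ evenProduct j (suc s) k μ

  evenProduct-zero : ∀ s k μ → evenProduct zero s k μ ≡ μ k
  evenProduct-zero s k μ = refl

  evenProduct-suc : ∀ j s k μ → evenProduct (suc j) s k μ ≡ evenProduct j (suc s) (suc k) μ +ᶻ (+ k -ᶻ + (2 * s)) *ᶻ
    evenProduct j (suc s) k μ
  evenProduct-suc j s k μ = refl

≤ᵇ-true : ∀ {a b} → (a ≤ᵇ b) ≡ true → a ≤ b
≤ᵇ-true {a} {b} h = ℕ.≤ᵇ⇒≤ a b (subst Bool.T (sym h) _)

below-true : ∀ p k → below p k ≡ true → ∀ i → i < k → p i ≡ true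
below-true p (suc k) h i (s≤s i≤k) with ∧-true {p k} h | ℕ.m≤n⇒m<n∨m≡n i≤k
... | _ , h′ | inj₁ lt = below-true p k h′ i lt
... | h′ , _ | inj₂ refl = h′

nondivisor-≢ : ∀ b a z → nondivisor b a ≡ true → a ≢ b *ᶻ z
nondivisor-≢ b a z h e with ℤ.∣ b ∣ ∣? ℤ.∣ a ∣
nondivisor-≢ b a z () e | yes _
... | no ¬d = ¬d (divides ℤ.∣ z ∣ (trans (cong ℤ.∣_∣ e) (trans (ℤ.∣i*j∣≡∣i∣*∣j∣ b z) (ℕ.*-comm ℤ.∣ b ∣ ℤ.∣ z ∣))))

nonzero-≢ : ∀ a → nonzero? a ≡ true → a ≢ 0ℤ
nonzero-≢ (+ suc a) _ ()
nonzero-≢ (-[1+ a ]) _ ()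

positive-≢ : ∀ a → positive? a ≡ true → a ≢ 0ℤ
positive-≢ (+ suc a) _ ()

-- The checks are opaque: with a variable m they must not be unfolded.
opaque
  -- the coefficients of Σ csᵢ Xⁱ · (1-X)ᵛ up to degree v do not vanish
  nonvanishing : List ℤ → ℕ → Bool
  nonvanishing cs v = (length cs ≤ᵇ suc v) ∧ below (λ k → nonzero? (numer cs (-ᶻ + v) (+ k))) (suc v)

  nonvanishing-elim : ∀ cs v → nonvanishing cs v ≡ true → length cs ≤ suc v × (∀ k → k ≤ v → numer cs (-ᶻ + v) (+ k) ≢ 0ℤ)
  nonvanishing-elim cs v h = ≤ᵇ-true (proj₁ (∧-true {length cs ≤ᵇ suc v} h)) ,
    λ k k≤v → nonzero-≢ _ (below-true (λ k → nonzero? (numer cs (-ᶻ + v) (+ k))) (suc v)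
      (proj₂ (∧-true {length cs ≤ᵇ suc v} h)) k (s≤s k≤v))

  secondPositive : ℕ → ℕ → Bool
  secondPositive r′ m = positive? (second# r′ m)

  secondPositive-elim : ∀ r′ m → secondPositive r′ m ≡ true → second# r′ m ≢ 0ℤ
  secondPositive-elim r′ m = positive-≢ (second# r′ m)

module Check (r r′ m : ℕ) where
  n d : ℕ
  n = (m * 6 + r * 2) * 4
  d = suc m * 4

  opaque
    -- The block number λ_t = A_d (d)_t / (n)_t of D_d is not an integer.
    blockFails : ℕ → Bool
    blockFails t = (2 * t ≤ᵇ n) ∧ nondivisor (ff (+ n) t) (first# r′ m *ᶻ ff (+ d) t)

    blockFails-elim : ∀ t → blockFails t ≡ true → 2 * t ≤ n × (∀ z → first# r′ m *ᶻ ff (+ d) t ≢ ff (+ n) t *ᶻ z)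
    blockFails-elim t h = ≤ᵇ-true (proj₁ (∧-true {2 * t ≤ᵇ n} h)) , λ z
      → nondivisor-≢ (ff (+ n) t) _ z (proj₂ (∧-true {2 * t ≤ᵇ n} h))

    -- The same for t + 1 points and the union of D_d with multiplicity n-d-t and D_(n-d) with
    -- multiplicity d-t; complementation gives A_(n-d) = A_d.
    unionFails : ℕ → Bool
    unionFails t = (2 * suc t ≤ᵇ n) ∧ nondivisor (ff (+ n) (suc t))
      (first# r′ m *ᶻ ((+ (n ∸ d) -ᶻ + t) *ᶻ ff (+ d) (suc t) +ᶻ (+ d -ᶻ + t) *ᶻ ff (+ (n ∸ d)) (suc t)))

    unionFails-elim : ∀ t → unionFails t ≡ true → 2 * suc t ≤ n × (∀ z →
      first# r′ m *ᶻ ((+ (n ∸ d) -ᶻ + t) *ᶻ ff (+ d) (suc t) +ᶻ (+ d -ᶻ + t) *ᶻ ff (+ (n ∸ d)) (suc t)) ≢ ff (+ n) (suc t) *ᶻ z)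
    unionFails-elim t h = ≤ᵇ-true (proj₁ (∧-true {2 * suc t ≤ᵇ n} h)) , λ z
      → nondivisor-≢ (ff (+ n) (suc t)) _ z (proj₂ (∧-true {2 * suc t ≤ᵇ n} h))

    -- 10321920 = 2⁸ · 8!
    evenFails : ℕ → Bool
    evenFails w = (16 ≤ᵇ n) ∧ nondivisor (+ 10321920 *ᶻ ff (+ n) 8)
      (evenProduct 8 0 0 (λ k → ff (+ w) k *ᶻ (first# r′ m *ᶻ ff (+ d) k *ᶻ ff (+ n -ᶻ + k) (8 ∸ k))))

    evenFails-elim : ∀ w → evenFails w ≡ true → 16 ≤ n × (∀ z →
      evenProduct 8 0 0 (λ k → ff (+ w) k *ᶻ (first# r′ m *ᶻ ff (+ d) k *ᶻ ff (+ n -ᶻ + k) (8 ∸ k))) ≢ + 10321920 *ᶻ ff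
        (+ n) 8 *ᶻ z)
    evenFails-elim w h = ≤ᵇ-true (proj₁ (∧-true {16 ≤ᵇ n} h)) , λ z
      → nondivisor-≢ (+ 10321920 *ᶻ ff (+ n) 8) _ z (proj₂ (∧-true {16 ≤ᵇ n} h))

  someBlockFails : ℕ → Bool
  someBlockFails zero = blockFails zero
  someBlockFails (suc t) = blockFails (suc t) ∨ someBlockFails t

Fˡ F²ˡ : List ℤ
Fˡ = Fᵖ
F²ˡ = Fᵖ *ᵖ Fᵖ

-- Either the strength reached by the jump already contradicts integrality. Or the next relevant
-- degree spreads from one weight to all, because the products of (1-X)ᵛ with F (or F²) have no zero
-- coefficient, and the stronger designs so obtained are impossible. The exponents d ∸ t are the v
-- of degree t.
check₀ check₁ check₂ : ℕ → Bool
check₀ m = someBlockFails 7 ∨ (nonvanishing Fˡ (d ∸ 8) ∧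
  (blockFails 8 ∨ (evenFails d ∨ (secondPositive 2 m ∧ evenFails (d + 4)))))
  where open Check 0 2 m
check₁ m = someBlockFails 5 ∨ (nonvanishing Fˡ (d ∸ 6) ∧ (blockFails 6 ∨ (nonvanishing F²ˡ (d ∸ 8) ∧ unionFails 7)))
  where open Check 1 1 m
check₂ m = someBlockFails 3 ∨ (nonvanishing Fˡ (d ∸ 4) ∧ (blockFails 4 ∨ (nonvanishing F²ˡ (d ∸ 6) ∧ unionFails 5)))
  where open Check 2 0 m

opaque
  unfolding evenProduct nonvanishing secondPositive Check.blockFails Check.unionFails Check.evenFails

  checked₀ : below (λ m → check₀ (suc m)) 153 ≡ true
  checked₀ = refl

  checked₁ : below check₁ 159 ≡ true
  checked₁ = refl

  checked₂ : below check₂ 164 ≡ true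
  checked₂ = refl

  -- The shortest lengths: λ₄ = 14 · (4)₄ / (8)₄ = 1/5 for n = 8, and λ₂ = 28 · (4)₂ / (16)₂ = 7/5
  -- for n = 16.
  blockFails-1 : Check.blockFails 1 1 0 4 ≡ true
  blockFails-1 = refl

  blockFails-2 : Check.blockFails 2 0 0 2 ≡ true
  blockFails-2 = refl

-- Nonvanishing of the coefficients of F(1-X)ᵛ and F²(1-X)ᵛ

*-nonzero : ∀ a b → a ≢ 0ℤ → b ≢ 0ℤ → a *ᶻ b ≢ 0ℤ
*-nonzero a b na nb e = nb (cancelˡ a na e)

1-X^-nonzero : ∀ v k → k ≤ v → (1-X ^ˢ v) k ≢ 0ℤ
1-X^-nonzero v zero _ e = contradiction (trans (sym (^ˢ-zero 1-X refl v)) e) (λ ())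
1-X^-nonzero v (suc k) lt e = *-nonzero (-ᶻ + v +ᶻ + k) ((1-X ^ˢ v) k) ne (1-X^-nonzero v k (ℕ.<⇒≤ lt))
  (trans (sym (hyper-1-X v k)) (trans (cong (+ suc k *ᶻ_) e) (ℤ.*-zeroʳ (+ suc k))))
  where
  ne : -ᶻ + v +ᶻ + k ≢ 0ℤ
  ne z = ℕ.<⇒≢ lt (ℤ.+-injective (ℤ.i-j≡0⇒i≡j (+ k) (+ v) (trans (ℤ.+-comm (+ k) (-ᶻ + v)) z)))

conv-nonzero : ∀ c cs v k → k ≤ v → numer (c ∷ cs) (-ᶻ + v) (+ k) ≢ 0ℤ → conv (c ∷ cs) (1-X ^ˢ v) k ≢ 0ℤ
conv-nonzero c cs v k le ne e = *-nonzero ((1-X ^ˢ v) k) _ (1-X^-nonzero v k le) ne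
  (trans (sym (conv-numer (-ᶻ + v) (1-X ^ˢ v) (hyper-1-X v) c cs k))
    (trans (cong (ff (-ᶻ + v +ᶻ + k -ᶻ 1ℤ) (length cs) *ᶻ_) e) (ℤ.*-zeroʳ (ff (-ᶻ + v +ᶻ + k -ᶻ 1ℤ) (length cs)))))

-- The numerator criterion needs (1-X)ᵛ to have a nonzero coefficient at k, so it works for k ≤ v
-- only; the degrees above v follow by symmetry.
nonvanishing-all : ∀ c cs v → Palindrome (length cs + v) (conv (c ∷ cs) (1-X ^ˢ v)) → nonvanishing (c ∷ cs) v ≡ true →
  ∀ k → k ≤ length cs + v → conv (c ∷ cs) (1-X ^ˢ v) k ≢ 0ℤ
nonvanishing-all c cs v pal h k le = [ low , high ]′ (ℕ.≤-<-connex k v)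
  where
  q≤v : length cs ≤ v
  q≤v = ℕ.≤-pred (proj₁ (nonvanishing-elim (c ∷ cs) v h))
  low : ∀ {k} → k ≤ v → conv (c ∷ cs) (1-X ^ˢ v) k ≢ 0ℤ
  low {k} k≤v = conv-nonzero c cs v k k≤v (proj₂ (nonvanishing-elim (c ∷ cs) v h) k k≤v)
  high : v < k → conv (c ∷ cs) (1-X ^ˢ v) k ≢ 0ℤ
  high v<k e = low (ℕ.≤-trans (ℕ.∸-monoʳ-≤ (length cs + v) (ℕ.≤-trans q≤v (ℕ.<⇒≤ v<k))) (ℕ.≤-reflexive (ℕ.m+n∸m≡n (length cs) v)))
    (trans (sym (pal k (length cs + v ∸ k) (ℕ.m+[n∸m]≡n le))) e)

-- For odd exponents the coefficients would be antisymmetric. The exponents that occur are d - t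
-- with t even.
Even-power : ∀ w → Above (w * 2) (1-X ^ˢ (w * 2)) × Palindrome (w * 2) (1-X ^ˢ (w * 2))
Even-power zero = (λ { (suc i) _ → refl }) , λ { zero zero _ → refl }
Even-power (suc w) with Even-power w
... | a , p = Above-1-X (Above-1-X a) , pal-quadratic -[1+ 1 ]
  (solve 2 (λ x f → (con 1ℤ :+ :- x) :* ((con 1ℤ :+ :- x) :* f) := f :+ con -[1+ 1 ] :* (x :* f) :+ x :* (x :* f))
    reflˢ X (1-X ^ˢ (w * 2))) a p

Palindrome-≈ : ∀ {M V V′} → V ≈ V′ → Palindrome M V → Palindrome M V′
Palindrome-≈ p h i j e = trans (sym (p i)) (trans (h i j e) (p j))

F-pal : ∀ w → Palindrome (2 + w * 2) (conv Fˡ (1-X ^ˢ (w * 2)))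
F-pal w with Even-power w
... | a , p = Palindrome-≈ (*ˢ-cong {g = 1-X ^ˢ (w * 2)} (symˢ poly-F) reflˢ ⟫ poly-* Fˡ (1-X ^ˢ (w * 2)))
  (pal-quadratic (+ 14) (F-expand (1-X ^ˢ (w * 2))) a p)

F²-pal : ∀ w → Palindrome (4 + w * 2) (conv F²ˡ (1-X ^ˢ (w * 2)))
F²-pal w with Even-power w
... | a , p = Palindrome-≈ (symˢ (*ˢ-assoc F F V) ⟫ *ˢ-cong {g = V} (symˢ (poly-*ᵖ Fᵖ Fᵖ ⟫ *ˢ-cong poly-F poly-F))
  reflˢ ⟫ poly-* F²ˡ V)
  (pal-quadratic (+ 14) (F-expand (F *ˢ V)) (Above-F a) (pal-quadratic (+ 14) (F-expand V) a p))
  where V = 1-X ^ˢ (w * 2)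

nth : List ℤ → ℕ → ℤ
nth [] k = 0ℤ
nth (c ∷ cs) zero = c
nth (c ∷ cs) (suc k) = nth cs k

poly-nth : ∀ cs k → poly cs k ≡ nth cs k
poly-nth [] k = refl
poly-nth (c ∷ cs) zero = trans (cong (c +ᶻ_) (X*-zero (poly cs))) (ℤ.+-identityʳ c)
poly-nth (c ∷ cs) (suc k) = trans (ℤ.+-identityˡ _) (trans (X*-suc (poly cs) k) (poly-nth cs k))

Solves : ℕ → List ℤ → Set
Solves q cs = ∀ Q → (∀ i → q < i → Q i ≡ 0ℤ) → Gap (hform q Q) → ∀ i → Q i ≡ Q 0 *ᶻ nth cs i

solves₀ : Solves 0 (1ℤ ∷ [])
solves₀ Q z G zero = sym (ℤ.*-identityʳ (Q 0))
solves₀ Q z G (suc i) = trans (z (suc i) (s≤s z≤n)) (sym (ℤ.*-zeroʳ (Q 0)))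

solves₂ : Solves 2 Fˡ
solves₂ Q z G 0 = sym (ℤ.*-identityʳ (Q 0))
solves₂ Q z G 1 = trans (proj₁ (Form2.solution Q G)) (ℤ.*-comm (+ 14) (Q 0))
solves₂ Q z G 2 = trans (proj₂ (Form2.solution Q G)) (sym (ℤ.*-identityʳ (Q 0)))
solves₂ Q z G (suc (suc (suc i))) = trans (z (3 + i) (s≤s (s≤s (s≤s z≤n)))) (sym (ℤ.*-zeroʳ (Q 0)))

solves₄ : Solves 4 F²ˡ
solves₄ Q z G 0 = sym (ℤ.*-identityʳ (Q 0))
solves₄ Q z G 1 = trans (Form4.b28 Q G) (ℤ.*-comm (+ 28) (Q 0))
solves₄ Q z G 2 = trans (Form4.c198 Q G) (ℤ.*-comm (+ 198) (Q 0))
solves₄ Q z G 3 = trans (Form4.bd Q G) (trans (Form4.b28 Q G) (ℤ.*-comm (+ 28) (Q 0)))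
solves₄ Q z G 4 = trans (Form4.ae Q G) (sym (ℤ.*-identityʳ (Q 0)))
solves₄ Q z G (suc (suc (suc (suc (suc i))))) = trans (z (5 + i) (s≤s (s≤s (s≤s (s≤s (s≤s z≤n)))))) (sym (ℤ.*-zeroʳ (Q 0)))

-- Spreading from one weight to all weights

module Kills {n} (C : Code n) (lin : IsLinear C) (sd : IsSelfDual C) (de : IsDoublyEven C)
  (m L : ℕ) (n≡ : n ≡ (suc m + (L + suc m)) * 4)
  (minw : ∀ x → x ∈C C → 0 < ∣ x ∣ → suc m * 4 ≤ ∣ x ∣) where
  open Extremal C lin sd de m L n≡ minw
  open Incidence C lin sd using (Killed)

  wt : ℕ → ℕ
  wt i = (suc m + i) * 4

  KillsAt : ℕ → ℕ → Set
  KillsAt t i = Killed (λ x → δ x (wt i)) t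

  KillsAll : ℕ → Set
  KillsAll t = ∀ i → KillsAt t i

  kills-zero : ∀ t v → 1 ≤ t → t + v ≡ suc m * 4 → L < v → KillsAll t
  kills-zero t v t≥1 e lt i P u refl = coeffs-zero P u t≥1 v e lt i

  kills-below : ∀ t → t + L < suc m * 4 → ∀ k → 1 ≤ k → k ≤ t → KillsAll k
  kills-below t lt k k≥1 k≤t = kills-zero k (suc m * 4 ∸ k) k≥1 (ℕ.m+[n∸m]≡n (ℕ.≤-trans (ℕ.m≤m+n k L) (ℕ.<⇒≤ lt′)))
    (ℕ.+-cancelˡ-< k L _ (subst (k + L <_) (sym (ℕ.m+[n∸m]≡n (ℕ.≤-trans (ℕ.m≤m+n k L) (ℕ.<⇒≤ lt′)))) lt′))
    where
    lt′ : k + L < suc m * 4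
    lt′ = ℕ.≤-<-trans (ℕ.+-monoˡ-≤ L k≤t) lt

  kills-one : ∀ t v → 1 ≤ t → t + v ≡ suc m * 4 → v + 1 ≡ L → KillsAll t
  kills-one t v t≥1 e L≡ i P u refl = trans (e≈ i) (trans (*ˢ-cong {1-X ^ˢ v} reflˢ Q≈0 i) (≈.zeroʳ (1-X ^ˢ v) i))
    where
    open Shape (coeffs-shape P u t≥1 v e 1 L≡)
    sol = Form1.solution Q (coeffs-gap P u t≥1 v e 1 L≡)
    Q≈0 : Q ≈ 0ˢ
    Q≈0 0 = proj₁ sol
    Q≈0 1 = proj₂ sol
    Q≈0 (suc (suc i)) = Q-above (suc (suc i)) (s≤s (s≤s z≤n))

  -- For a fixed system of pairs the sums at the various weights are one number, `Q 0`, times a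
  -- fixed sequence without zeros; a single vanishing sum forces `Q 0` to be 0.
  kills-spread : ∀ q cs → Solves q cs → ∀ t v → 1 ≤ t → t + v ≡ suc m * 4 → v + q ≡ L →
    (∀ i → i ≤ L → conv cs (1-X ^ˢ v) i ≢ 0ℤ) → ∀ i → i ≤ L → KillsAt t i → KillsAll t
  kills-spread q cs sol t v t≥1 e L≡ nz i i≤L K j P u refl
    = trans (value j) (trans (cong (_*ᶻ conv cs (1-X ^ˢ v) j) Q₀) (ℤ.*-zeroˡ (conv cs (1-X ^ˢ v) j)))
    where
    open Shape (coeffs-shape P u t≥1 v e q L≡)
    Q≈ : Q ≈ κ (Q 0) *ˢ poly cs
    Q≈ k = trans (sol Q Q-above (coeffs-gap P u t≥1 v e q L≡) k)
      (sym (trans (κ-*ˢ (Q 0) (poly cs) k) (cong (Q 0 *ᶻ_) (poly-nth cs k))))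
    value : ∀ k → coeffs P k ≡ Q 0 *ᶻ conv cs (1-X ^ˢ v) k
    value k = trans (e≈ k) (trans (*ˢ-cong {1-X ^ˢ v} reflˢ Q≈ k)
      (trans (solve 3 (λ x a p → x :* (a :* p) := a :* (p :* x)) reflˢ (1-X ^ˢ v) (κ (Q 0)) (poly cs) k)
      (trans (κ-*ˢ (Q 0) (poly cs *ˢ 1-X ^ˢ v) k) (cong (Q 0 *ᶻ_) (poly-* cs (1-X ^ˢ v) k)))))
    Q₀ : Q 0 ≡ 0ℤ
    Q₀ = cancelˡ (conv cs (1-X ^ˢ v) i) (nz i i≤L)
      (trans (ℤ.*-comm (conv cs (1-X ^ˢ v) i) (Q 0)) (trans (sym (value i)) (K P u refl)))

  kills₀ : ∀ t v → 1 ≤ t → t + v ≡ suc m * 4 → v ≡ L → ∀ i → i ≤ L → KillsAt t i → KillsAll t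
  kills₀ t v t≥1 e refl = kills-spread 0 (1ℤ ∷ []) solves₀ t v t≥1 e (ℕ.+-identityʳ v) nz
    where
    nz : ∀ i → i ≤ v → conv (1ℤ ∷ []) (1-X ^ˢ v) i ≢ 0ℤ
    nz zero le z = 1-X^-nonzero v 0 le (trans (sym (ℤ.*-identityˡ _)) z)
    nz (suc i) le z = 1-X^-nonzero v (suc i) le
      (trans (sym (trans (ℤ.+-identityʳ (1ℤ *ᶻ (1-X ^ˢ v) (suc i))) (ℤ.*-identityˡ _))) z)

  kills₂ : ∀ t w → 1 ≤ t → t + w * 2 ≡ suc m * 4 → w * 2 + 2 ≡ L → nonvanishing Fˡ (w * 2) ≡ true → ∀ i → i ≤ L
    → KillsAt t i → KillsAll t
  kills₂ t w t≥1 e L≡ h = kills-spread 2 Fˡ solves₂ t (w * 2) t≥1 e L≡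
    (λ i le → nonvanishing-all _ _ (w * 2) (F-pal w) h i (subst (i ≤_) (trans (sym L≡) (ℕ.+-comm (w * 2) 2)) le))

  kills₄ : ∀ t w → 1 ≤ t → t + w * 2 ≡ suc m * 4 → w * 2 + 4 ≡ L → nonvanishing F²ˡ (w * 2) ≡ true → ∀ i → i ≤ L
    → KillsAt t i → KillsAll t
  kills₄ t w t≥1 e L≡ h = kills-spread 4 F²ˡ solves₄ t (w * 2) t≥1 e L≡
    (λ i le → nonvanishing-all _ _ (w * 2) (F²-pal w) h i (subst (i ≤_) (trans (sym L≡) (ℕ.+-comm (w * 2) 4)) le))

-- Parity of block intersections

∣∩∣-ΣFin : ∀ {n} (x c : Subset n) → ΣFin (λ i → ⟦ lookup x i ⟧ *ᶻ ⟦ lookup c i ⟧) ≡ + ∣ c ∩ x ∣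
∣∩∣-ΣFin [] [] = refl
∣∩∣-ΣFin (true ∷ x) (true ∷ c) = trans (cong (1ℤ +ᶻ_) (∣∩∣-ΣFin x c)) (sym (ℤ.pos-+ 1 ∣ c ∩ x ∣))
∣∩∣-ΣFin (true ∷ x) (false ∷ c) = trans (ℤ.+-identityˡ _) (∣∩∣-ΣFin x c)
∣∩∣-ΣFin (false ∷ x) (true ∷ c) = trans (ℤ.+-identityˡ _) (∣∩∣-ΣFin x c)
∣∩∣-ΣFin (false ∷ x) (false ∷ c) = trans (ℤ.+-identityˡ _) (∣∩∣-ΣFin x c)

power₂ : ℕ → ℤ
power₂ zero = 1ℤ
power₂ (suc k) = + 2 *ᶻ power₂ k

opaque
  halves : ℕ → ℕ → ℤ → ℤ
  halves zero s I = 1ℤ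
  halves (suc j) s I = (I -ᶻ + (2 * s)) *ᶻ halves j (suc s) I

  halves-zero : ∀ s I → halves zero s I ≡ 1ℤ
  halves-zero s I = refl

  halves-suc : ∀ j s I → halves (suc j) s I ≡ (I -ᶻ + (2 * s)) *ᶻ halves j (suc s) I
  halves-suc j s I = refl

halves-even : ∀ j s h → halves j s (+ 2 *ᶻ h) ≡ power₂ j *ᶻ ff (h -ᶻ + s) j
halves-even zero s h = halves-zero s (+ 2 *ᶻ h)
halves-even (suc j) s h = trans (halves-suc j s (+ 2 *ᶻ h))
  (trans (cong₂ (λ a b → (+ 2 *ᶻ h -ᶻ a) *ᶻ b) (ℤ.pos-* 2 s) (halves-even j (suc s) h))
  (trans (l h (+ s) (power₂ j) (ff (h -ᶻ + suc s) j))
    (cong (λ a → + 2 *ᶻ power₂ j *ᶻ ((h -ᶻ + s) *ᶻ ff a j)) (trans (cong (λ t → h -ᶻ t) (ℤ.pos-+ 1 s)) (l₂ h (+ s))))))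
  where
  l : ∀ h s p f → (+ 2 *ᶻ h -ᶻ + 2 *ᶻ s) *ᶻ (p *ᶻ f) ≡ + 2 *ᶻ p *ᶻ ((h -ᶻ s) *ᶻ f)
  l = solve-∀
  l₂ : ∀ h s → h -ᶻ (1ℤ +ᶻ s) ≡ h -ᶻ s -ᶻ 1ℤ
  l₂ = solve-∀

factorial : ℕ → ℤ
factorial zero = 1ℤ
factorial (suc k) = + suc k *ᶻ factorial k

Multiple : ℤ → ℤ → Set
Multiple k a = Σ ℤ λ z → a ≡ k *ᶻ z

factorial-ff : ∀ h k → Multiple (factorial k) (ff (+ h) k)
factorial-ff h zero = 1ℤ , refl
factorial-ff zero (suc k) = 0ℤ , trans (ℤ.*-zeroˡ (ff (0ℤ -ᶻ 1ℤ) k)) (sym (ℤ.*-zeroʳ (factorial (suc k))))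
factorial-ff (suc h) (suc k) with factorial-ff h (suc k) | factorial-ff h k
... | z , e | z′ , e′ = z +ᶻ z′ , (begin
  + suc h *ᶻ ff (+ h) k                          ≡⟨ cong (_*ᶻ ff (+ h) k) (ℤ.pos-+ 1 h) ⟩
  (1ℤ +ᶻ + h) *ᶻ ff (+ h) k                      ≡⟨ l₁ (+ h) (+ k) (ff (+ h) k) ⟩
  ff (+ h) k *ᶻ (+ h -ᶻ + k) +ᶻ (1ℤ +ᶻ + k) *ᶻ ff (+ h) k  ≡⟨ cong₂ (λ a b → a +ᶻ b *ᶻ ff (+ h) k)
    (trans (sym (ff-snoc (+ h) k)) e) (sym (ℤ.pos-+ 1 k)) ⟩
  factorial (suc k) *ᶻ z +ᶻ + suc k *ᶻ ff (+ h) k  ≡⟨ cong (λ t → factorial (suc k) *ᶻ z +ᶻ + suc k *ᶻ t) e′ ⟩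
  factorial (suc k) *ᶻ z +ᶻ + suc k *ᶻ (factorial k *ᶻ z′)  ≡⟨ l₂ (+ suc k) (factorial k) z z′ ⟩
  factorial (suc k) *ᶻ (z +ᶻ z′) ∎)
  where
  open ≡-Reasoning
  l₁ : ∀ h k f → (1ℤ +ᶻ h) *ᶻ f ≡ f *ᶻ (h -ᶻ k) +ᶻ (1ℤ +ᶻ k) *ᶻ f
  l₁ = solve-∀
  l₂ : ∀ k f a b → k *ᶻ f *ᶻ a +ᶻ k *ᶻ (f *ᶻ b) ≡ k *ᶻ f *ᶻ (a +ᶻ b)
  l₂ = solve-∀

-- At I = 2h the product is 2^j times j consecutive integers, and these have a product divisible by
-- j!.
halves-multiple : ∀ j h → Multiple (power₂ j *ᶻ factorial j) (halves j 0 (+ 2 *ᶻ + h))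
halves-multiple j h with factorial-ff h j
... | z , e = z , trans (halves-even j 0 (+ h))
  (trans (cong (λ a → power₂ j *ᶻ ff a j) (ℤ.+-identityʳ (+ h)))
  (trans (cong (power₂ j *ᶻ_) e) (sym (ℤ.*-assoc (power₂ j) (factorial j) z))))

evenProduct-cong : ∀ j s k {μ ν : ℕ → ℤ} → (∀ i → i ≤ j + k → μ i ≡ ν i) → evenProduct j s k μ ≡ evenProduct j s k ν
evenProduct-cong zero s k p = trans (evenProduct-zero s k _) (trans (p k ℕ.≤-refl) (sym (evenProduct-zero s k _)))
evenProduct-cong (suc j) s k p = trans (evenProduct-suc j s k _) (trans (cong₂ (λ a b → a +ᶻ (+ k -ᶻ + (2 * s)) *ᶻ b)
  (evenProduct-cong j (suc s) (suc k) (λ i le → p i (subst (i ≤_) (ℕ.+-suc j k) le)))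
    (evenProduct-cong j (suc s) k (λ i le → p i (ℕ.m≤n⇒m≤1+n le)))) (sym (evenProduct-suc j s k _)))

evenProduct-* : ∀ j s k a μ → evenProduct j s k (λ i → a *ᶻ μ i) ≡ a *ᶻ evenProduct j s k μ
evenProduct-* zero s k a μ = trans (evenProduct-zero s k (λ i → a *ᶻ μ i)) (cong (a *ᶻ_) (sym (evenProduct-zero s k μ)))
evenProduct-* (suc j) s k a μ = trans (evenProduct-suc j s k (λ i → a *ᶻ μ i))
  (trans (cong₂ (λ x y → x +ᶻ (+ k -ᶻ + (2 * s)) *ᶻ y) (evenProduct-* j (suc s) (suc k) a μ)
  (evenProduct-* j (suc s) k a μ))
  (trans (l a (+ k -ᶻ + (2 * s)) (evenProduct j (suc s) (suc k) μ) (evenProduct j (suc s) k μ))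
    (cong (a *ᶻ_) (sym (evenProduct-suc j s k μ)))))
  where
  l : ∀ a b x y → a *ᶻ x +ᶻ b *ᶻ (a *ᶻ y) ≡ a *ᶻ (x +ᶻ b *ᶻ y)
  l = solve-∀

ff-+ : ∀ x a b → ff x (a + b) ≡ ff x a *ᶻ ff (x -ᶻ + a) b
ff-+ x zero b = sym (trans (ℤ.*-identityˡ _) (cong (λ y → ff y b) (ℤ.+-identityʳ x)))
ff-+ x (suc a) b = trans (cong (x *ᶻ_) (ff-+ (x -ᶻ 1ℤ) a b)) (trans (sym (ℤ.*-assoc x (ff (x -ᶻ 1ℤ) a) _))
  (cong (λ y → x *ᶻ ff (x -ᶻ 1ℤ) a *ᶻ ff y b) (trans (l x (+ a)) (cong (λ t → x -ᶻ t) (sym (ℤ.pos-+ 1 a))))))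
  where
  l : ∀ x a → x -ᶻ 1ℤ -ᶻ a ≡ x -ᶻ (1ℤ +ᶻ a)
  l = solve-∀

module Evenness {n} (C : Code n) (lin : IsLinear C) (sd : IsSelfDual C) (d : ℕ) where
  open SelfDual C lin sd
  open Incidence C lin sd
  open Designs C lin sd

  ΣC-multiple : ∀ k f → (∀ c → c ∈C C → Multiple k (f c)) → Multiple k (ΣC f)
  ΣC-multiple k f h = go (λ c → ⟦ C c ⟧ *ᶻ f c) pt
    where
    go : ∀ {n} (g : Subset n → ℤ) → (∀ c → Multiple k (g c)) → Multiple k (ΣW g)
    go {zero} g p = p []
    go {suc n} g p with go (g ∘ (true ∷_)) (p ∘ (true ∷_)) | go (g ∘ (false ∷_)) (p ∘ (false ∷_))
    ... | a , e | b , e′ = a +ᶻ b , trans (cong₂ _+ᶻ_ e e′) (sym (ℤ.*-distribˡ-+ k a b))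
    pt : ∀ c → Multiple k (⟦ C c ⟧ *ᶻ f c)
    pt c with C c in c∈
    ... | false = 0ℤ , trans (ℤ.*-zeroˡ (f c)) (sym (ℤ.*-zeroʳ k))
    ... | true with h c c∈
    ...   | z , e = z , trans (ℤ.*-identityˡ (f c)) e

  module _ (J : ℕ) (K : ∀ k → k ≤ J → ∀ R → length R ≡ k → Unique R → ff (+ n) k *ᶻ H (λ x → δ x d) [] R ≡ size d *ᶻ ff (+ d) k)
    (x : Subset n) (x∈ : x ∈C C) where

    -- The blocks of D_d through `R`, each weighted by a falling factorial of its intersection
    -- number with x. The shift l will be the size of `R`, which counts the points of x outside `R`.
    moment : ℕ → ℤ → List (Fin n) → ℤ
    moment j l R = ΣC (λ c → δ ∣ c ∣ d *ᶻ (ff (+ ∣ c ∩ x ∣ -ᶻ l) j *ᶻ inc R c))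

    moment-suc : ∀ j l R → moment (suc j) l R ≡ ΣFin (λ i → ⟦ lookup x i ⟧ *ᶻ moment j (l +ᶻ 1ℤ) (i ∷ R)) -ᶻ l *ᶻ
      moment j (l +ᶻ 1ℤ) R
    moment-suc j l R = sym (trans (cong₂ _+ᶻ_ first
      (trans (sym (ℤ.-1*i≡-i (l *ᶻ moment j (l +ᶻ 1ℤ) R)))
      (trans (sym (ℤ.*-assoc -1ℤ l (moment j (l +ᶻ 1ℤ) R))) (sym (ΣC-*ˡ (-1ℤ *ᶻ l) _)))))
      (trans (sym (ΣC-+ _ _)) (ΣC-cong (λ c _ → trans (l₁ (δ ∣ c ∣ d) (+ ∣ c ∩ x ∣) l (ff (+ ∣ c ∩ x ∣ -ᶻ (l +ᶻ 1ℤ)) j) (inc R c))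
        (cong (λ a → δ ∣ c ∣ d *ᶻ ((+ ∣ c ∩ x ∣ -ᶻ l) *ᶻ ff a j *ᶻ inc R c)) (l₂ (+ ∣ c ∩ x ∣) l))))))
      where
      g : Subset n → ℤ
      g c = δ ∣ c ∣ d *ᶻ (ff (+ ∣ c ∩ x ∣ -ᶻ (l +ᶻ 1ℤ)) j *ᶻ inc R c)
      l₀ : ∀ a d f b i → a *ᶻ (d *ᶻ (f *ᶻ (b *ᶻ i))) ≡ a *ᶻ b *ᶻ (d *ᶻ (f *ᶻ i))
      l₀ = solve-∀
      l₁ : ∀ d I l f i → I *ᶻ (d *ᶻ (f *ᶻ i)) +ᶻ -1ℤ *ᶻ l *ᶻ (d *ᶻ (f *ᶻ i)) ≡ d *ᶻ ((I -ᶻ l) *ᶻ f *ᶻ i)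
      l₁ = solve-∀
      l₂ : ∀ I l → I -ᶻ (l +ᶻ 1ℤ) ≡ I -ᶻ l -ᶻ 1ℤ
      l₂ = solve-∀
      first : ΣFin (λ i → ⟦ lookup x i ⟧ *ᶻ moment j (l +ᶻ 1ℤ) (i ∷ R)) ≡ ΣC (λ c → + ∣ c ∩ x ∣ *ᶻ g c)
      first = trans (ΣFin-cong (λ i → sym (ΣC-*ˡ ⟦ lookup x i ⟧
        (λ c → δ ∣ c ∣ d *ᶻ (ff (+ ∣ c ∩ x ∣ -ᶻ (l +ᶻ 1ℤ)) j *ᶻ inc (i ∷ R) c)))))
        (trans (ΣFin-ΣC (λ i c → ⟦ lookup x i ⟧ *ᶻ (δ ∣ c ∣ d *ᶻ (ff (+ ∣ c ∩ x ∣ -ᶻ (l +ᶻ 1ℤ)) j *ᶻ inc (i ∷ R) c))))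
        (ΣC-cong (λ c _ → trans (ΣFin-cong (λ i → l₀ ⟦ lookup x i ⟧ (δ ∣ c ∣ d) (ff (+ ∣ c ∩ x ∣ -ᶻ (l +ᶻ 1ℤ)) j) ⟦
          lookup c i ⟧ (inc R c)))
          (trans (ΣFin-*ʳ (λ i → ⟦ lookup x i ⟧ *ᶻ ⟦ lookup c i ⟧) (g c)) (cong (_*ᶻ g c) (∣∩∣-ΣFin x c))))))

    moment-own : ∀ j l R → ΣL (λ i → moment j l (i ∷ R)) R ≡ + length R *ᶻ moment j l R
    moment-own j l R = trans (ΣL-ΣC (λ i c → δ ∣ c ∣ d *ᶻ (ff (+ ∣ c ∩ x ∣ -ᶻ l) j *ᶻ inc (i ∷ R) c)) R)
      (trans (ΣC-cong pt) (ΣC-*ˡ (+ length R) (λ c → δ ∣ c ∣ d *ᶻ (ff (+ ∣ c ∩ x ∣ -ᶻ l) j *ᶻ inc R c))))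
      where
      l₁ : ∀ d f b i → d *ᶻ (f *ᶻ (b *ᶻ i)) ≡ b *ᶻ (d *ᶻ (f *ᶻ i))
      l₁ = solve-∀
      l₂ : ∀ s d f i → s *ᶻ (d *ᶻ (f *ᶻ i)) ≡ d *ᶻ (f *ᶻ (s *ᶻ i))
      l₂ = solve-∀
      pt : ∀ c → c ∈C C → ΣL (λ i → δ ∣ c ∣ d *ᶻ (ff (+ ∣ c ∩ x ∣ -ᶻ l) j *ᶻ inc (i ∷ R) c)) R ≡ + length R *ᶻ
        (δ ∣ c ∣ d *ᶻ (ff (+ ∣ c ∩ x ∣ -ᶻ l) j *ᶻ inc R c))
      pt c _ = trans (ΣL-cong (All.universal (λ i → l₁ D f ⟦ lookup c i ⟧ (inc R c)) R))
        (trans (ΣL-*ʳ (λ i → ⟦ lookup c i ⟧) (D *ᶻ (f *ᶻ inc R c)) R)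
        (trans (l₂ (ΣL (λ i → ⟦ lookup c i ⟧) R) D f (inc R c))
        (trans (cong (λ t → D *ᶻ (f *ᶻ t)) (inc-sum R c)) (sym (l₂ (+ length R) D f (inc R c))))))
        where
        D = δ ∣ c ∣ d
        f = ff (+ ∣ c ∩ x ∣ -ᶻ l) j

    -- Induction on j: writing |c ∩ x| as a sum over the points of x turns one factor into an extra
    -- point. Points outside `R` all give the same value by induction, those in `R` return the same
    -- moment, and the shift by |R| cancels the latter.
    moment-value : ∀ j R → length R + j ≤ J → Unique R → All (λ i → lookup x i ≡ true) R →
      ff (+ n) (length R + j) *ᶻ moment j (+ length R) R ≡ ff (+ ∣ x ∣ -ᶻ + length R) j *ᶻ (size d *ᶻ ff (+ d) (length R + j))
    moment-value zero R le u _ = trans (cong (ff (+ n) (length R + 0) *ᶻ_) (ΣC-cong (λ c _ → refl)))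
      (trans (K (length R + 0) le R (sym (ℕ.+-identityʳ (length R))) u) (sym (ℤ.*-identityˡ _)))
    moment-value (suc j) R le u sub = trans (cong (S *ᶻ_) (moment-suc j (+ k) R))
      (trans (l₁ S (ΣFin (λ i → ⟦ lookup x i ⟧ *ᶻ M (i ∷ R))) (+ k) (M R))
      (trans (cong (λ t → t -ᶻ + k *ᶻ (S *ᶻ M R)) total)
        (trans (l₂ (+ k) (S *ᶻ M R) V (+ ∣ x ∣)) (trans (sym (ℤ.*-assoc (+ ∣ x ∣ -ᶻ + k) w _))
        (cong (λ a → (+ ∣ x ∣ -ᶻ + k) *ᶻ a *ᶻ (size d *ᶻ ff (+ d) (k + suc j))) refl)))))
      where
      k = length R
      S = ff (+ n) (k + suc j)
      M : List (Fin n) → ℤ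
      M = moment j (+ k +ᶻ 1ℤ)
      w = ff (+ ∣ x ∣ -ᶻ + k -ᶻ 1ℤ) j
      V = w *ᶻ (size d *ᶻ ff (+ d) (k + suc j))
      l₁ : ∀ s f k m → s *ᶻ (f -ᶻ k *ᶻ m) ≡ s *ᶻ f -ᶻ k *ᶻ (s *ᶻ m)
      l₁ = solve-∀
      l₂ : ∀ k m v x → (k *ᶻ m -ᶻ k *ᶻ v +ᶻ x *ᶻ v) -ᶻ k *ᶻ m ≡ (x -ᶻ k) *ᶻ v
      l₂ = solve-∀
      each : ∀ i → All (i ≢_) R → lookup x i ≡ true → S *ᶻ M (i ∷ R) ≡ V
      each i ne xi = trans (cong₂ (λ a b → ff (+ n) a *ᶻ moment j b (i ∷ R)) (ℕ.+-suc k j)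
        (trans (ℤ.+-comm (+ k) 1ℤ) (sym (ℤ.pos-+ 1 k))))
        (trans (moment-value j (i ∷ R) (subst (_≤ J) (ℕ.+-suc k j) le) (ne ∷ u) (xi ∷ sub))
        (cong₂ (λ a b → ff a j *ᶻ (size d *ᶻ ff (+ d) b))
          (trans (cong (λ t → + ∣ x ∣ -ᶻ t) (ℤ.pos-+ 1 k)) (l (+ ∣ x ∣) (+ k))) (sym (ℕ.+-suc k j))))
        where
        l : ∀ x k → x -ᶻ (1ℤ +ᶻ k) ≡ x -ᶻ k -ᶻ 1ℤ
        l = solve-∀
      h : Fin n → ℤ
      h i = ⟦ lookup x i ⟧ *ᶻ (S *ᶻ M (i ∷ R) -ᶻ V)
      h-out : ∀ i → All (i ≢_) R → h i ≡ 0ℤ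
      h-out i ne with lookup x i in xi
      ... | false = ℤ.*-zeroˡ (S *ᶻ M (i ∷ R) -ᶻ V)
      ... | true = trans (ℤ.*-identityˡ _) (trans (cong (_-ᶻ V) (each i ne xi)) (ℤ.+-inverseʳ V))
      h-in : ΣL h R ≡ + k *ᶻ (S *ᶻ M R) -ᶻ + k *ᶻ V
      h-in = trans (ΣL-cong (All.map (λ {i} xi → trans (cong (λ b → ⟦ b ⟧ *ᶻ (S *ᶻ M (i ∷ R) -ᶻ V)) xi) (ℤ.*-identityˡ _)) sub))
        (trans (ΣL-shift (λ i → S *ᶻ M (i ∷ R)) V R)
          (cong (_-ᶻ + k *ᶻ V) (trans (ΣL-cong (All.universal (λ i → ℤ.*-comm S (M (i ∷ R))) R))
          (trans (ΣL-*ʳ (λ i → M (i ∷ R)) S R) (trans (cong (_*ᶻ S) (moment-own j (+ k +ᶻ 1ℤ) R)) (l (+ k) (M R) S))))))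
        where
        l : ∀ k m s → k *ᶻ m *ᶻ s ≡ k *ᶻ (s *ᶻ m)
        l = solve-∀
      total : S *ᶻ ΣFin (λ i → ⟦ lookup x i ⟧ *ᶻ M (i ∷ R)) ≡ + k *ᶻ (S *ᶻ M R) -ᶻ + k *ᶻ V +ᶻ + ∣ x ∣ *ᶻ V
      total = trans (ℤ.*-comm S _) (trans (sym (ΣFin-*ʳ (λ i → ⟦ lookup x i ⟧ *ᶻ M (i ∷ R)) S))
        (trans (ΣFin-cong (λ i → l ⟦ lookup x i ⟧ (M (i ∷ R)) S V))
        (trans (ΣFin-+ h (λ i → ⟦ lookup x i ⟧ *ᶻ V))
          (cong₂ _+ᶻ_ (trans (ΣFin-support h R u h-out) h-in)
          (trans (ΣFin-*ʳ (λ i → ⟦ lookup x i ⟧) V) (cong (_*ᶻ V) (∣∣-ΣFin x)))))))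
        where
        l : ∀ b m s v → b *ᶻ m *ᶻ s ≡ b *ᶻ (s *ᶻ m -ᶻ v) +ᶻ b *ᶻ v
        l = solve-∀
        ΣFin-+ : ∀ {n} (f g : Fin n → ℤ) → ΣFin (λ i → f i +ᶻ g i) ≡ ΣFin f +ᶻ ΣFin g
        ΣFin-+ {zero} f g = refl
        ΣFin-+ {suc n} f g = trans (cong (f zero +ᶻ g zero +ᶻ_) (ΣFin-+ (f ∘ suc) (g ∘ suc)))
          (+-interchange (f zero) (g zero) _ _)

    μ : ℕ → ℤ
    μ k = ΣC (λ c → δ ∣ c ∣ d *ᶻ ff (+ ∣ c ∩ x ∣) k)

    μ-value : ∀ k → k ≤ J → ff (+ n) J *ᶻ μ k ≡ ff (+ ∣ x ∣) k *ᶻ (size d *ᶻ ff (+ d) k *ᶻ ff (+ n -ᶻ + k) (J ∸ k))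
    μ-value k le = trans (cong (_*ᶻ μ k) (trans (cong (ff (+ n)) (sym (ℕ.m+[n∸m]≡n le))) (ff-+ (+ n) k (J ∸ k))))
      (trans (l₁ (ff (+ n) k) (ff (+ n -ᶻ + k) (J ∸ k)) (μ k))
        (trans (cong (_*ᶻ ff (+ n -ᶻ + k) (J ∸ k))
        (trans (cong (ff (+ n) k *ᶻ_) (ΣC-cong (λ c _ → l₂ (δ ∣ c ∣ d) (+ ∣ c ∩ x ∣))))
        (trans (moment-value k [] le [] []) (cong (λ a → ff a k *ᶻ (size d *ᶻ ff (+ d) k))
          (ℤ.+-identityʳ (+ ∣ x ∣)))))) (ℤ.*-assoc (ff (+ ∣ x ∣) k) (size d *ᶻ ff (+ d) k) _)))
      where
      l₁ : ∀ a b m → a *ᶻ b *ᶻ m ≡ a *ᶻ m *ᶻ b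
      l₁ = solve-∀
      l₂ : ∀ a I → a *ᶻ ff I k ≡ a *ᶻ (ff (I -ᶻ 0ℤ) k *ᶻ 1ℤ)
      l₂ a I = cong (a *ᶻ_) (sym (trans (ℤ.*-identityʳ _) (cong (λ t → ff t k) (ℤ.+-identityʳ I))))

    expand : ∀ j s k → ΣC (λ c → δ ∣ c ∣ d *ᶻ (halves j s (+ ∣ c ∩ x ∣) *ᶻ ff (+ ∣ c ∩ x ∣) k)) ≡ evenProduct j s k μ
    expand zero s k = trans (ΣC-cong (λ c _ → cong (δ ∣ c ∣ d *ᶻ_)
      (trans (cong (_*ᶻ ff (+ ∣ c ∩ x ∣) k) (halves-zero s (+ ∣ c ∩ x ∣))) (ℤ.*-identityˡ _))))
      (sym (evenProduct-zero s k μ))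
    expand (suc j) s k = trans (ΣC-cong (λ c _
      → trans (cong (λ t → δ ∣ c ∣ d *ᶻ (t *ᶻ ff (+ ∣ c ∩ x ∣) k)) (halves-suc j s (+ ∣ c ∩ x ∣)))
        (trans (l₁ (δ ∣ c ∣ d) (+ ∣ c ∩ x ∣) (+ (2 * s)) (+ k) (halves j (suc s) (+ ∣ c ∩ x ∣)) (ff (+ ∣ c ∩ x ∣) k))
        (cong (λ t → δ ∣ c ∣ d *ᶻ (halves j (suc s) (+ ∣ c ∩ x ∣) *ᶻ t) +ᶻ (+ k -ᶻ + (2 * s)) *ᶻ
          (δ ∣ c ∣ d *ᶻ (halves j (suc s) (+ ∣ c ∩ x ∣) *ᶻ ff (+ ∣ c ∩ x ∣) k))) (sym (ff-snoc (+ ∣ c ∩ x ∣) k))))))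
      (trans (ΣC-+ _ _) (trans (cong₂ _+ᶻ_ (expand j (suc s) (suc k))
        (trans (ΣC-*ˡ (+ k -ᶻ + (2 * s)) _) (cong ((+ k -ᶻ + (2 * s)) *ᶻ_) (expand j (suc s) k))))
        (sym (evenProduct-suc j s k μ))))
      where
      l₁ : ∀ d I s k h f → d *ᶻ ((I -ᶻ s) *ᶻ h *ᶻ f) ≡ d *ᶻ (h *ᶻ (f *ᶻ (I -ᶻ k))) +ᶻ (k -ᶻ s) *ᶻ (d *ᶻ (h *ᶻ f))
      l₁ = solve-∀

    evenFactor : ℤ
    evenFactor = power₂ J *ᶻ factorial J

    -- Codewords are orthogonal, so every |c ∩ x| is even and each block contributes a multiple of
    -- 2^J J!.
    even-multiple : Multiple evenFactor (evenProduct J 0 0 μ)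
    even-multiple = subst (Multiple evenFactor) (expand J 0 0) (ΣC-multiple evenFactor _ pt)
      where
      pt : ∀ c → c ∈C C → Multiple evenFactor (δ ∣ c ∣ d *ᶻ (halves J 0 (+ ∣ c ∩ x ∣) *ᶻ 1ℤ))
      pt c c∈ with Equivalence.to (sd c) c∈ x x∈
      ... | divides h e with halves-multiple J h
      ...   | z , e′ = δ ∣ c ∣ d *ᶻ z , trans (cong (λ t → δ ∣ c ∣ d *ᶻ (t *ᶻ 1ℤ))
        (trans (cong (halves J 0) (trans (cong +_ e) (trans (ℤ.pos-* h 2) (ℤ.*-comm (+ h) (+ 2))))) e′))
        (l (δ ∣ c ∣ d) evenFactor z)
        where
        l : ∀ d k z → d *ᶻ (k *ᶻ z *ᶻ 1ℤ) ≡ k *ᶻ (d *ᶻ z)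
        l = solve-∀

    even-value : Σ ℤ λ z → evenProduct J 0 0 (λ k
      → ff (+ ∣ x ∣) k *ᶻ (size d *ᶻ ff (+ d) k *ᶻ ff (+ n -ᶻ + k) (J ∸ k))) ≡ evenFactor *ᶻ ff (+ n) J *ᶻ z
    even-value = proj₁ even-multiple ,
      trans (evenProduct-cong J 0 0 (λ k le → sym (μ-value k (subst (k ≤_) (ℕ.+-identityʳ J) le))))
      (trans (evenProduct-* J 0 0 (ff (+ n) J) μ)
        (trans (cong (ff (+ n) J *ᶻ_) (proj₂ even-multiple)) (l (ff (+ n) J) evenFactor (proj₁ even-multiple))))
      where
      l : ∀ a k z → a *ᶻ (k *ᶻ z) ≡ k *ᶻ a *ᶻ z
      l = solve-∀

    even-value′ : ∀ {N a w s} → n ≡ N → size d ≡ a → ∣ x ∣ ≡ w → evenFactor ≡ s →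
      Σ ℤ λ z → evenProduct J 0 0 (λ k → ff (+ w) k *ᶻ (a *ᶻ ff (+ d) k *ᶻ ff (+ N -ᶻ + k) (J ∸ k))) ≡ s *ᶻ ff (+ N) J *ᶻ z
    even-value′ refl refl refl refl = even-value

conv-cong : ∀ cs {s s′ : Ser} → (∀ k → s k ≡ s′ k) → ∀ k → conv cs s k ≡ conv cs s′ k
conv-cong [] p k = refl
conv-cong (c ∷ cs) p zero = cong (c *ᶻ_) (p 0)
conv-cong (c ∷ cs) p (suc k) = cong₂ (λ a b → c *ᶻ a +ᶻ b) (p (suc k)) (conv-cong cs p k)

-- Complementary weights

sign : ℕ → ℤ
sign zero = 1ℤ
sign (suc k) = -ᶻ sign k

specht-comp : ∀ {n} (P : Pairs n) c → specht P (ones ⊕ c) ≡ sign (length P) *ᶻ specht P c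
specht-comp [] c = refl
specht-comp ((a , b) ∷ P) c rewrite lookup-ones⊕ c a | lookup-ones⊕ c b | ⟦not⟧ (lookup c a) (lookup c b) | specht-comp P c =
  l (⟦ lookup c a ⟧ -ᶻ ⟦ lookup c b ⟧) (sign (length P)) (specht P c)
  where
  l : ∀ x s d → -ᶻ x *ᶻ (s *ᶻ d) ≡ -ᶻ s *ᶻ (x *ᶻ d)
  l = solve-∀

-- Contradictions from integrality and parity

module Analysis {n} (C : Code n) (lin : IsLinear C) (sd : IsSelfDual C) (de : IsDoublyEven C)
  (m L r r′ : ℕ) (r+r′ : r + r′ ≡ 2) (n≡ : n ≡ (suc m + (L + suc m)) * 4) (M≡ : suc m + (L + suc m) ≡ m * 6 + r * 2)
  (L< : L < suc m * 4)
  (minw : ∀ x → x ∈C C → 0 < ∣ x ∣ → suc m * 4 ≤ ∣ x ∣) where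

  open WeightEnumerator C lin sd de m L r r′ r+r′ n≡ M≡ L< minw public
  open Incidence C lin sd public
  open Kills C lin sd de m L n≡ minw public
  open Check r r′ m renaming (n to n#; d to d#) public

  nn : n ≡ n#
  nn = trans n≡ (cong (_* 4) M≡)

  size-first : size (suc m * 4) ≡ first# r′ m
  size-first = trans (sym (W-size (suc m))) (trans W-first (cong -ᶻ_ (trans (kernel-conv r′ m (suc m))
    (conv-cong (kernelᵖ r′) (N^-binom (5 + m * 4)) (suc m)))))

  size-second : size (suc (suc m) * 4) ≡ second r′ m
  size-second = trans (sym (W-size (suc (suc m))))
    (trans W-second (trans (cong (λ a → -ᶻ (G₂ (suc (suc m)) +ᶻ a *ᶻ G₂ 1)) W-first) (sym (second-≡ r′ m))))

  size-second# : size (suc (suc m) * 4) ≡ second# r′ m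
  size-second# = trans (sym (W-size (suc (suc m)))) (trans W-second (cong₂ (λ a b → -ᶻ (a +ᶻ b))
    (trans (kernel₃-conv r′ m (suc (suc m))) (conv-cong (kernelᵖ (3 + r′)) bin (suc (suc m))))
    (cong₂ _*ᶻ_ (trans (W-size (suc m)) size-first) (trans (kernel₃-conv r′ m 1) (conv-cong (kernelᵖ (3 + r′)) bin 1)))))
    where
    bin : ∀ k → (N ^ˢ (9 + m * 4)) k ≡ binomSer (9 + m * 4) k
    bin = N^-binom (9 + m * 4)

  -- `second` is a number of codewords.
  second-nonneg : second r′ m ℤ.< 0ℤ → Empty
  second-nonneg lt = ℤ.<⇒≱ lt (subst (0ℤ ℤ.≤_) (trans (sym (size≡ (suc (suc m) * 4))) size-second) (ℤ.+≤+ z≤n))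

  size-witness : ∀ w → size w ≢ 0ℤ → Σ (Subset n) λ x → x ∈C C × ∣ x ∣ ≡ w
  size-witness w ne with anySubset? (λ x → (C x Bool.≟ true) ×-dec (∣ x ∣ ℕ.≟ w))
  ... | yes h = h
  ... | no none = contradiction (ΣC-zero (λ c c∈ → δ-≢ ∣ c ∣ w (λ e → none (c , c∈ , e)))) ne

  wt0 : wt 0 ≡ suc m * 4
  wt0 = cong (_* 4) (ℕ.+-identityʳ (suc m))

  at0 : ∀ {t} → KillsAll t → Killed (λ x → δ x (suc m * 4)) t
  at0 {t} K = subst (λ w → Killed (λ x → δ x w) t) wt0 (K 0)

  values : ∀ t → 2 * t ≤ n → (∀ i → 1 ≤ i → i ≤ t → KillsAll i) → ∀ k → k ≤ t → ∀ R → length R ≡ k → Unique R →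
    ff (+ n) k *ᶻ H (λ x → δ x (suc m * 4)) [] R ≡ size (suc m * 4) *ᶻ ff (+ (suc m * 4)) k
  values t le K k k≤t = Killed⇒value k (ℕ.≤-trans (ℕ.*-monoʳ-≤ 2 k≤t) le) (λ i i≥1 i≤k → at0 (K i i≥1 (ℕ.≤-trans i≤k k≤t)))

  block-contradiction : ∀ t → (∀ i → 1 ≤ i → i ≤ t → KillsAll i) → blockFails t ≡ true → Empty
  block-contradiction t K h = proj₂ (blockFails-elim t h) (H (λ x → δ x (suc m * 4)) [] (proj₁ R))
    (trans (cong (_*ᶻ ff (+ (suc m * 4)) t) (sym size-first))
      (trans (sym (values t le K t ℕ.≤-refl (proj₁ R) (proj₁ (proj₂ R)) (proj₂ (proj₂ R))))
      (cong (λ N → ff (+ N) t *ᶻ H (λ x → δ x (suc m * 4)) [] (proj₁ R)) nn)))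
    where
    le : 2 * t ≤ n
    le = subst (2 * t ≤_) (sym nn) (proj₁ (blockFails-elim t h))
    R = firstPoints {n} t (ℕ.≤-trans (ℕ.m≤n*m t 2) le)

  someBlock-contradiction : ∀ t → (∀ i → 1 ≤ i → i ≤ t → KillsAll i) → someBlockFails t ≡ true → Empty
  someBlock-contradiction zero K h = block-contradiction 0 K h
  someBlock-contradiction (suc t) K h with blockFails (suc t) in e
  ... | true = block-contradiction (suc t) K e
  ... | false = someBlock-contradiction t (λ i i≥1 i≤t → K i i≥1 (ℕ.m≤n⇒m≤1+n i≤t)) h

  even-contradiction : (∀ i → 1 ≤ i → i ≤ 8 → KillsAll i) → ∀ x → x ∈C C → ∀ w → ∣ x ∣ ≡ w → evenFails w ≡ true → Empty
  even-contradiction K x x∈ w e h = proj₂ (evenFails-elim w h) (proj₁ value) (proj₂ value)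
    where
    value = Evenness.even-value′ C lin sd (suc m * 4) 8
      (values 8 (subst (16 ≤_) (sym nn) (proj₁ (evenFails-elim w h))) K) x x∈ nn size-first e refl

  n∸d : n# ∸ suc m * 4 ≡ wt L
  n∸d = trans (cong (_∸ suc m * 4) (trans (sym nn) (trans n≡ (ℕ.*-distribʳ-+ 4 (suc m) (L + suc m)))))
    (trans (ℕ.m+n∸m≡n (suc m * 4) ((L + suc m) * 4))
    (cong (_* 4) (ℕ.+-comm L (suc m))))

  total : (suc m + L) + suc m ≡ M
  total = ℕ.+-assoc (suc m) L (suc m)

  -- In odd degree t the Specht sums at the weights d and n-d are opposite, so the weighted union
  -- (n-d-t) D_d + (d-t) D_{n-d} has no component of degree t.
  opposite : ∀ t → sign t ≡ -1ℤ → ∀ P → length P ≡ t →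
    ΣC (λ c → δ ∣ c ∣ (wt L) *ᶻ specht P c) ≡ -ᶻ ΣC (λ c → δ ∣ c ∣ (suc m * 4) *ᶻ specht P c)
  opposite t odd P e = trans (ΣC-⊕ ones∈ (λ c → δ ∣ c ∣ (wt L) *ᶻ specht P c))
    (trans (ΣC-cong (λ c _ → trans (cong₂ _*ᶻ_ (δ-comp (suc m + L) (suc m) total c)
      (trans (specht-comp P c) (cong (_*ᶻ specht P c) (trans (cong sign e) odd))))
      (l (δ ∣ c ∣ (suc m * 4)) (specht P c)))) (trans (ΣC-*ˡ -1ℤ (λ c → δ ∣ c ∣ (suc m * 4) *ᶻ specht P c)) (ℤ.-1*i≡-i _)))
    where
    l : ∀ a b → a *ᶻ (-1ℤ *ᶻ b) ≡ -1ℤ *ᶻ (a *ᶻ b)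
    l = solve-∀

  size-L : size (wt L) ≡ size (suc m * 4)
  size-L = trans (ΣC-⊕ ones∈ (λ c → δ ∣ c ∣ (wt L))) (ΣC-cong (λ c _ → δ-comp (suc m + L) (suc m) total c))

  -- The sums of degree t are not assumed to vanish at any weight: the multiplicities of the two
  -- designs are chosen so that this degree cancels when block numbers of t + 1 points are formed.
  module Union (t : ℕ) (odd : sign t ≡ -1ℤ) (K : ∀ i → 1 ≤ i → i ≤ suc t → i ≢ t → KillsAll i) where
    d₁ d₂ : ℕ
    d₁ = suc m * 4
    d₂ = wt L

    f : ℕ → ℤ
    f x = (+ d₂ -ᶻ + t) *ᶻ δ x d₁ +ᶻ (+ d₁ -ᶻ + t) *ᶻ δ x d₂

    split : ∀ (g : ℕ → ℤ) (h : Subset n → ℤ) → ΣC (λ c → f ∣ c ∣ *ᶻ g ∣ c ∣ *ᶻ h c) ≡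
      (+ d₂ -ᶻ + t) *ᶻ (g d₁ *ᶻ ΣC (λ c → δ ∣ c ∣ d₁ *ᶻ h c)) +ᶻ (+ d₁ -ᶻ + t) *ᶻ (g d₂ *ᶻ ΣC (λ c → δ ∣ c ∣ d₂ *ᶻ h c))
    split g h = trans (ΣC-cong (λ c _ → trans (l₁ (+ d₂ -ᶻ + t) (δ ∣ c ∣ d₁) (+ d₁ -ᶻ + t) (δ ∣ c ∣ d₂) (g ∣ c ∣) (h c))
        (cong₂ (λ a b → (+ d₂ -ᶻ + t) *ᶻ (a *ᶻ h c) +ᶻ (+ d₁ -ᶻ + t) *ᶻ (b *ᶻ h c))
          (trans (δ-subst ∣ c ∣ d₁ g) (ℤ.*-comm (δ ∣ c ∣ d₁) (g d₁)))
          (trans (δ-subst ∣ c ∣ d₂ g) (ℤ.*-comm (δ ∣ c ∣ d₂) (g d₂))))))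
      (trans (ΣC-+ _ _) (cong₂ _+ᶻ_ (part d₁ (+ d₂ -ᶻ + t)) (part d₂ (+ d₁ -ᶻ + t))))
      where
      l₁ : ∀ a p b q g h → (a *ᶻ p +ᶻ b *ᶻ q) *ᶻ g *ᶻ h ≡ a *ᶻ (p *ᶻ g *ᶻ h) +ᶻ b *ᶻ (q *ᶻ g *ᶻ h)
      l₁ = solve-∀
      part : ∀ w a → ΣC (λ c → a *ᶻ (g w *ᶻ δ ∣ c ∣ w *ᶻ h c)) ≡ a *ᶻ (g w *ᶻ ΣC (λ c → δ ∣ c ∣ w *ᶻ h c))
      part w a = trans (ΣC-*ˡ a _) (cong (a *ᶻ_) (trans (ΣC-cong (λ c _ → ℤ.*-assoc (g w) (δ ∣ c ∣ w) (h c))) (ΣC-*ˡ (g w) _)))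

    kills : ∀ i → 1 ≤ i → i ≤ suc t → Killed (ff-shift f i (suc t ∸ i)) i
    kills i i≥1 i≤ P u e = trans (split g (specht P)) (go (i ℕ.≟ t))
      where
      g : ℕ → ℤ
      g x = ff (+ x -ᶻ + i) (suc t ∸ i)
      e₁ = ΣC (λ c → δ ∣ c ∣ d₁ *ᶻ specht P c)
      e₂ = ΣC (λ c → δ ∣ c ∣ d₂ *ᶻ specht P c)
      go : Dec (i ≡ t) → (+ d₂ -ᶻ + t) *ᶻ (g d₁ *ᶻ e₁) +ᶻ (+ d₁ -ᶻ + t) *ᶻ (g d₂ *ᶻ e₂) ≡ 0ℤ
      go (no ne) = trans (cong₂ (λ a b → (+ d₂ -ᶻ + t) *ᶻ (g d₁ *ᶻ a) +ᶻ (+ d₁ -ᶻ + t) *ᶻ (g d₂ *ᶻ b))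
        (at0 (K i i≥1 i≤ ne) P u e) (K i i≥1 i≤ ne L P u e))
        (l (+ d₂ -ᶻ + t) (g d₁) (+ d₁ -ᶻ + t) (g d₂))
        where
        l : ∀ a b c d → a *ᶻ (b *ᶻ 0ℤ) +ᶻ c *ᶻ (d *ᶻ 0ℤ) ≡ 0ℤ
        l = solve-∀
      -- In degree t one factor w - t is left in `ff-shift`; with the multiplicities both weights
      -- carry (d₁-t)(d₂-t), against opposite Specht sums.
      go (yes refl) = trans (cong₂ (λ k b → (+ d₂ -ᶻ + t) *ᶻ (ff (+ d₁ -ᶻ + t) k *ᶻ e₁) +ᶻ (+ d₁ -ᶻ + t) *ᶻ
        (ff (+ d₂ -ᶻ + t) k *ᶻ b)) (ℕ.m+n∸n≡m 1 t) (opposite t odd P e))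
        (l (+ d₂ -ᶻ + t) (+ d₁ -ᶻ + t) e₁)
        where
        l : ∀ a b e → a *ᶻ (b *ᶻ 1ℤ *ᶻ e) +ᶻ b *ᶻ (a *ᶻ 1ℤ *ᶻ -ᶻ e) ≡ 0ℤ
        l = solve-∀

    contradictory : unionFails t ≡ true → Empty
    contradictory h = proj₂ (unionFails-elim t h) (H f [] (proj₁ R))
      (trans (cong₂ (λ a w → a *ᶻ ((+ w -ᶻ + t) *ᶻ ff (+ d₁) (suc t) +ᶻ (+ d₁ -ᶻ + t) *ᶻ ff (+ w) (suc t)))
      (sym size-first) n∸d)
        (trans (sym value) (trans (sym (H-value (suc t) f le kills (proj₁ R) (proj₁ (proj₂ R)) (proj₂ (proj₂ R))))
          (cong (λ N → ff (+ N) (suc t) *ᶻ H f [] (proj₁ R)) nn))))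
      where
      le : 2 * suc t ≤ n
      le = subst (2 * suc t ≤_) (sym nn) (proj₁ (unionFails-elim t h))
      R = firstPoints {n} (suc t) (ℕ.≤-trans (ℕ.m≤n*m (suc t) 2) le)
      g : ℕ → ℤ
      g x = ff (+ x) (suc t)
      value : ΣC (λ c → f ∣ c ∣ *ᶻ g ∣ c ∣) ≡ size d₁ *ᶻ ((+ d₂ -ᶻ + t) *ᶻ g d₁ +ᶻ (+ d₁ -ᶻ + t) *ᶻ g d₂)
      value = trans (ΣC-cong (λ c _ → sym (ℤ.*-identityʳ (f ∣ c ∣ *ᶻ g ∣ c ∣)))) (trans (split g (λ _ → 1ℤ))
        (trans (cong₂ (λ a b → (+ d₂ -ᶻ + t) *ᶻ (g d₁ *ᶻ a) +ᶻ (+ d₁ -ᶻ + t) *ᶻ (g d₂ *ᶻ b)) (one d₁)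
          (trans (one d₂) size-L)) (l (+ d₂ -ᶻ + t) (g d₁) (+ d₁ -ᶻ + t) (g d₂) (size d₁))))
        where
        one : ∀ w → ΣC (λ c → δ ∣ c ∣ w *ᶻ 1ℤ) ≡ size w
        one w = ΣC-cong (λ c _ → ℤ.*-identityʳ (δ ∣ c ∣ w))
        l : ∀ a b c d s → a *ᶻ (b *ᶻ s) +ᶻ c *ᶻ (d *ᶻ s) ≡ s *ᶻ (a *ᶻ b +ᶻ c *ᶻ d)
        l = solve-∀

-- Strengths

maximum : ∀ {Q : ℕ → Set} → (∀ t → Dec (Q t)) → ∀ lo e → Q lo → (∀ t → e + lo < t → ¬ Q t) →
  Σ ℕ λ s → lo ≤ s × s ≤ e + lo × Q s × (∀ t → Q t → t ≤ s)
maximum dec lo zero q above = lo , ℕ.≤-refl , ℕ.≤-refl , q , λ t qt → ℕ.≮⇒≥ (λ lt → above t lt qt)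
maximum dec lo (suc e) q above with dec (suc e + lo)
... | yes qh = suc e + lo , ℕ.m≤n+m lo (suc e) , ℕ.≤-refl , qh , λ t qt → ℕ.≮⇒≥ (λ lt → above t lt qt)
... | no ¬qh with maximum dec lo e q (λ t lt qt → skip t lt qt)
  where
  skip : ∀ t → e + lo < t → ¬ _
  skip t lt qt with ℕ.m≤n⇒m<n∨m≡n lt
  ... | inj₁ lt′ = above t lt′ qt
  ... | inj₂ refl = ¬qh qt
...   | s , l , u , qs , mx = s , l , ℕ.m≤n⇒m≤1+n u , qs , mx

module Conclude {n} (C : Code n) (lin : IsLinear C) (sd : IsSelfDual C) (de : IsDoublyEven C)
  (m L r r′ : ℕ) (r+r′ : r + r′ ≡ 2) (n≡ : n ≡ (suc m + (L + suc m)) * 4) (M≡ : suc m + (L + suc m) ≡ m * 6 + r * 2)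
  (L< : L < suc m * 4)
  (minw : ∀ x → x ∈C C → 0 < ∣ x ∣ → suc m * 4 ≤ ∣ x ∣) (dExt≡ : dExt n ≡ suc m * 4) where

  open Analysis C lin sd de m L r r′ r+r′ n≡ M≡ L< minw public

  designDec : ∀ w t → t ≤ n → Dec (IsDesignD C w t)
  designDec w t t≤n with firstPoints {n} t t≤n
  ... | R , e , u = map′ to from ((t ℕ.≤? w) ×-dec ¬?
    (anySubset? (λ T → (∣ T ∣ ℕ.≟ t) ×-dec ¬? (blocksThrough C w T ℕ.≟ blocksThrough C w T₀))))
    where
    T₀ = fromList R
    e₀ : ∣ T₀ ∣ ≡ t
    e₀ = trans (fromList-size R u) e
    to : _ → IsDesignD C w t
    to (le , none) = le , blocksThrough C w T₀ , λ T eT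
      → decidable-stable (blocksThrough C w T ℕ.≟ blocksThrough C w T₀) (λ ne → none (T , eT , ne))
    from : IsDesignD C w t → _
    from (le , lam , h) = le , λ { (T , eT , ne) → ne (trans (h T eT) (sym (h T₀ e₀))) }

  M-split : ∀ i → i ≤ L → wt i + suc m * 4 ≤ n
  M-split i le = subst (wt i + suc m * 4 ≤_) (sym n≡) (subst (_≤ M * 4) (ℕ.*-distribʳ-+ 4 (suc m + i) (suc m))
    (ℕ.*-monoˡ-≤ 4 (subst (_≤ M) (sym (ℕ.+-assoc (suc m) i (suc m))) (ℕ.+-monoʳ-≤ (suc m) (ℕ.+-monoˡ-≤ (suc m) le)))))

  wt≤n : ∀ i → i ≤ L → wt i ≤ n
  wt≤n i le = ℕ.≤-trans (ℕ.m≤m+n (wt i) (suc m * 4)) (M-split i le)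

  d≤wt : ∀ i → suc m * 4 ≤ wt i
  d≤wt i = ℕ.*-monoˡ-≤ 4 (ℕ.m≤m+n (suc m) i)

  admissible : ∀ i → i ≤ L → Admissible n (wt i)
  admissible i le = divides (suc m + i) refl , subst (_≤ wt i) (sym dExt≡) (d≤wt i) , subst (λ d → wt i + d ≤ n)
    (sym dExt≡) (M-split i le)

  index : ∀ w → Admissible n w → Σ ℕ λ i → i ≤ L × w ≡ wt i
  index w (divides a e , lo , hi) = a ∸ suc m , i≤L , trans e (cong (_* 4) (sym a≡))
    where
    m<a : suc m ≤ a
    m<a = ℕ.*-cancelʳ-≤ (suc m) a 4 (subst₂ _≤_ dExt≡ e lo)
    a≡ : suc m + (a ∸ suc m) ≡ a
    a≡ = ℕ.m+[n∸m]≡n m<a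
    up : a + suc m ≤ M
    up = ℕ.*-cancelʳ-≤ (a + suc m) M 4 (subst₂ _≤_ (trans (cong₂ _+_ e dExt≡) (sym (ℕ.*-distribʳ-+ 4 a (suc m)))) n≡ hi)
    i≤L : a ∸ suc m ≤ L
    i≤L = ℕ.+-cancelˡ-≤ (suc m) _ _ (subst (_≤ suc m + L) (sym a≡)
      (ℕ.+-cancelʳ-≤ (suc m) a (suc m + L) (subst (a + suc m ≤_) (sym (ℕ.+-assoc (suc m) L (suc m))) up)))

  design-kills : ∀ i → i ≤ L → ∀ {t} → IsDesignD C (wt i) t → ∀ k → 1 ≤ k → k ≤ t → KillsAt k i
  design-kills i i≤L {t} D k k≥1 k≤t = Const⇒Killed k≥1 (Const-below (t ∸ k) (subst (_≤ wt i) (sym t≡) (proj₁ D))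
    (ℕ.≤-trans (subst (_≤ wt i) (sym t≡) (proj₁ D)) (wt≤n i i≤L)) (subst (Const (wt i)) (sym t≡) (design⇒Const D)))
    where
    t≡ : t ∸ k + k ≡ t
    t≡ = ℕ.m∸n+n≡m k≤t

  kills-design : ∀ t → 2 * t ≤ n → t ≤ suc m * 4 → (∀ k → 1 ≤ k → k ≤ t → KillsAll k) → ∀ i → IsDesignD C (wt i) t
  kills-design t le t≤d K i = Const⇒design (ℕ.≤-trans t≤d (d≤wt i)) (ℕ.≤-trans (ℕ.m≤n*m t 2) le)
    (Killed⇒Const t le (λ k k≥1 k≤t → K k k≥1 k≤t i))

  someWeight everyWeight : ℕ → Set
  someWeight t = Σ ℕ λ w → Admissible n w × IsDesignD C w t
  everyWeight t = ∀ w → Admissible n w → IsDesignD C w t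

  someWeight≤ : ∀ {t} → someWeight t → t ≤ n
  someWeight≤ (w , adm , D) with index w adm
  ... | i , i≤L , refl = ℕ.≤-trans (proj₁ D) (wt≤n i i≤L)

  every⇒some : ∀ {t} → everyWeight t → someWeight t
  every⇒some E = wt 0 , admissible 0 z≤n , E (wt 0) (admissible 0 z≤n)

  some? : ∀ t → Dec (someWeight t)
  some? t with t ℕ.≤? n
  ... | no t≰n = no (λ s → t≰n (someWeight≤ s))
  ... | yes t≤n = map′ to from (ℕ.anyUpTo? (λ i → designDec (wt i) t t≤n) (suc L))
    where
    to : (Σ ℕ λ i → i < suc L × IsDesignD C (wt i) t) → someWeight t
    to (i , s≤s i≤L , D) = wt i , admissible i i≤L , D
    from : someWeight t → Σ ℕ λ i → i < suc L × IsDesignD C (wt i) t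
    from (w , adm , D) with index w adm
    ... | i , i≤L , refl = i , s≤s i≤L , D

  every? : ∀ t → Dec (everyWeight t)
  every? t with t ℕ.≤? n
  ... | no t≰n = no (λ E → t≰n (someWeight≤ (every⇒some E)))
  ... | yes t≤n = map′ to from (ℕ.allUpTo? (λ i → designDec (wt i) t t≤n) (suc L))
    where
    to : (∀ {i} → i < suc L → IsDesignD C (wt i) t) → everyWeight t
    to h w adm with index w adm
    ... | i , i≤L , refl = h (s≤s i≤L)
    from : everyWeight t → ∀ {i} → i < suc L → IsDesignD C (wt i) t
    from E {i} (s≤s i≤L) = E (wt i) (admissible i i≤L)

  -- The alternative is decided by whether D_d is a (T+1)-design. If not, degree T+1 vanishes at no
  -- admissible weight for all systems of pairs, by `spread`, so both strengths are T. If it is, all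
  -- weights have strength T+2 by `next`, and it remains to bound the strength by `cap`.
  conclude : ∀ T e →
    (∀ k → 1 ≤ k → k ≤ T → KillsAll k) →
    2 * suc T ≤ n → suc T ≤ suc m * 4 →
    (∀ i → i ≤ L → KillsAt (suc T) i → KillsAll (suc T)) →
    (KillsAll (suc T) → KillsAll (2 + T) × 2 * (2 + T) ≤ n × 2 + T ≤ suc m * 4) →
    (KillsAll (suc T) → ∀ i → i ≤ L → (∀ k → 1 ≤ k → k ≤ suc (e + (2 + T)) → KillsAt k i) → Empty) →
    Σ ℕ λ s → Σ ℕ λ δ → IsS C s × IsDelta C δ × ((δ ≡ T × s ≡ T) ⊎ (2 + T ≤ δ × δ ≤ s × s ≤ e + (2 + T)))
  conclude T e base le T<d spread next cap with designDec (wt 0) (suc T) (ℕ.≤-trans (ℕ.m≤n*m (suc T) 2) le)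
  ... | no ¬D = T , T , ((wt 0 , admissible 0 z≤n , baseDesign 0) , most) ,
        ((λ w adm → every w adm) , λ t E → most t (wt 0) (admissible 0 z≤n) (E (wt 0) (admissible 0 z≤n))) , inj₁ (refl , refl)
    where
    baseDesign : ∀ i → IsDesignD C (wt i) T
    baseDesign = kills-design T (ℕ.≤-trans (ℕ.*-monoʳ-≤ 2 (ℕ.n≤1+n T)) le) (ℕ.<⇒≤ T<d) base
    every : everyWeight T
    every w adm with index w adm
    ... | i , i≤L , refl = baseDesign i
    most : ∀ t w → Admissible n w → IsDesignD C w t → t ≤ T
    most t w adm D with index w adm
    ... | i , i≤L , refl = ℕ.≮⇒≥ λ T<t → ¬D (kills-design (suc T) le T<d (K T<t) 0)
      where
      K : T < t → ∀ k → 1 ≤ k → k ≤ suc T → KillsAll k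
      K T<t k k≥1 k≤ with ℕ.m≤n⇒m<n∨m≡n k≤
      ... | inj₁ (s≤s k≤T) = base k k≥1 k≤T
      ... | inj₂ refl = spread i i≤L (design-kills i i≤L D (suc T) (s≤s z≤n) T<t)
  ... | yes D = proj₁ S , proj₁ Δ′ ,
        (proj₁ (proj₂ (proj₂ (proj₂ S))) , λ t w adm D′ → proj₂ (proj₂ (proj₂ (proj₂ S))) t (w , adm , D′)) ,
        (proj₁ (proj₂ (proj₂ (proj₂ Δ′))) , proj₂ (proj₂ (proj₂ (proj₂ Δ′)))) ,
        inj₂ (proj₁ (proj₂ Δ′) , proj₂ (proj₂ (proj₂ (proj₂ S))) (proj₁ Δ′)
          (every⇒some (proj₁ (proj₂ (proj₂ (proj₂ Δ′))))) , proj₁ (proj₂ (proj₂ S)))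
    where
    K₁ : KillsAll (suc T)
    K₁ = spread 0 z≤n (design-kills 0 z≤n D (suc T) (s≤s z≤n) ℕ.≤-refl)
    K : ∀ k → 1 ≤ k → k ≤ 2 + T → KillsAll k
    K k k≥1 k≤ with ℕ.m≤n⇒m<n∨m≡n k≤
    ... | inj₂ refl = proj₁ (next K₁)
    ... | inj₁ (s≤s k≤T+1) with ℕ.m≤n⇒m<n∨m≡n k≤T+1
    ...   | inj₂ refl = K₁
    ...   | inj₁ (s≤s k≤T) = base k k≥1 k≤T
    every : everyWeight (2 + T)
    every w adm with index w adm
    ... | i , i≤L , refl = kills-design (2 + T) (proj₁ (proj₂ (next K₁))) (proj₂ (proj₂ (next K₁))) K i
    above : ∀ t → e + (2 + T) < t → ¬ someWeight t
    above t lt (w , adm , D′) with index w adm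
    ... | i , i≤L , refl = cap K₁ i i≤L (λ k k≥1 k≤ → design-kills i i≤L D′ k k≥1 (ℕ.≤-trans k≤ lt))
    S = maximum some? (2 + T) e (every⇒some every) above
    Δ′ = maximum every? (2 + T) e every (λ t lt E → above t lt (every⇒some E))

-- The three residue classes of n

∨-true : ∀ {a b} → a ∨ b ≡ true → a ≡ true ⊎ b ≡ true
∨-true {true} _ = inj₁ refl
∨-true {false} h = inj₂ h

dExt-24 : ∀ m s → s / 24 ≡ 0 → dExt (24 * m + s) ≡ suc m * 4
dExt-24 m s e = trans (cong (λ q → 4 * q + 4)
  (trans (+-distrib-/-∣ˡ s {24} (m∣m*n {24} m))
  (trans (cong₂ _+_ (trans (cong (_/ 24) (ℕ.*-comm 24 m)) (m*n/n≡m m 24)) e) (ℕ.+-identityʳ m))))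
  (trans (ℕ.+-comm (4 * m) 4) (cong (ℕ._+_ 4) (ℕ.*-comm 4 m)))

extend : ∀ {K : ℕ → Set} {t} → (∀ k → 1 ≤ k → k ≤ t → K k) → K (suc t) → ∀ k → 1 ≤ k → k ≤ suc t → K k
extend below top k k≥1 k≤ with ℕ.m≤n⇒m<n∨m≡n k≤
... | inj₁ (s≤s k≤t) = below k k≥1 k≤t
... | inj₂ refl = top

Conclusion : ∀ {n} → Code n → ℕ → ℕ → Set
Conclusion C T hi = Σ ℕ λ s → Σ ℕ λ δ → IsS C s × IsDelta C δ × ((δ ≡ T × s ≡ T) ⊎ (2 + T ≤ δ × δ ≤ s × s ≤ hi))

module Case₀ {n} (C : Code n) (des : IsDoublyEvenSelfDual C) (ext : IsExtremal C) (m : ℕ) (n≡ : n ≡ 24 * suc m + 0) where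
  private
    n≡′ : n ≡ (suc (suc m) + ((2 + m * 4) + suc (suc m))) * 4
    n≡′ = trans n≡ (l m)
      where
      l : ∀ m → 24 * suc m + 0 ≡ (suc (suc m) + ((2 + m * 4) + suc (suc m))) * 4
      l = ℕ-Solver.solve-∀
    M≡ : ∀ m → suc (suc m) + ((2 + m * 4) + suc (suc m)) ≡ suc m * 6 + 0 * 2
    M≡ = ℕ-Solver.solve-∀
    dExt≡ : dExt n ≡ suc (suc m) * 4
    dExt≡ = trans (cong dExt n≡) (dExt-24 (suc m) 0 refl)
  open Conclude C (proj₁ des) (proj₁ (proj₂ des)) (proj₂ (proj₂ des)) (suc m) (2 + m * 4) 0 2 refl n≡′ (M≡ m)
    (s≤s (s≤s (s≤s (ℕ.m≤n+m (m * 4) 5)))) (λ x x∈ pos → subst (_≤ ∣ x ∣) dExt≡ (proj₂ ext x x∈ pos)) dExt≡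

  w₂ : m * 2 * 2 ≡ m * 4
  w₂ = ℕ.*-assoc m 2 2

  kills≤5 : ∀ k → 1 ≤ k → k ≤ 5 → KillsAll k
  -- Here L = 4m + 2 and d = 4m + 8, so that 5 is the last degree with 5 + L < d.
  kills≤5 = kills-below 5 ℕ.≤-refl

  kills7 : KillsAll 7
  kills7 = kills-one 7 (1 + m * 4) (s≤s z≤n) refl (ℕ.+-comm (1 + m * 4) 1)

  module _ (kills6 : KillsAll 6) where
    kills≤7 : ∀ k → 1 ≤ k → k ≤ 7 → KillsAll k
    kills≤7 = extend (extend kills≤5 kills6) kills7

    no-8 : ∀ i → i ≤ 2 + m * 4 → KillsAt 8 i → check₀ (suc m) ≡ true → Empty
    no-8 i i≤L K h with ∨-true {someBlockFails 7} h
    ... | inj₁ h₁ = someBlock-contradiction 7 kills≤7 h₁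
    ... | inj₂ h₂ with ∧-true {nonvanishing Fˡ (m * 4)} h₂
    ...   | nv , h₃ = stage (∨-true {blockFails 8} h₃)
      where
      kills8 : KillsAll 8
      kills8 = kills₂ 8 (m * 2) (s≤s z≤n) (cong (ℕ._+_ 8) w₂) (trans (ℕ.+-comm (m * 2 * 2) 2) (cong (ℕ._+_ 2) w₂))
        (subst (λ v → nonvanishing Fˡ v ≡ true) (sym w₂) nv) i i≤L K
      kills≤8 : ∀ k → 1 ≤ k → k ≤ 8 → KillsAll k
      kills≤8 = extend kills≤7 kills8
      -- The parity of intersections is tested with a codeword of weight d, which exists by
      -- extremality, or with one of weight d + 4, which exists when A_(d+4) is not 0.
      even : ∀ w → (Σ (Subset n) λ x → (x ∈C C) × ∣ x ∣ ≡ w) → evenFails w ≡ true → Empty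
      even w (x , x∈ , e) = even-contradiction kills≤8 x x∈ w e
      stage : blockFails 8 ≡ true ⊎ _ → Empty
      stage (inj₁ b) = block-contradiction 8 kills≤8 b
      stage (inj₂ h₄) with ∨-true {evenFails (suc (suc m) * 4)} h₄
      ... | inj₁ ev = even (suc (suc m) * 4) (proj₁ (proj₁ ext) , proj₁ (proj₂ (proj₁ ext)) , trans
        (proj₂ (proj₂ (proj₁ ext))) dExt≡) ev
      ... | inj₂ h₅ with ∧-true {secondPositive 2 (suc m)} h₅
      ...   | pos , ev = even (suc (suc m) * 4 + 4)
        (subst (λ w → Σ (Subset n) λ x → (x ∈C C) × ∣ x ∣ ≡ w) (ℕ.+-comm 4 (suc (suc m) * 4))
                (size-witness (suc (suc (suc m)) * 4) (λ e → secondPositive-elim 2 (suc m) pos (trans (sym size-second#) e)))) ev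

    cap : ∀ i → i ≤ 2 + m * 4 → (∀ k → 1 ≤ k → k ≤ 8 → KillsAt k i) → Empty
    -- The length is 24(m+1), so this m is one less than the argument of `check₀` and of `second`;
    -- the bound 154 becomes 153.
    cap i i≤L K with m ℕ.<? 153
    ... | yes m<153 = no-8 i i≤L (K 8 (s≤s z≤n) ℕ.≤-refl) (below-true (λ m → check₀ (suc m)) 153 checked₀ m m<153)
    ... | no m≮153 = second-nonneg (subst (λ k → second 2 (suc k) ℤ.< 0ℤ) (ℕ.m+[n∸m]≡n (ℕ.≮⇒≥ m≮153))
      (second-negative₀ (m ∸ 153)))

  n≥14 : 14 ≤ n
  n≥14 = subst (14 ≤_) (sym n≡) (ℕ.≤-trans (ℕ.m≤m+n 14 10) (ℕ.≤-trans (ℕ.*-monoʳ-≤ 24 (s≤s (z≤n {m}))) (ℕ.m≤m+n (24 * suc m) 0)))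

  result : Conclusion C 5 7
  result = conclude 5 0 kills≤5 (ℕ.≤-trans (ℕ.m≤m+n 12 2) n≥14) (s≤s (s≤s (s≤s (s≤s (s≤s (s≤s z≤n))))))
    (λ i i≤L → kills₀ 6 (2 + m * 4) (s≤s z≤n) refl refl i i≤L)
    (λ _ → kills7 , n≥14 , s≤s (s≤s (s≤s (s≤s (s≤s (s≤s (s≤s z≤n)))))))
    cap

-- With d - L = 4, degree 4 has q = 0, degree 5 has q = 1, and the degrees 6 and 8 lead to F and F².
-- Degree 7 is bypassed by the union of D_d and D_(n-d), which is why the contradiction uses 8
-- points.
module Case₁ {n} (C : Code n) (des : IsDoublyEvenSelfDual C) (ext : IsExtremal C) (m : ℕ) (n≡ : n ≡ 24 * m + 8) where
  private
    n≡′ : n ≡ (suc m + (m * 4 + suc m)) * 4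
    n≡′ = trans n≡ (l m)
      where
      l : ∀ m → 24 * m + 8 ≡ (suc m + (m * 4 + suc m)) * 4
      l = ℕ-Solver.solve-∀
    M≡ : ∀ m → suc m + (m * 4 + suc m) ≡ m * 6 + 1 * 2
    M≡ = ℕ-Solver.solve-∀
    dExt≡ : dExt n ≡ suc m * 4
    dExt≡ = trans (cong dExt n≡) (dExt-24 m 8 refl)
  open Conclude C (proj₁ des) (proj₁ (proj₂ des)) (proj₂ (proj₂ des)) m (m * 4) 1 1 refl n≡′ (M≡ m)
    (s≤s (ℕ.m≤n+m (m * 4) 3)) (λ x x∈ pos → subst (_≤ ∣ x ∣) dExt≡ (proj₂ ext x x∈ pos)) dExt≡

  kills≤3 : ∀ k → 1 ≤ k → k ≤ 3 → KillsAll k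
  kills≤3 = kills-below 3 ℕ.≤-refl

  kills≤4 : KillsAll 4 → ∀ k → 1 ≤ k → k ≤ 4 → KillsAll k
  kills≤4 = extend kills≤3

  m≢0 : KillsAll 4 → m ≢ 0
  m≢0 K refl = block-contradiction 4 (kills≤4 K) blockFails-1

  kills5 : KillsAll 4 → KillsAll 5
  kills5 K = go m refl
    where
    go : ∀ k → m ≡ k → KillsAll 5
    go zero e = ⊥-elim (m≢0 K e)
    go (suc k) refl = kills-one 5 (3 + k * 4) (s≤s z≤n) refl (ℕ.+-comm (3 + k * 4) 1)

  module _ (kills4 : KillsAll 4) where
    kills≤5 : ∀ k → 1 ≤ k → k ≤ 5 → KillsAll k
    kills≤5 = extend (kills≤4 kills4) (kills5 kills4)

    no-8 : ∀ i → i ≤ m * 4 → KillsAt 6 i → KillsAt 8 i → check₁ m ≡ true → ∀ k → m ≡ suc k → Empty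
    no-8 i i≤L K₆ K₈ h k refl with ∨-true {someBlockFails 5} h
    ... | inj₁ h₁ = someBlock-contradiction 5 kills≤5 h₁
    ... | inj₂ h₂ with ∧-true {nonvanishing Fˡ (2 + k * 4)} h₂
    ...   | nv₆ , h₃ = stage (∨-true {blockFails 6} h₃)
      where
      w₂ : k * 2 * 2 ≡ k * 4
      w₂ = ℕ.*-assoc k 2 2
      kills6 : KillsAll 6
      kills6 = kills₂ 6 (1 + k * 2) (s≤s z≤n) (cong (ℕ._+_ 8) w₂)
        (trans (ℕ.+-comm (2 + k * 2 * 2) 2) (cong (ℕ._+_ 4) w₂))
        (subst (λ v → nonvanishing Fˡ (2 + v) ≡ true) (sym w₂) nv₆) i i≤L K₆
      kills≤6 : ∀ k → 1 ≤ k → k ≤ 6 → KillsAll k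
      kills≤6 = extend kills≤5 kills6
      stage : blockFails 6 ≡ true ⊎ _ → Empty
      stage (inj₁ b) = block-contradiction 6 kills≤6 b
      stage (inj₂ h₄) with ∧-true {nonvanishing F²ˡ (k * 4)} h₄
      ... | nv₈ , un = Union.contradictory 7 refl kills≢7 un
        where
        kills8 : KillsAll 8
        kills8 = kills₄ 8 (k * 2) (s≤s z≤n) (cong (ℕ._+_ 8) w₂) (trans (ℕ.+-comm (k * 2 * 2) 4) (cong (ℕ._+_ 4) w₂))
          (subst (λ v → nonvanishing F²ˡ v ≡ true) (sym w₂) nv₈) i i≤L K₈
        kills≢7 : ∀ j → 1 ≤ j → j ≤ 8 → j ≢ 7 → KillsAll j
        kills≢7 j j≥1 j≤ j≢7 with ℕ.m≤n⇒m<n∨m≡n j≤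
        ... | inj₂ refl = kills8
        ... | inj₁ (s≤s j≤7) with ℕ.m≤n⇒m<n∨m≡n j≤7
        ...   | inj₂ refl = contradiction refl j≢7
        ...   | inj₁ (s≤s j≤6) = kills≤6 j j≥1 j≤6

    cap : ∀ i → i ≤ m * 4 → (∀ k → 1 ≤ k → k ≤ 8 → KillsAt k i) → Empty
    cap i i≤L K with m ℕ.<? 159
    ... | yes m<159 = no-8 i i≤L (K 6 (s≤s z≤n) (ℕ.m≤m+n 6 2)) (K 8 (s≤s z≤n) ℕ.≤-refl)
      (below-true check₁ 159 checked₁ m m<159) (ℕ.pred m) (pos m refl)
      where
      pos : ∀ k → m ≡ k → m ≡ suc (ℕ.pred m)
      pos zero e = ⊥-elim (m≢0 kills4 e)
      pos (suc k) refl = refl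
    ... | no m≮159 = second-nonneg (subst (λ k → second 1 k ℤ.< 0ℤ) (ℕ.m+[n∸m]≡n (ℕ.≮⇒≥ m≮159)) (second-negative₁ (m ∸ 159)))

  result : Conclusion C 3 7
  result = conclude 3 2 kills≤3 (subst (8 ≤_) (sym n≡) (ℕ.m≤n+m 8 (24 * m))) (s≤s (s≤s (s≤s (s≤s z≤n))))
    (λ i i≤L → kills₀ 4 (m * 4) (s≤s z≤n) refl refl i i≤L)
    (λ K → kills5 K , big K m refl)
    cap
    where
    big : KillsAll 4 → ∀ k → m ≡ k → 10 ≤ n × 5 ≤ suc m * 4
    big K zero e = ⊥-elim (m≢0 K e)
    big K (suc k) refl = subst (10 ≤_) (sym n≡)
      (ℕ.≤-trans (ℕ.m≤m+n 10 14) (ℕ.≤-trans (ℕ.*-monoʳ-≤ 24 (s≤s (z≤n {k}))) (ℕ.m≤m+n (24 * suc k) 8))) , s≤s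
      (s≤s (s≤s (s≤s (s≤s z≤n))))

-- The same pattern two degrees lower: d - L = 2, the degrees 4 and 6 lead to F and F², and the
-- union bypasses degree 5.
module Case₂ {n} (C : Code n) (des : IsDoublyEvenSelfDual C) (ext : IsExtremal C) (m : ℕ) (n≡ : n ≡ 24 * m + 16) where
  private
    n≡′ : n ≡ (suc m + ((2 + m * 4) + suc m)) * 4
    n≡′ = trans n≡ (l m)
      where
      l : ∀ m → 24 * m + 16 ≡ (suc m + ((2 + m * 4) + suc m)) * 4
      l = ℕ-Solver.solve-∀
    M≡ : ∀ m → suc m + ((2 + m * 4) + suc m) ≡ m * 6 + 2 * 2
    M≡ = ℕ-Solver.solve-∀
    dExt≡ : dExt n ≡ suc m * 4
    dExt≡ = trans (cong dExt n≡) (dExt-24 m 16 refl)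
  open Conclude C (proj₁ des) (proj₁ (proj₂ des)) (proj₂ (proj₂ des)) m (2 + m * 4) 2 0 refl n≡′ (M≡ m)
    (s≤s (s≤s (s≤s (ℕ.m≤n+m (m * 4) 1)))) (λ x x∈ pos → subst (_≤ ∣ x ∣) dExt≡ (proj₂ ext x x∈ pos)) dExt≡

  kills≤1 : ∀ k → 1 ≤ k → k ≤ 1 → KillsAll k
  kills≤1 = kills-below 1 ℕ.≤-refl

  kills3 : KillsAll 3
  kills3 = kills-one 3 (1 + m * 4) (s≤s z≤n) refl (ℕ.+-comm (1 + m * 4) 1)

  module _ (kills2 : KillsAll 2) where
    kills≤3 : ∀ k → 1 ≤ k → k ≤ 3 → KillsAll k
    kills≤3 = extend (extend kills≤1 kills2) kills3

    m≢0 : m ≢ 0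
    m≢0 refl = block-contradiction 2 (λ k k≥1 k≤2 → kills≤3 k k≥1 (ℕ.m≤n⇒m≤1+n k≤2)) blockFails-2

    no-6 : ∀ i → i ≤ 2 + m * 4 → KillsAt 4 i → KillsAt 6 i → check₂ m ≡ true → ∀ k → m ≡ suc k → Empty
    no-6 i i≤L K₄ K₆ h k refl with ∨-true {someBlockFails 3} h
    ... | inj₁ h₁ = someBlock-contradiction 3 kills≤3 h₁
    ... | inj₂ h₂ with ∧-true {nonvanishing Fˡ (4 + k * 4)} h₂
    ...   | nv₄ , h₃ = stage (∨-true {blockFails 4} h₃)
      where
      w₂ : k * 2 * 2 ≡ k * 4
      w₂ = ℕ.*-assoc k 2 2
      kills4 : KillsAll 4
      kills4 = kills₂ 4 (2 + k * 2) (s≤s z≤n) (cong (ℕ._+_ 8) w₂)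
        (trans (ℕ.+-comm (4 + k * 2 * 2) 2) (cong (ℕ._+_ 6) w₂))
        (subst (λ v → nonvanishing Fˡ (4 + v) ≡ true) (sym w₂) nv₄) i i≤L K₄
      kills≤4 : ∀ k → 1 ≤ k → k ≤ 4 → KillsAll k
      kills≤4 = extend kills≤3 kills4
      stage : blockFails 4 ≡ true ⊎ _ → Empty
      stage (inj₁ b) = block-contradiction 4 kills≤4 b
      stage (inj₂ h₄) with ∧-true {nonvanishing F²ˡ (2 + k * 4)} h₄
      ... | nv₆ , un = Union.contradictory 5 refl kills≢5 un
        where
        kills6 : KillsAll 6
        kills6 = kills₄ 6 (1 + k * 2) (s≤s z≤n) (cong (ℕ._+_ 8) w₂)
          (trans (ℕ.+-comm (2 + k * 2 * 2) 4) (cong (ℕ._+_ 6) w₂))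
          (subst (λ v → nonvanishing F²ˡ (2 + v) ≡ true) (sym w₂) nv₆) i i≤L K₆
        kills≢5 : ∀ j → 1 ≤ j → j ≤ 6 → j ≢ 5 → KillsAll j
        kills≢5 j j≥1 j≤ j≢5 with ℕ.m≤n⇒m<n∨m≡n j≤
        ... | inj₂ refl = kills6
        ... | inj₁ (s≤s j≤5) with ℕ.m≤n⇒m<n∨m≡n j≤5
        ...   | inj₂ refl = contradiction refl j≢5
        ...   | inj₁ (s≤s j≤4) = kills≤4 j j≥1 j≤4

    cap : ∀ i → i ≤ 2 + m * 4 → (∀ k → 1 ≤ k → k ≤ 6 → KillsAt k i) → Empty
    cap i i≤L K with m ℕ.<? 164
    ... | yes m<164 = no-6 i i≤L (K 4 (s≤s z≤n) (ℕ.m≤m+n 4 2)) (K 6 (s≤s z≤n) ℕ.≤-refl)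
      (below-true check₂ 164 checked₂ m m<164) (ℕ.pred m) (pos m refl)
      where
      pos : ∀ k → m ≡ k → m ≡ suc (ℕ.pred m)
      pos zero e = ⊥-elim (m≢0 e)
      pos (suc k) refl = refl
    ... | no m≮164 = second-nonneg (subst (λ k → second 0 k ℤ.< 0ℤ) (ℕ.m+[n∸m]≡n (ℕ.≮⇒≥ m≮164)) (second-negative₂ (m ∸ 164)))

  result : Conclusion C 1 5
  result = conclude 1 2 kills≤1 (n≥ 4 (s≤s (s≤s (s≤s (s≤s z≤n))))) (s≤s (s≤s z≤n))
    (λ i i≤L → kills₀ 2 (2 + m * 4) (s≤s z≤n) refl refl i i≤L)
    (λ _ → kills3 , n≥ 6 (ℕ.m≤m+n 6 10) , s≤s (s≤s (s≤s z≤n)))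
    cap
    where
    n≥ : ∀ k → k ≤ 16 → k ≤ n
    n≥ k k≤ = subst (k ≤_) (sym n≡) (ℕ.≤-trans k≤ (ℕ.m≤n+m 16 (24 * m)))

theorem1p3 : (n : ℕ) (C : Code n) → IsDoublyEvenSelfDual C → IsExtremal C →
    ((m : ℕ) → n ≡ 24 * m →
    Σ ℕ λ s → Σ ℕ λ δ → IsS C s × IsDelta C δ ×
    ((δ ≡ 5 × s ≡ 5) ⊎ (δ ≡ 7 × s ≡ 7)))
    × ((m : ℕ) → n ≡ 24 * m + 8 →
    Σ ℕ λ s → Σ ℕ λ δ → IsS C s × IsDelta C δ ×
    ((δ ≡ 3 × s ≡ 3) ⊎ (5 ≤ δ × δ ≤ s × s ≤ 7)))
    × ((m : ℕ) → n ≡ 24 * m + 16 →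
    Σ ℕ λ s → Σ ℕ λ δ → IsS C s × IsDelta C δ ×
    ((δ ≡ 1 × s ≡ 1) ⊎ (3 ≤ δ × δ ≤ s × s ≤ 5)))
theorem1p3 n C des ext = part₀ , (λ m e → Case₁.result C des ext m e) , (λ m e → Case₂.result C des ext m e)
  where
  part₀ : (m : ℕ) → n ≡ 24 * m → Σ ℕ λ s → Σ ℕ λ δ → IsS C s × IsDelta C δ × ((δ ≡ 5 × s ≡ 5) ⊎ (δ ≡ 7 × s ≡ 7))
  -- In length 0 extremality would demand a word of weight 4.
  part₀ zero refl = ⊥-elim (no-word (proj₁ ext))
    where
    no-word : ¬ (Σ (Subset 0) λ x → (x ∈C C) × ∣ x ∣ ≡ 4)
    no-word ([] , _ , ())
  part₀ (suc m) e = settle (Case₀.result C des ext m (trans e (sym (ℕ.+-identityʳ (24 * suc m)))))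
    where
    settle : Conclusion C 5 7 → Σ ℕ λ s → Σ ℕ λ δ → IsS C s × IsDelta C δ × ((δ ≡ 5 × s ≡ 5) ⊎ (δ ≡ 7 × s ≡ 7))
    settle (s , δ , S , D , inj₁ p) = s , δ , S , D , inj₁ p
    settle (s , δ , S , D , inj₂ (7≤δ , δ≤s , s≤7)) =
      s , δ , S , D , inj₂ (ℕ.≤-antisym (ℕ.≤-trans δ≤s s≤7) 7≤δ , ℕ.≤-antisym s≤7 (ℕ.≤-trans 7≤δ δ≤s))
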